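{- Let $q$ be a prime power and $G=\langle x,y\mid x^n=1=y^2,\ y^{ -1}xy=x^s\rangle$, where $s^2\equiv1\pmod n$ and $\gcd(2n,q)=1$, and let $d=\gcd(n,s-1)$. Then the primitive central idempotents of $\mathbb F_qG$ are exactly the following: (1) for each irreducible divisor $f$ of $x^d-1$ in $\mathbb F_q[x]$, the two idempotents $\frac{1+y}{2}e_f(x)$ and $\frac{1-y}{2}e_f(x)$; (2) for each $s$-self-involutive irreducible factor $f$ of $\frac{x^n-1}{x^d-1}$, the idempotent $e_f(x)$; (3) for each pair $\{f,f^{*_s}\}$ of irreducible factors of $\frac{x^n-1}{x^d-1}$ with $f\neq f^{*_s}$ (i.e. $f$ not $s$-self-involutive), the idempotent $e_f(x)+e_{f^{*_s}}(x)$.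
   Context: For a monic irreducible factor $f$ of $x^n-1$ in $\mathbb F_q[x]$, $e_f(x)=-\frac1n\,((f^*)')^*(x)\cdot\frac{x^n-1}{f(x)}$, viewed as an element of $\mathbb F_qG$ by substituting the group element $x$; here $g^*(x)=x^{\deg g}g(1/x)$ is the reciprocal polynomial, $'$ is the formal derivative, and the outer reciprocal of $(f^*)'$ is taken with respect to degree $\deg f-1$. (Equivalently, $e_f$ is the unique polynomial of degree $<n$ congruent to $1$ mod $f$ and to $0$ mod $(x^n-1)/f$.) For a monic $g(x)=(x-a_1)\cdots(x-a_k)$ with $g(0)\ne0$ and $s^2\equiv1\pmod{\mathrm{ord}(g)}$ (where $\mathrm{ord}(g)$ is the least $N\ge1$ with $g\mid x^N-1$), $g^{*_s}(x)=(x-a_1^s)\cdots(x-a_k^s)$, and $g$ is $s$-self-involutive if $g$ and $g^{*_s}$ have the same roots. -}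

module Defs where

open import Level using (0ℓ)
open import Algebra.Bundles using (CommutativeRing)
open import Data.Nat using (ℕ; zero; suc; _^_; _≥_; NonZero) renaming (_+_ to _+ℕ_; _*_ to _*ℕ_)
open import Data.Nat.DivMod using (_mod_)
open import Data.Nat.Primality using (Prime)
open import Data.Fin using (Fin; toℕ) renaming (zero to fzero; suc to fsuc)
open import Data.Fin.Properties using () renaming (_≟_ to _≟F_)
open import Data.List using (List; []; _∷_; _++_; map; replicate; reverse; foldr)
open import Data.List.Relation.Unary.Any using (Any)
open import Data.Product using (Σ; ∃; _×_; _,_)
open import Data.Product.Properties using (≡-dec)
open import Data.Sum using (_⊎_)
open import Data.Bool using (if_then_else_)
open import Relation.Nullary using (¬_; Dec)
open import Relation.Nullary.Decidable using (⌊_⌋)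
open import Relation.Binary.PropositionalEquality using (_≡_)

record Field : Set₁ where
  field
    commRing : CommutativeRing 0ℓ 0ℓ
  open CommutativeRing commRing public hiding (ring)
  field
    1≉0 : ¬ (1# ≈ 0#)
    inverse : ∀ x → ¬ (x ≈ 0#) → ∃ λ y → (x * y) ≈ 1#

IsPrimePower : ℕ → Set
IsPrimePower q = Σ ℕ λ p → Σ ℕ λ k → Prime p × k ≥ 1 × q ≡ p ^ k

-- Polynomials over a commutative ring, as coefficient lists
-- (constant term first); equality is coefficientwise, so trailing zeros
-- are irrelevant.

module Poly (R : CommutativeRing 0ℓ 0ℓ) where
  open CommutativeRing R

  Pol : Set
  Pol = List Carrier

  coeff : Pol → ℕ → Carrier
  coeff []      _       = 0#
  coeff (a ∷ p) zero    = a
  coeff (a ∷ p) (suc i) = coeff p i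

  infix 4 _≈ₚ_
  _≈ₚ_ : Pol → Pol → Set
  p ≈ₚ q = ∀ i → coeff p i ≈ coeff q i

  infixl 6 _+ₚ_
  _+ₚ_ : Pol → Pol → Pol
  []      +ₚ q       = q
  (a ∷ p) +ₚ []      = a ∷ p
  (a ∷ p) +ₚ (b ∷ q) = (a + b) ∷ (p +ₚ q)

  scale : Carrier → Pol → Pol
  scale c p = map (c *_) p

  infixl 7 _*ₚ_
  _*ₚ_ : Pol → Pol → Pol
  []      *ₚ q = []
  (a ∷ p) *ₚ q = scale a q +ₚ (0# ∷ (p *ₚ q))

  oneₚ : Pol
  oneₚ = 1# ∷ []

  Monic : Pol → Set
  Monic f = Σ Pol λ f' → f ≡ f' ++ (1# ∷ [])

  infix 4 _∣ₚ_
  _∣ₚ_ : Pol → Pol → Set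
  g ∣ₚ f = ∃ λ h → g *ₚ h ≈ₚ f

  IsUnit : Pol → Set
  IsUnit g = ∃ λ u → g *ₚ u ≈ₚ oneₚ

  Irreducible : Pol → Set
  Irreducible f = ¬ (f ≈ₚ []) × ¬ IsUnit f ×
                  (∀ g h → g *ₚ h ≈ₚ f → IsUnit g ⊎ IsUnit h)

  xpow : ℕ → Pol
  xpow n = replicate n 0# ++ (1# ∷ [])

  xⁿ-1 : ℕ → Pol
  xⁿ-1 n = xpow n +ₚ ((- 1#) ∷ [])

  nat : ℕ → Carrier
  nat zero    = 0#
  nat (suc k) = 1# + nat k

  pow : Carrier → ℕ → Carrier
  pow a zero    = 1#
  pow a (suc k) = a * pow a k

  derivFrom : ℕ → Pol → Pol
  derivFrom k []      = []
  derivFrom k (a ∷ p) = (nat k * a) ∷ derivFrom (suc k) p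

  deriv : Pol → Pol
  deriv []      = []
  deriv (a ∷ p) = derivFrom 1 p

  -- For a monic (normalised) f of degree m, 'reverse f' is the reciprocal
  -- f* = x^m f(1/x) (a list of length m+1); its derivative is a list of
  -- length m, whose reverse is the reciprocal of (f*)' taken w.r.t.
  -- degree m-1.  Given cn = -1/n and the cofactor g = (x^n-1)/f, this is
  -- the polynomial  -1/n ((f*)')*(x) (x^n-1)/f(x).
  efPoly : (cn : Carrier) (f g : Pol) → Pol
  efPoly cn f g = scale cn (reverse (deriv (reverse f))) *ₚ g

  linear : Carrier → Pol
  linear a = (- a) ∷ 1# ∷ []

  prodLin : List Carrier → Pol
  prodLin as = foldr (λ a p → linear a *ₚ p) oneₚ as

  _∈_ : Carrier → List Carrier → Set
  a ∈ as = Any (λ b → a ≈ b) as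

record Hom (F K : CommutativeRing 0ℓ 0ℓ) : Set where
  module F = CommutativeRing F
  module K = CommutativeRing K
  field
    ⟦_⟧   : F.Carrier → K.Carrier
    cong  : ∀ {a b} → a F.≈ b → ⟦ a ⟧ K.≈ ⟦ b ⟧
    +-hom : ∀ a b → ⟦ a F.+ b ⟧ K.≈ (⟦ a ⟧ K.+ ⟦ b ⟧)
    *-hom : ∀ a b → ⟦ a F.* b ⟧ K.≈ (⟦ a ⟧ K.* ⟦ b ⟧)
    1-hom : ⟦ F.1# ⟧ K.≈ K.1#

-- s-conjugate g^{*_s} and s-self-involutivity, relative to an extension
-- ι : F → K in which the relevant polynomials split.

module Involution (F K : CommutativeRing 0ℓ 0ℓ) (ι : Hom F K) (s : ℕ) where
  module PF = Poly F
  module PK = Poly K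
  open Hom ι using (⟦_⟧)

  mapP : PF.Pol → PK.Pol
  mapP = map ⟦_⟧

  IsStarS : PF.Pol → PF.Pol → Set
  IsStarS g h = PF.Monic h × Σ (List (CommutativeRing.Carrier K)) λ as →
     (mapP g PK.≈ₚ PK.prodLin as) ×
     (mapP h PK.≈ₚ PK.prodLin (map (λ a → PK.pow a s) as))

  SelfInvolutive : PF.Pol → Set
  SelfInvolutive g = Σ (List (CommutativeRing.Carrier K)) λ as →
     (mapP g PK.≈ₚ PK.prodLin as) ×
     (∀ a → a PK.∈ as → PK.pow a s PK.∈ as) ×
     (∀ a → a PK.∈ as → ∃ λ b → b PK.∈ as ×
                          CommutativeRing._≈_ K (PK.pow b s) a)

-- The group algebra R G for G = ⟨x,y | x^n = 1 = y^2, y⁻¹xy = x^s⟩.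
-- Group elements are normal forms x^i y^j (i : Fin n, j : Fin 2); since
-- y x^k = x^{k s} y, we have x^i y^j · x^k y^l = x^{i + k s^j} y^{j+l}.

module GroupAlgebra (R : CommutativeRing 0ℓ 0ℓ) (n : ℕ) .{{_ : NonZero n}} (s : ℕ) where
  open CommutativeRing R
  open Poly R using (Pol)

  G : Set
  G = Fin n × Fin 2

  _·_ : G → G → G
  (i , j) · (k , l) = ((toℕ i +ℕ toℕ k *ℕ s ^ toℕ j) mod n , (toℕ j +ℕ toℕ l) mod 2)

  _≟G_ : (a b : G) → Dec (a ≡ b)
  _≟G_ = ≡-dec (_≟F_ {n}) (_≟F_ {2})

  -- elements of RG: functions G → R (finite support automatically)
  RG : Set
  RG = G → Carrier

  sumFin : ∀ {m} → (Fin m → Carrier) → Carrier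
  sumFin {zero}  f = 0#
  sumFin {suc m} f = f fzero + sumFin (λ i → f (fsuc i))

  sumG : (G → Carrier) → Carrier
  sumG f = sumFin λ i → sumFin λ j → f (i , j)

  infix 4 _≈G_
  _≈G_ : RG → RG → Set
  a ≈G b = ∀ g → a g ≈ b g

  infixl 6 _+G_
  _+G_ : RG → RG → RG
  (a +G b) g = a g + b g

  -G_ : RG → RG
  (-G a) g = - a g

  infixl 7 _⋆_
  _⋆_ : RG → RG → RG
  (a ⋆ b) g = sumG λ h → sumG λ k →
              if ⌊ (h · k) ≟G g ⌋ then a h * b k else 0#

  scaleG : Carrier → RG → RG
  scaleG c a g = c * a g

  0G : RG
  0G _ = 0#

  δ : G → RG
  δ h g = if ⌊ h ≟G g ⌋ then 1# else 0#

  1G : RG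
  1G = δ (0 mod n , fzero)

  yG : RG
  yG = δ (0 mod n , fsuc fzero)

  toRGFrom : ℕ → Pol → RG
  toRGFrom k []      = 0G
  toRGFrom k (a ∷ p) = scaleG a (δ (k mod n , fzero)) +G toRGFrom (suc k) p

  toRG : Pol → RG
  toRG = toRGFrom 0

  Central : RG → Set
  Central e = ∀ b → e ⋆ b ≈G b ⋆ e

  Idempotent : RG → Set
  Idempotent e = e ⋆ e ≈G e

  PrimitiveCentralIdempotent : RG → Set
  PrimitiveCentralIdempotent e =
    Central e × Idempotent e × ¬ (e ≈G 0G) ×
    (∀ e' → Central e' → Idempotent e' → e ⋆ e' ≈G e' → e' ≈G 0G ⊎ e' ≈G e)

-- The list of idempotents in Theorem 5.3.
-- cn plays the role of -1/n and c2 of 1/2 in F.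

module Theorem (F K : CommutativeRing 0ℓ 0ℓ) (ι : Hom F K)
               (n : ℕ) .{{_ : NonZero n}} (s d : ℕ)
               (cn c2 : CommutativeRing.Carrier F) where
  open CommutativeRing F
  open Poly F
  open GroupAlgebra F n s
  open Involution F K ι s

  IsEf : Pol → RG → Set
  IsEf f e = Σ Pol λ g → (f *ₚ g ≈ₚ xⁿ-1 n) × (e ≈G toRG (efPoly cn f g))

  IrrFactorOfQuot : Pol → Set
  IrrFactorOfQuot f = Monic f × Irreducible f ×
    Σ Pol λ Q → (Q *ₚ xⁿ-1 d ≈ₚ xⁿ-1 n) × (f ∣ₚ Q)

  Listed : RG → Set
  Listed e =
      (Σ Pol λ f → Σ RG λ ef → Monic f × Irreducible f × (f ∣ₚ xⁿ-1 d) ×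
          IsEf f ef ×
          (e ≈G scaleG c2 (1G +G yG) ⋆ ef  ⊎  e ≈G scaleG c2 (1G +G (-G yG)) ⋆ ef))
    ⊎
      (Σ Pol λ f → IrrFactorOfQuot f × SelfInvolutive f × IsEf f e)
    ⊎
      (Σ Pol λ f → Σ Pol λ h → Σ RG λ ef → Σ RG λ eh →
          IrrFactorOfQuot f × IrrFactorOfQuot h × IsStarS f h × ¬ (f ≈ₚ h) ×
          IsEf f ef × IsEf h eh × e ≈G ef +G eh)

{-# OPTIONS --safe #-}
module Submission where

-- Let R = F[x]/(xⁿ - 1) and let σ be the substitution x ↦ x^s on R.  Then FG = R ⊕ R y with
-- y r = σ(r) y, and a + b y is central iff σ fixes a and b and b kills every σ(r) - r.  R is a
-- product of fields with primitive idempotents e_f, and σ acts trivially on the component of f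
-- iff f ∣ x^d - 1.  On the other components b vanishes, so the primitive central idempotents
-- there are the sums of the e_f over the orbits of σ; on a component with f ∣ x^d - 1 the algebra
-- is F[x]/(f) ⊕ F[x]/(f) y, which splits by (1 ± y)/2.  Conversely, a primitive central idempotent
-- is nonzero on some component, so its product with a listed idempotent is nonzero, and two
-- primitive central idempotents with nonzero product are equal.
--
-- The conditions on roots in K amount to f ∣ f(x^s), respectively f ∣ h(x^s) and h ∣ f(x^s), by
-- Bézout.  As K is not assumed to have decidable equality, lists of roots in K are obtained as
-- images of lists of roots in a finite field L, F → L → K, in which xⁿ - 1 splits; L is built by
-- adjoining one root at a time.

open import Defs
open import Level using (0ℓ)
open import Algebra.Bundles using (CommutativeRing; CommutativeMonoid; RawRing)
open import Algebra.Structures using (IsCommutativeRing; IsCommutativeMonoid)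
import Algebra.Solver.Ring as RingSolver
import Algebra.Solver.Ring.AlmostCommutativeRing as ACR
open import Data.Bool using (if_then_else_)
open import Data.Empty using (⊥; ⊥-elim)
open import Data.Fin as Fin using (Fin; toℕ) renaming (zero to fzero; suc to fsuc)
import Data.Fin.Properties as Finₚ
open import Data.Integer as ℤ using (ℤ; +_; -[1+_])
import Data.Integer.Properties as ℤₚ
open import Data.List using (List; []; _∷_; map; _++_; length; reverse; replicate; tabulate)
import Data.List.Properties as Listₚ
open import Data.List.Relation.Unary.All as All using (All; []; _∷_)
import Data.List.Relation.Unary.All.Properties as Allₚ
open import Data.List.Relation.Unary.AllPairs using (AllPairs; []; _∷_)
import Data.List.Relation.Unary.AllPairs.Properties as AllPairsₚ
open import Data.List.Relation.Unary.Any as Any using (here; there)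
import Data.List.Relation.Unary.Any.Properties as Anyₚ
open import Data.Maybe using (Maybe; just; nothing)
open import Data.Nat as ℕ using (ℕ; zero; suc; _≤_; _<_; z≤n; s≤s; NonZero; _∸_)
open import Data.Nat.DivMod using (_%_; _/_; _mod_; m≡m%n+[m/n]*n; m%n<n; m%n%n≡m%n; %-distribˡ-+; %-distribˡ-*; m<n⇒m%n≡m; [m+n]%n≡m%n)
open import Data.Nat.Divisibility using (divides) renaming (_∣_ to _∣ℕ_)
open import Data.Nat.GCD using (GCD; module GCD; module Bézout; gcd; gcd-GCD)
import Data.Nat.Properties as ℕₚ
open import Data.Product using (Σ; ∃; _×_; _,_; proj₁; proj₂)
import Data.Sign as Sign
open import Data.Sum as Sum using (_⊎_; inj₁; inj₂; [_,_]′)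
open import Data.Unit using (⊤)
open import Function using (_∘_)
open import Function.Bundles using (Bijection; Equivalence; _⇔_; mk⇔)
open import Relation.Binary.Definitions using (tri<; tri≈; tri>)
import Relation.Binary.PropositionalEquality as ≡
open ≡ using (_≡_; _≢_)
open import Relation.Nullary using (¬_; yes; no; Dec)
open import Relation.Nullary.Decidable using (⌊_⌋; map′; ¬?; _×-dec_)

-- The decomposition of R into fields is never formed. The component of f enters through e_f ≡ 1 mod
-- f and e_f ≡ 0 mod g, where f g = xⁿ - 1: multiplication by e_f kills a in R exactly when f
-- divides a, so every statement about components becomes a divisibility in F[x]. Coprimality of f
-- and g and the formula for e_f have one source: differentiating f g = xⁿ - 1 and multiplying by x
-- gives x f′ g ≡ n mod f, while ((f*)′)* is congruent to -x f′ mod f; hence the constant -1/n. The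
-- map L → K needs, at each stage, one root in K of an irreducible φ dividing xⁿ - 1. The given list
-- of roots cannot be searched for it. The Bézout identity for φ and its cofactor supplies at each
-- listed r an idempotent that is 1 if φ(r) = 0 and 0 if φ(r) is invertible, and with these weights
-- the listed elements are combined into a root. An idempotent of a field that differs from 1 is
-- equal to 0, which turns the merely negative knowledge that φ cannot be invertible at all r into
-- an equation.

CR : Set₁
CR = CommutativeRing 0ℓ 0ℓ

-- Commutative rings: integer-coefficient solver, homomorphisms, divisibility, quotients.

module IntegerSolver (R : CR) where
  open CommutativeRing R
  open import Relation.Binary.Reasoning.Setoid setoid
  open import Algebra.Properties.Ring ring
  open import Algebra.Properties.AbelianGroup +-abelianGroup using (⁻¹-∙-comm)
  open import Algebra.Properties.Semiring.Mult.TCOptimised semiring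
    using (×-homo-+; ×1-homo-*) renaming (_×_ to _∙_)
  import Data.Nat as N

  -- Normal forms of the ring solver compare coefficients, and equality in `R` need not be
  -- decidable. Coefficients from the integers, mapped to multiples of 1, let terms such as x - x
  -- cancel in every commutative ring.
  ⟦_⟧ℤ : ℤ → Carrier
  ⟦ + n ⟧ℤ      = n ∙ 1#
  ⟦ -[1+ n ] ⟧ℤ = - (suc n ∙ 1#)

  private
    cancel : ∀ a b c → a + b + - (a + c) ≈ b + - c
    cancel a b c = begin
      a + b + - (a + c)      ≈⟨ +-cong (+-comm a b) (sym (⁻¹-∙-comm a c)) ⟩
      b + a + (- a + - c)    ≈⟨ +-assoc b a _ ⟩
      b + (a + (- a + - c))  ≈⟨ +-congˡ (sym (+-assoc a _ _)) ⟩
      b + (a + - a + - c)    ≈⟨ +-congˡ (+-congʳ (-‿inverseʳ a)) ⟩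
      b + (0# + - c)         ≈⟨ +-congˡ (+-identityˡ _) ⟩
      b + - c                ∎

    ⊖-homo : ∀ m n → ⟦ m ℤ.⊖ n ⟧ℤ ≈ m ∙ 1# + - (n ∙ 1#)
    ⊖-homo zero    zero    = sym (trans (+-identityˡ _) -0#≈0#)
    ⊖-homo (suc m) zero    = sym (trans (+-congˡ -0#≈0#) (+-identityʳ _))
    ⊖-homo zero    (suc n) = sym (+-identityˡ _)
    ⊖-homo (suc m) (suc n) = begin
      ⟦ suc m ℤ.⊖ suc n ⟧ℤ                     ≡⟨ ≡.cong ⟦_⟧ℤ (ℤₚ.[1+m]⊖[1+n]≡m⊖n m n) ⟩
      ⟦ m ℤ.⊖ n ⟧ℤ                             ≈⟨ ⊖-homo m n ⟩
      m ∙ 1# + - (n ∙ 1#)                      ≈⟨ sym (cancel 1# _ _) ⟩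
      1# + m ∙ 1# + - (1# + n ∙ 1#)
        ≈⟨ sym (+-cong (×-homo-+ 1# 1 m) (-‿cong (×-homo-+ 1# 1 n))) ⟩
      suc m ∙ 1# + - (suc n ∙ 1#)              ∎

    +-homo : ∀ i j → ⟦ i ℤ.+ j ⟧ℤ ≈ ⟦ i ⟧ℤ + ⟦ j ⟧ℤ
    +-homo (+ m)    (+ n)    = ×-homo-+ 1# m n
    +-homo (+ m)    -[1+ n ] = ⊖-homo m (suc n)
    +-homo -[1+ m ] (+ n)    = trans (⊖-homo n (suc m)) (+-comm _ _)
    +-homo -[1+ m ] -[1+ n ] = begin
      - (suc (suc (m N.+ n)) ∙ 1#)
        ≡⟨ ≡.cong (λ k → - (k ∙ 1#)) (≡.cong suc (≡.sym (+-suc m n))) ⟩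
      - ((suc m N.+ suc n) ∙ 1#)            ≈⟨ -‿cong (×-homo-+ 1# (suc m) (suc n)) ⟩
      - (suc m ∙ 1# + suc n ∙ 1#)           ≈⟨ sym (⁻¹-∙-comm _ _) ⟩
      - (suc m ∙ 1#) + - (suc n ∙ 1#)       ∎
      where open import Data.Nat.Properties using (+-suc)

    neg◃ : ∀ k → ⟦ Sign.- ℤ.◃ k ⟧ℤ ≈ - (k ∙ 1#)
    neg◃ zero    = sym -0#≈0#
    neg◃ (suc k) = refl

    pos◃ : ∀ k → ⟦ Sign.+ ℤ.◃ k ⟧ℤ ≈ k ∙ 1#
    pos◃ zero    = refl
    pos◃ (suc k) = refl

    *-homo : ∀ i j → ⟦ i ℤ.* j ⟧ℤ ≈ ⟦ i ⟧ℤ * ⟦ j ⟧ℤ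
    *-homo (+ m)    (+ n)    = trans (pos◃ (m N.* n)) (×1-homo-* m n)
    *-homo (+ m)    -[1+ n ] = begin
      ⟦ Sign.- ℤ.◃ (m N.* suc n) ⟧ℤ ≈⟨ neg◃ (m N.* suc n) ⟩
      - ((m N.* suc n) ∙ 1#)        ≈⟨ -‿cong (×1-homo-* m (suc n)) ⟩
      - (m ∙ 1# * (suc n ∙ 1#))     ≈⟨ -‿distribʳ-* _ _ ⟩
      m ∙ 1# * - (suc n ∙ 1#)       ∎
    *-homo -[1+ m ] (+ n)    = begin
      ⟦ Sign.- ℤ.◃ (suc m N.* n) ⟧ℤ ≈⟨ neg◃ (suc m N.* n) ⟩
      - ((suc m N.* n) ∙ 1#)        ≈⟨ -‿cong (×1-homo-* (suc m) n) ⟩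
      - (suc m ∙ 1# * (n ∙ 1#))     ≈⟨ -‿distribˡ-* _ _ ⟩
      - (suc m ∙ 1#) * (n ∙ 1#)     ∎
    *-homo -[1+ m ] -[1+ n ] = begin
      (suc m N.* suc n) ∙ 1#              ≈⟨ ×1-homo-* (suc m) (suc n) ⟩
      suc m ∙ 1# * (suc n ∙ 1#)           ≈⟨ sym (-‿involutive _) ⟩
      - (- (suc m ∙ 1# * (suc n ∙ 1#)))   ≈⟨ -‿cong (-‿distribˡ-* _ _) ⟩
      - (- (suc m ∙ 1#) * (suc n ∙ 1#))   ≈⟨ -‿distribʳ-* _ _ ⟩
      - (suc m ∙ 1#) * - (suc n ∙ 1#)     ∎

    -‿homo : ∀ i → ⟦ ℤ.- i ⟧ℤ ≈ - ⟦ i ⟧ℤ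
    -‿homo (+ zero)  = sym -0#≈0#
    -‿homo (+ suc n) = refl
    -‿homo -[1+ n ]  = sym (-‿involutive _)

    ℤ-raw : RawRing 0ℓ 0ℓ
    ℤ-raw = record { Carrier = ℤ ; _≈_ = _≡_ ; _+_ = ℤ._+_ ; _*_ = ℤ._*_
                   ; -_ = ℤ.-_ ; 0# = + 0 ; 1# = + 1 }

    acr : ACR.AlmostCommutativeRing 0ℓ 0ℓ
    acr = ACR.fromCommutativeRing R

    morphism : ℤ-raw ACR.-Raw-AlmostCommutative⟶ acr
    morphism = record { ⟦_⟧ = ⟦_⟧ℤ ; +-homo = +-homo ; *-homo = *-homo
                      ; -‿homo = -‿homo ; 0-homo = refl ; 1-homo = refl }

    _≟ᶜ_ : ∀ i j → Maybe (⟦ i ⟧ℤ ≈ ⟦ j ⟧ℤ)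
    i ≟ᶜ j with i ℤ.≟ j
    ... | yes ≡.refl = just refl
    ... | no  _      = nothing

  open RingSolver ℤ-raw acr morphism _≟ᶜ_ public
    using (solve; Polynomial; _:=_; _:+_; _:*_; _:-_; :-_; con)

  :0 :1 : ∀ {k} → Polynomial k
  :0 = con (+ 0)
  :1 = con (+ 1)

module HomProperties {A B : CR} (h : Hom A B) where
  private
    module A = CommutativeRing A
    module B = CommutativeRing B
  open Hom h
  open IntegerSolver B
  open import Relation.Binary.Reasoning.Setoid B.setoid

  -- `Hom` records sums, products and 1 only, so 0 comes from 0 + 0 = 0 by cancellation.
  0-hom : ⟦ A.0# ⟧ B.≈ B.0#
  0-hom = begin
    ⟦ A.0# ⟧ ≈⟨ solve 1 (λ a → a := a :+ a :- a) B.refl ⟦ A.0# ⟧ ⟩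
    ⟦ A.0# ⟧ B.+ ⟦ A.0# ⟧ B.+ B.- ⟦ A.0# ⟧ ≈⟨ B.+-congʳ (B.sym (+-hom _ _)) ⟩
    ⟦ A.0# A.+ A.0# ⟧ B.+ B.- ⟦ A.0# ⟧ ≈⟨ B.+-congʳ (cong (A.+-identityˡ _)) ⟩
    ⟦ A.0# ⟧ B.+ B.- ⟦ A.0# ⟧ ≈⟨ B.-‿inverseʳ _ ⟩
    B.0# ∎

  neg-hom : ∀ a → ⟦ A.- a ⟧ B.≈ B.- ⟦ a ⟧
  neg-hom a = begin
    ⟦ A.- a ⟧ ≈⟨ solve 2 (λ a b → b := a :+ b :- a) B.refl ⟦ a ⟧ _ ⟩
    ⟦ a ⟧ B.+ ⟦ A.- a ⟧ B.+ B.- ⟦ a ⟧ ≈⟨ B.+-congʳ (B.sym (+-hom _ _)) ⟩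
    ⟦ a A.+ A.- a ⟧ B.+ B.- ⟦ a ⟧ ≈⟨ B.+-congʳ (B.trans (cong (A.-‿inverseʳ _)) 0-hom) ⟩
    B.0# B.+ B.- ⟦ a ⟧ ≈⟨ B.+-identityˡ _ ⟩
    B.- ⟦ a ⟧ ∎

  sub-hom : ∀ a b → ⟦ a A.- b ⟧ B.≈ ⟦ a ⟧ B.- ⟦ b ⟧
  sub-hom a b = B.trans (+-hom a _) (B.+-congˡ (neg-hom b))

  nat-hom : ∀ k → ⟦ Poly.nat A k ⟧ B.≈ Poly.nat B k
  nat-hom zero    = 0-hom
  nat-hom (suc k) = B.trans (+-hom _ _) (B.+-cong 1-hom (nat-hom k))

  pow-hom : ∀ a k → ⟦ Poly.pow A a k ⟧ B.≈ Poly.pow B ⟦ a ⟧ k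
  pow-hom a zero    = 1-hom
  pow-hom a (suc k) = B.trans (*-hom _ _) (B.*-congˡ (pow-hom a k))

idHom : (A : CR) → Hom A A
idHom A = record { ⟦_⟧ = λ a → a ; cong = λ e → e ; +-hom = λ _ _ → refl
                 ; *-hom = λ _ _ → refl ; 1-hom = refl }
  where open CommutativeRing A

infixr 9 _∘ʰ_
_∘ʰ_ : ∀ {A B C : CR} → Hom B C → Hom A B → Hom A C
_∘ʰ_ {C = C} g f = record
  { ⟦_⟧   = λ a → G.⟦ F.⟦ a ⟧ ⟧
  ; cong  = λ e → G.cong (F.cong e)
  ; +-hom = λ a b → trans (G.cong (F.+-hom a b)) (G.+-hom _ _)
  ; *-hom = λ a b → trans (G.cong (F.*-hom a b)) (G.*-hom _ _)
  ; 1-hom = trans (G.cong F.1-hom) G.1-hom }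
  where
  module F = Hom f
  module G = Hom g
  open CommutativeRing C

module Divisibility (R : CR) where
  open CommutativeRing R
  open IntegerSolver R

  infix 4 _∣_ _by_
  record _∣_ (a b : Carrier) : Set where
    constructor _by_
    field
      cofactor : Carrier
      product  : a * cofactor ≈ b
  open _∣_ public

  ∣-refl : ∀ {a} → a ∣ a
  ∣-refl = 1# by *-identityʳ _

  ∣-reflexive : ∀ {a b} → a ≈ b → a ∣ b
  ∣-reflexive e = 1# by trans (*-identityʳ _) e

  ∣-trans : ∀ {a b c} → a ∣ b → b ∣ c → a ∣ c
  ∣-trans (x by p) (y by q) = x * y by trans (sym (*-assoc _ _ _)) (trans (*-congʳ p) q)

  ∣-respʳ : ∀ {a b c} → b ≈ c → a ∣ b → a ∣ c
  ∣-respʳ e (x by p) = x by trans p e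

  ∣-respˡ : ∀ {a b c} → a ≈ b → a ∣ c → b ∣ c
  ∣-respˡ e (x by p) = x by trans (*-congʳ (sym e)) p

  ∣0 : ∀ {a} → a ∣ 0#
  ∣0 = 0# by zeroʳ _

  ∣+ : ∀ {a b c} → a ∣ b → a ∣ c → a ∣ (b + c)
  ∣+ (x by p) (y by q) = x + y by trans (distribˡ _ _ _) (+-cong p q)

  ∣neg : ∀ {a b} → a ∣ b → a ∣ (- b)
  ∣neg {a} (x by p) = - x by trans (solve 2 (λ a x → a :* (:- x) := :- (a :* x)) refl a x) (-‿cong p)

  ∣- : ∀ {a b c} → a ∣ b → a ∣ c → a ∣ (b - c)
  ∣- p q = ∣+ p (∣neg q)

  ∣*ʳ : ∀ {a b} c → a ∣ b → a ∣ (b * c)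
  ∣*ʳ c (x by p) = x * c by trans (sym (*-assoc _ _ _)) (*-congʳ p)

  ∣*ˡ : ∀ {a b} c → a ∣ b → a ∣ (c * b)
  ∣*ˡ c p = ∣-respʳ (*-comm _ _) (∣*ʳ c p)

  m∣m* : ∀ {a} b → a ∣ (a * b)
  m∣m* b = b by refl

  m∣*m : ∀ {a} b → a ∣ (b * a)
  m∣*m b = b by *-comm _ _

  ∣*∣ : ∀ {a b c d} → a ∣ b → c ∣ d → (a * c) ∣ (b * d)
  ∣*∣ {a} {b} {c} {d} (x by p) (y by q) = x * y by
    trans (solve 4 (λ a c x y → a :* c :* (x :* y) := a :* x :* (c :* y)) refl a c x y) (*-cong p q)

hom-∣ : ∀ {A B : CR} (h : Hom A B) {a b} → Divisibility._∣_ A a b →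
        Divisibility._∣_ B (Hom.⟦_⟧ h a) (Hom.⟦_⟧ h b)
hom-∣ {A} {B} h (c Divisibility.by p) = Hom.⟦_⟧ h c Divisibility.by CommutativeRing.trans B
  (CommutativeRing.sym B (Hom.*-hom h _ _)) (Hom.cong h p)

module Quotient (R : CR) (m : CommutativeRing.Carrier R) where
  open CommutativeRing R
  open Divisibility R
  open IntegerSolver R

  infix 4 _≈/_
  -- The quotient ring keeps the carrier of `R` and only coarsens equality; so `π` is the identity
  -- on elements and no representatives are chosen.
  record _≈/_ (a b : Carrier) : Set where
    constructor mk/
    field un/ : m ∣ (a - b)
  open _≈/_ public

  ≈⇒≈/ : ∀ {a b} → a ≈ b → a ≈/ b
  ≈⇒≈/ {a} {b} e = mk/ (∣-respʳ (sym (trans (+-congʳ e) (-‿inverseʳ b))) ∣0)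

  private
    sym/ : ∀ {a b} → a ≈/ b → b ≈/ a
    sym/ {a} {b} (mk/ p) =
      mk/ (∣-respʳ (solve 2 (λ a b → :- (a :- b) := b :- a) refl a b) (∣neg p))
    trans/ : ∀ {a b c} → a ≈/ b → b ≈/ c → a ≈/ c
    trans/ {a} {b} {c} (mk/ p) (mk/ q) = mk/ (∣-respʳ
      (solve 3 (λ a b c → a :- b :+ (b :- c) := a :- c) refl a b c) (∣+ p q))
    +-cong/ : ∀ {a b c d} → a ≈/ b → c ≈/ d → (a + c) ≈/ (b + d)
    +-cong/ {a} {b} {c} {d} (mk/ p) (mk/ q) = mk/ (∣-respʳ
      (solve 4 (λ a b c d → a :- b :+ (c :- d) := a :+ c :- (b :+ d)) refl a b c d) (∣+ p q))
    *-cong/ : ∀ {a b c d} → a ≈/ b → c ≈/ d → (a * c) ≈/ (b * d)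
    *-cong/ {a} {b} {c} {d} (mk/ p) (mk/ q) = mk/ (∣-respʳ
      (solve 4 (λ a b c d → (a :- b) :* c :+ b :* (c :- d) := a :* c :- b :* d) refl a b c d)
      (∣+ (∣*ʳ c p) (∣*ˡ b q)))
    neg-cong/ : ∀ {a b} → a ≈/ b → (- a) ≈/ (- b)
    neg-cong/ {a} {b} (mk/ p) = mk/ (∣-respʳ
      (solve 2 (λ a b → :- (a :- b) := :- a :- (:- b)) refl a b) (∣neg p))

  isCommutativeRing/ : IsCommutativeRing _≈/_ _+_ _*_ -_ 0# 1#
  isCommutativeRing/ = record
    { isRing = record
      { +-isAbelianGroup = record
        { isGroup = record
          { isMonoid = record
            { isSemigroup = record
              { isMagma = record
                { isEquivalence = record { refl = ≈⇒≈/ refl ; sym = sym/ ; trans = trans/ }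
                ; ∙-cong = +-cong/ }
              ; assoc = λ a b c → ≈⇒≈/ (+-assoc a b c) }
            ; identity = (λ a → ≈⇒≈/ (+-identityˡ a)) , (λ a → ≈⇒≈/ (+-identityʳ a)) }
          ; inverse = (λ a → ≈⇒≈/ (-‿inverseˡ a)) , (λ a → ≈⇒≈/ (-‿inverseʳ a))
          ; ⁻¹-cong = neg-cong/ }
        ; comm = λ a b → ≈⇒≈/ (+-comm a b) }
      ; *-cong = *-cong/
      ; *-assoc = λ a b c → ≈⇒≈/ (*-assoc a b c)
      ; *-identity = (λ a → ≈⇒≈/ (*-identityˡ a)) , (λ a → ≈⇒≈/ (*-identityʳ a))
      ; distrib = (λ a b c → ≈⇒≈/ (distribˡ a b c)) , (λ a b c → ≈⇒≈/ (distribʳ a b c)) }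
    ; *-comm = λ a b → ≈⇒≈/ (*-comm a b) }

  quotient : CR
  quotient = record { isCommutativeRing = isCommutativeRing/ }

  π : Hom R quotient
  π = record { ⟦_⟧ = λ a → a ; cong = ≈⇒≈/ ; +-hom = λ _ _ → ≈⇒≈/ refl
             ; *-hom = λ _ _ → ≈⇒≈/ refl ; 1-hom = ≈⇒≈/ refl }

  ≈/0⇒∣ : ∀ {a} → a ≈/ 0# → m ∣ a
  ≈/0⇒∣ {a} (mk/ p) = ∣-respʳ (solve 1 (λ a → a :- :0 := a) refl a) p

  ∣⇒≈/0 : ∀ {a} → m ∣ a → a ≈/ 0#
  ∣⇒≈/0 {a} p = mk/ (∣-respʳ (solve 1 (λ a → a := a :- :0) refl a) p)

  -- Well defined because a = (a - b) + b and a - b is a multiple of `m`, which `h` sends to 0.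
  lift : ∀ {S : CR} (h : Hom R S) →
         CommutativeRing._≈_ S (Hom.⟦_⟧ h m) (CommutativeRing.0# S) → Hom quotient S
  lift {S} h hm = record { ⟦_⟧ = ⟦_⟧ ; cong = cong/ ; +-hom = +-hom ; *-hom = *-hom ; 1-hom = 1-hom }
    where
    open Hom h
    open HomProperties h
    module S = CommutativeRing S
    module SS = IntegerSolver S
    cong/ : ∀ {a b} → a ≈/ b → ⟦ a ⟧ S.≈ ⟦ b ⟧
    cong/ {a} {b} (mk/ (c by p)) = S.trans
      (SS.solve 2 (λ a b → a SS.:= a SS.:- b SS.:+ b) S.refl ⟦ a ⟧ ⟦ b ⟧)
      (S.trans (S.+-congʳ (S.trans (S.sym (sub-hom a b)) (S.trans (cong (sym p))
        (S.trans (*-hom _ _) (S.trans (S.*-congʳ hm) (S.zeroˡ _)))))) (S.+-identityˡ _))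

-- Polynomials as a commutative ring; evaluation and change of coefficients.

module PolynomialRing (R : CR) where
  open CommutativeRing R
  open Poly R
  open IntegerSolver R

  infix 4 _≋_
  -- The relation `_≈ₚ_` unfolds to a family of equations from which `p` and `q` cannot be inferred;
  -- the record wrapper keeps both visible to unification.
  record _≋_ (p q : Pol) : Set where
    constructor mk≋
    field at : p ≈ₚ q
  open _≋_ public

  coeff-+ : ∀ p q i → coeff (p +ₚ q) i ≈ coeff p i + coeff q i
  coeff-+ []      q       i       = sym (+-identityˡ _)
  coeff-+ (a ∷ p) []      i       = sym (+-identityʳ _)
  coeff-+ (a ∷ p) (b ∷ q) zero    = refl
  coeff-+ (a ∷ p) (b ∷ q) (suc i) = coeff-+ p q i

  coeff-scale : ∀ c p i → coeff (scale c p) i ≈ c * coeff p i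
  coeff-scale c []      i       = sym (zeroʳ c)
  coeff-scale c (a ∷ p) zero    = refl
  coeff-scale c (a ∷ p) (suc i) = coeff-scale c p i

  negₚ : Pol → Pol
  negₚ = map (λ a → - a)

  coeff-neg : ∀ p i → coeff (negₚ p) i ≈ - coeff p i
  coeff-neg []      i       = solve 0 (:0 := :- :0) refl
  coeff-neg (a ∷ p) zero    = refl
  coeff-neg (a ∷ p) (suc i) = coeff-neg p i

  ≋-refl : ∀ {p} → p ≋ p
  ≋-refl = mk≋ λ i → refl

  ≋-sym : ∀ {p q} → p ≋ q → q ≋ p
  ≋-sym (mk≋ e) = mk≋ λ i → sym (e i)

  ≋-trans : ∀ {p q r} → p ≋ q → q ≋ r → p ≋ r
  ≋-trans (mk≋ e) (mk≋ f) = mk≋ λ i → trans (e i) (f i)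

  ∷-cong : ∀ {a b p q} → a ≈ b → p ≋ q → (a ∷ p) ≋ (b ∷ q)
  ∷-cong e (mk≋ f) = mk≋ λ where
    zero    → e
    (suc i) → f i

  0∷[] : ∀ {p} → p ≋ [] → (0# ∷ p) ≋ []
  0∷[] (mk≋ e) = mk≋ λ where
    zero    → refl
    (suc i) → e i

  ∷-tail : ∀ {a b p q} → (a ∷ p) ≋ (b ∷ q) → p ≋ q
  ∷-tail (mk≋ e) = mk≋ λ i → e (suc i)

  ∷-tail[] : ∀ {a p} → (a ∷ p) ≋ [] → p ≋ []
  ∷-tail[] (mk≋ e) = mk≋ λ i → e (suc i)

  +ₚ-cong : ∀ {p p' q q'} → p ≋ p' → q ≋ q' → (p +ₚ q) ≋ (p' +ₚ q')
  +ₚ-cong {p} {p'} {q} {q'} (mk≋ e) (mk≋ f) = mk≋ λ i →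
    trans (coeff-+ p q i) (trans (+-cong (e i) (f i)) (sym (coeff-+ p' q' i)))

  +ₚ-assoc : ∀ p q r → (p +ₚ q +ₚ r) ≋ (p +ₚ (q +ₚ r))
  +ₚ-assoc p q r = mk≋ λ i → trans (coeff-+ (p +ₚ q) r i) (trans (+-congʳ (coeff-+ p q i))
    (trans (+-assoc _ _ _) (sym (trans (coeff-+ p (q +ₚ r) i) (+-congˡ (coeff-+ q r i))))))

  +ₚ-comm : ∀ p q → (p +ₚ q) ≋ (q +ₚ p)
  +ₚ-comm p q = mk≋ λ i →
    trans (coeff-+ p q i) (trans (+-comm _ _) (sym (coeff-+ q p i)))

  +ₚ-identityʳ : ∀ p → (p +ₚ []) ≋ p
  +ₚ-identityʳ p = mk≋ λ i → trans (coeff-+ p [] i) (+-identityʳ _)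

  neg-cong : ∀ {p q} → p ≋ q → negₚ p ≋ negₚ q
  neg-cong {p} {q} (mk≋ e) = mk≋ λ i →
    trans (coeff-neg p i) (trans (-‿cong (e i)) (sym (coeff-neg q i)))

  +ₚ-inverseʳ : ∀ p → (p +ₚ negₚ p) ≋ []
  +ₚ-inverseʳ p = mk≋ λ i →
    trans (coeff-+ p _ i) (trans (+-congˡ (coeff-neg p i)) (-‿inverseʳ _))

  scale-cong : ∀ {a b p q} → a ≈ b → p ≋ q → scale a p ≋ scale b q
  scale-cong {a} {b} {p} {q} e (mk≋ f) = mk≋ λ i →
    trans (coeff-scale a p i) (trans (*-cong e (f i)) (sym (coeff-scale b q i)))

  scale-+ : ∀ c p q → scale c (p +ₚ q) ≋ (scale c p +ₚ scale c q)
  scale-+ c p q = mk≋ λ i → trans (coeff-scale c (p +ₚ q) i) (trans (*-congˡ (coeff-+ p q i))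
    (trans (distribˡ _ _ _) (sym (trans (coeff-+ (scale c p) _ i)
      (+-cong (coeff-scale c p i) (coeff-scale c q i))))))

  scale-scale : ∀ a b p → scale a (scale b p) ≋ scale (a * b) p
  scale-scale a b p = mk≋ λ i → trans (coeff-scale a (scale b p) i)
    (trans (*-congˡ (coeff-scale b p i)) (trans (sym (*-assoc _ _ _)) (sym (coeff-scale _ p i))))

  scale-1 : ∀ p → scale 1# p ≋ p
  scale-1 p = mk≋ λ i → trans (coeff-scale _ p i) (*-identityˡ _)

  scale-0 : ∀ p → scale 0# p ≋ []
  scale-0 p = mk≋ λ i → trans (coeff-scale _ p i) (zeroˡ _)

  scale-∷0 : ∀ c p → scale c (0# ∷ p) ≋ (0# ∷ scale c p)
  scale-∷0 c p = ∷-cong (zeroʳ c) ≋-refl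

  +ₚ-swap : ∀ p q r → (p +ₚ (q +ₚ r)) ≋ (q +ₚ (p +ₚ r))
  +ₚ-swap p q r = ≋-trans (≋-sym (+ₚ-assoc p q r))
    (≋-trans (+ₚ-cong (+ₚ-comm p q) (≋-refl {r})) (+ₚ-assoc q p r))

  +ₚ-interchange : ∀ p q r s → (p +ₚ q +ₚ (r +ₚ s)) ≋ (p +ₚ r +ₚ (q +ₚ s))
  +ₚ-interchange p q r s = ≋-trans (+ₚ-assoc p q _)
    (≋-trans (+ₚ-cong (≋-refl {p}) (+ₚ-swap q r s)) (≋-sym (+ₚ-assoc p r _)))

  *ₚ-congˡ : ∀ p {q q'} → q ≋ q' → (p *ₚ q) ≋ (p *ₚ q')
  *ₚ-congˡ []      e = ≋-refl
  *ₚ-congˡ (a ∷ p) e = +ₚ-cong (scale-cong refl e) (∷-cong refl (*ₚ-congˡ p e))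

  *ₚ-zeroʳ : ∀ p → (p *ₚ []) ≋ []
  *ₚ-zeroʳ []      = ≋-refl
  *ₚ-zeroʳ (a ∷ p) = 0∷[] (*ₚ-zeroʳ p)

  -- The product recurses on its left factor only. Peeling the right factor instead is the step from
  -- which commutativity follows by induction.
  *ₚ-∷ʳ : ∀ p b q → (p *ₚ (b ∷ q)) ≋ (scale b p +ₚ (0# ∷ (p *ₚ q)))
  *ₚ-∷ʳ []      b q = ≋-sym (0∷[] ≋-refl)
  *ₚ-∷ʳ (a ∷ p) b q = ∷-cong (+-congʳ (*-comm a b))
    (≋-trans (+ₚ-cong (≋-refl {scale a q}) (*ₚ-∷ʳ p b q)) (+ₚ-swap (scale a q) (scale b p) _))

  *ₚ-comm : ∀ p q → (p *ₚ q) ≋ (q *ₚ p)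
  *ₚ-comm []      q = ≋-sym (*ₚ-zeroʳ q)
  *ₚ-comm (a ∷ p) q = ≋-trans (+ₚ-cong (≋-refl {scale a q}) (∷-cong refl (*ₚ-comm p q)))
                              (≋-sym (*ₚ-∷ʳ q a p))

  *ₚ-congʳ : ∀ {p p'} q → p ≋ p' → (p *ₚ q) ≋ (p' *ₚ q)
  *ₚ-congʳ {p} {p'} q e = ≋-trans (*ₚ-comm p q) (≋-trans (*ₚ-congˡ q e) (*ₚ-comm q p'))

  *ₚ-distribˡ : ∀ p q r → (p *ₚ (q +ₚ r)) ≋ (p *ₚ q +ₚ p *ₚ r)
  *ₚ-distribˡ []      q r = ≋-refl
  *ₚ-distribˡ (a ∷ p) q r = ≋-trans
    (+ₚ-cong (scale-+ a q r) (≋-trans (∷-cong (sym (+-identityˡ 0#)) (*ₚ-distribˡ p q r)) ≋-refl))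
    (+ₚ-interchange (scale a q) (scale a r) (0# ∷ (p *ₚ q)) (0# ∷ (p *ₚ r)))

  *ₚ-distribʳ : ∀ r p q → ((p +ₚ q) *ₚ r) ≋ (p *ₚ r +ₚ q *ₚ r)
  *ₚ-distribʳ r p q = ≋-trans (*ₚ-comm (p +ₚ q) r)
    (≋-trans (*ₚ-distribˡ r p q) (+ₚ-cong (*ₚ-comm r p) (*ₚ-comm r q)))

  scale-*ₚ : ∀ c p q → (scale c p *ₚ q) ≋ scale c (p *ₚ q)
  scale-*ₚ c []      q = ≋-refl
  scale-*ₚ c (a ∷ p) q = ≋-trans
    (+ₚ-cong (≋-sym (scale-scale c a q))
      (≋-trans (∷-cong refl (scale-*ₚ c p q)) (≋-sym (scale-∷0 c (p *ₚ q)))))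
    (≋-sym (scale-+ c (scale a q) (0# ∷ (p *ₚ q))))

  0∷-*ₚ : ∀ p q → ((0# ∷ p) *ₚ q) ≋ (0# ∷ (p *ₚ q))
  0∷-*ₚ p q = +ₚ-cong (scale-0 q) (≋-refl {0# ∷ (p *ₚ q)})

  *ₚ-assoc : ∀ p q r → ((p *ₚ q) *ₚ r) ≋ (p *ₚ (q *ₚ r))
  *ₚ-assoc []      q r = ≋-refl
  *ₚ-assoc (a ∷ p) q r = ≋-trans (*ₚ-distribʳ r (scale a q) (0# ∷ (p *ₚ q)))
    (+ₚ-cong (scale-*ₚ a q r) (≋-trans (0∷-*ₚ (p *ₚ q) r) (∷-cong refl (*ₚ-assoc p q r))))

  *ₚ-identityˡ : ∀ p → (oneₚ *ₚ p) ≋ p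
  *ₚ-identityˡ p = ≋-trans (+ₚ-cong (scale-1 p) (0∷[] ≋-refl)) (+ₚ-identityʳ p)

  isCommutativeRingₚ : IsCommutativeRing _≋_ _+ₚ_ _*ₚ_ negₚ [] oneₚ
  isCommutativeRingₚ = record
    { isRing = record
      { +-isAbelianGroup = record
        { isGroup = record
          { isMonoid = record
            { isSemigroup = record
              { isMagma = record
                { isEquivalence = record { refl = ≋-refl ; sym = ≋-sym ; trans = ≋-trans }
                ; ∙-cong = +ₚ-cong }
              ; assoc = +ₚ-assoc }
            ; identity = (λ _ → ≋-refl) , +ₚ-identityʳ }
          ; inverse = (λ p → ≋-trans (+ₚ-comm (negₚ p) p) (+ₚ-inverseʳ p)) , +ₚ-inverseʳ
          ; ⁻¹-cong = neg-cong }
        ; comm = +ₚ-comm }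
      ; *-cong = λ {p} {p'} {q} {q'} e f → ≋-trans (*ₚ-congʳ q e) (*ₚ-congˡ p' f)
      ; *-assoc = *ₚ-assoc
      ; *-identity = *ₚ-identityˡ , (λ p → ≋-trans (*ₚ-comm p oneₚ) (*ₚ-identityˡ p))
      ; distrib = *ₚ-distribˡ , *ₚ-distribʳ }
    ; *-comm = *ₚ-comm }

  polynomials : CR
  polynomials = record { isCommutativeRing = isCommutativeRingₚ }

  constants : Hom R polynomials
  constants = record
    { ⟦_⟧ = λ a → a ∷ [] ; cong = λ e → ∷-cong e ≋-refl ; +-hom = λ a b → ≋-refl
    ; *-hom = λ a b → ∷-cong (sym (+-identityʳ _)) ≋-refl ; 1-hom = ≋-refl }

  X : Pol
  X = 0# ∷ 1# ∷ []

  X* : ∀ p → (X *ₚ p) ≋ (0# ∷ p)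
  X* p = ≋-trans (0∷-*ₚ oneₚ p) (∷-cong refl (*ₚ-identityˡ p))

  -- Turns a list cell into ring operations, so that inductions on lists can be handed to the ring
  -- solver.
  ∷-split : ∀ a p → (a ∷ p) ≋ ((a ∷ []) +ₚ X *ₚ p)
  ∷-split a p = ≋-trans (∷-cong (sym (+-identityʳ a)) ≋-refl)
                        (+ₚ-cong (≋-refl {a ∷ []}) (≋-sym (X* p)))

  const-* : ∀ a p → ((a ∷ []) *ₚ p) ≋ scale a p
  const-* a p = ≋-trans (+ₚ-cong (≋-refl {scale a p}) (0∷[] ≋-refl)) (+ₚ-identityʳ _)

  xpow≋pow : ∀ k → xpow k ≋ Poly.pow polynomials X k
  xpow≋pow zero    = ≋-refl
  xpow≋pow (suc k) = ≋-trans (∷-cong refl (xpow≋pow k)) (≋-sym (X* _))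

IsNegInverse : (R : CR) → ℕ → CommutativeRing.Carrier R → Set
IsNegInverse R n c = c * Poly.nat R n ≈ - 1#
  where open CommutativeRing R

open PolynomialRing public using () renaming (polynomials to polyRing; constants to constHom)

module Evaluation {R S : CR} (h : Hom R S) (t : CommutativeRing.Carrier S) where
  private
    module R = CommutativeRing R
    module H = Hom h
  open CommutativeRing S
  open Poly R using (Pol; _+ₚ_; _*ₚ_; scale; coeff; xpow; xⁿ-1)
  open PolynomialRing R using (_≋_; mk≋; ∷-tail; ∷-tail[]; X; at; ≋-sym)
  open IntegerSolver S
  open HomProperties h
  open import Relation.Binary.Reasoning.Setoid setoid

  -- Horner's scheme with coefficients moved along `h`. One definition serves for the substitution x
  -- ↦ x^s (`h` the constants, `t` a power of x), for values in L and K, and for maps out of an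
  -- adjunction of a root.
  eval : Pol → Carrier
  eval []      = 0#
  eval (a ∷ p) = H.⟦ a ⟧ + t * eval p

  eval-zero : ∀ p → p ≋ [] → eval p ≈ 0#
  eval-zero []      e = refl
  eval-zero (a ∷ p) e = begin
    H.⟦ a ⟧ + t * eval p ≈⟨ +-cong (trans (H.cong (at e 0)) 0-hom)
                                   (*-congˡ (eval-zero p (∷-tail[] e))) ⟩
    0# + t * 0#          ≈⟨ solve 1 (λ t → :0 :+ t :* :0 := :0) refl t ⟩
    0#                   ∎

  eval-cong : ∀ {p q} → p ≋ q → eval p ≈ eval q
  eval-cong {[]}    {q}     e = sym (eval-zero q (≋-sym e))
  eval-cong {a ∷ p} {[]}    e = eval-zero (a ∷ p) e
  eval-cong {a ∷ p} {b ∷ q} e = +-cong (H.cong (at e 0)) (*-congˡ (eval-cong (∷-tail e)))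

  eval-+ : ∀ p q → eval (p +ₚ q) ≈ eval p + eval q
  eval-+ []      q       = sym (+-identityˡ _)
  eval-+ (a ∷ p) []      = sym (+-identityʳ _)
  eval-+ (a ∷ p) (b ∷ q) = begin
    H.⟦ a R.+ b ⟧ + t * eval (p +ₚ q)            ≈⟨ +-cong (H.+-hom a b) (*-congˡ (eval-+ p q)) ⟩
    H.⟦ a ⟧ + H.⟦ b ⟧ + t * (eval p + eval q)
      ≈⟨ solve 5 (λ a b t p q → a :+ b :+ t :* (p :+ q) := a :+ t :* p :+ (b :+ t :* q))
           refl H.⟦ a ⟧ H.⟦ b ⟧ t (eval p) (eval q) ⟩
    H.⟦ a ⟧ + t * eval p + (H.⟦ b ⟧ + t * eval q) ∎

  eval-scale : ∀ c p → eval (scale c p) ≈ H.⟦ c ⟧ * eval p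
  eval-scale c []      = sym (zeroʳ _)
  eval-scale c (a ∷ p) = begin
    H.⟦ c R.* a ⟧ + t * eval (scale c p)     ≈⟨ +-cong (H.*-hom c a) (*-congˡ (eval-scale c p)) ⟩
    H.⟦ c ⟧ * H.⟦ a ⟧ + t * (H.⟦ c ⟧ * eval p)
      ≈⟨ solve 4 (λ c a t p → c :* a :+ t :* (c :* p) := c :* (a :+ t :* p))
           refl H.⟦ c ⟧ H.⟦ a ⟧ t (eval p) ⟩
    H.⟦ c ⟧ * (H.⟦ a ⟧ + t * eval p)         ∎

  eval-* : ∀ p q → eval (p *ₚ q) ≈ eval p * eval q
  eval-* []      q = sym (zeroˡ _)
  eval-* (a ∷ p) q = begin
    eval (scale a q +ₚ (R.0# ∷ (p *ₚ q)))       ≈⟨ eval-+ (scale a q) _ ⟩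
    eval (scale a q) + (H.⟦ R.0# ⟧ + t * eval (p *ₚ q))
      ≈⟨ +-cong (eval-scale a q) (+-cong 0-hom (*-congˡ (eval-* p q))) ⟩
    H.⟦ a ⟧ * eval q + (0# + t * (eval p * eval q))
      ≈⟨ solve 4 (λ a t p q → a :* q :+ (:0 :+ t :* (p :* q)) := (a :+ t :* p) :* q)
           refl H.⟦ a ⟧ t (eval p) (eval q) ⟩
    (H.⟦ a ⟧ + t * eval p) * eval q             ∎

  eval-const : ∀ a → eval (a ∷ []) ≈ H.⟦ a ⟧
  eval-const a = trans (+-congˡ (zeroʳ t)) (+-identityʳ _)

  evalHom : Hom (polyRing R) S
  evalHom = record { ⟦_⟧ = eval ; cong = eval-cong ; +-hom = eval-+ ; *-hom = eval-*
                   ; 1-hom = trans (eval-const R.1#) H.1-hom }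

  eval-X : eval X ≈ t
  eval-X = begin
    H.⟦ R.0# ⟧ + t * (H.⟦ R.1# ⟧ + t * 0#) ≈⟨ +-cong 0-hom (*-congˡ (+-congʳ H.1-hom)) ⟩
    0# + t * (1# + t * 0#) ≈⟨ solve 1 (λ t → :0 :+ t :* (:1 :+ t :* :0) := t) refl t ⟩
    t ∎

  eval-xpow : ∀ k → eval (xpow k) ≈ Poly.pow S t k
  eval-xpow zero    = Hom.1-hom evalHom
  eval-xpow (suc k) = trans (+-cong 0-hom (*-congˡ (eval-xpow k))) (+-identityˡ _)

  eval-xⁿ-1 : ∀ k → eval (xⁿ-1 k) ≈ Poly.pow S t k - 1#
  eval-xⁿ-1 k = trans (eval-+ (xpow k) _)
    (+-cong (eval-xpow k) (trans (eval-const _) (trans (neg-hom _) (-‿cong H.1-hom))))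

  -- Universal property of the polynomial ring. Later equalities between ring maps, such as x ↦ x^s
  -- being an involution modulo xⁿ - 1, are reduced by it to the value at `X`.
  eval-unique : ∀ (g : Hom (polyRing R) S) → (∀ a → Hom.⟦_⟧ g (a ∷ []) ≈ H.⟦ a ⟧) →
                Hom.⟦_⟧ g X ≈ t → ∀ p → Hom.⟦_⟧ g p ≈ eval p
  eval-unique g gC gX []      = HomProperties.0-hom g
  eval-unique g gC gX (a ∷ p) = trans (Hom.cong g (PolynomialRing.∷-split R a p))
    (trans (Hom.+-hom g _ _) (+-cong (gC a) (trans (Hom.*-hom g _ _)
      (*-cong gX (eval-unique g gC gX p)))))

  open HomProperties evalHom public using () renaming (sub-hom to eval-sub)

open Evaluation using (eval; evalHom) public

module MapPolynomial {R S : CR} (h : Hom R S) where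
  private
    module S = CommutativeRing S
    module H = Hom h
    module PR = Poly R
    module PS = Poly S
  open PolynomialRing R using () renaming (_≋_ to _≋R_; at to atR; X to XR)
  open PolynomialRing S
  open HomProperties h

  mapₚ : PR.Pol → PS.Pol
  mapₚ = map H.⟦_⟧

  coeff-map : ∀ p i → PS.coeff (mapₚ p) i S.≈ H.⟦ PR.coeff p i ⟧
  coeff-map []      i       = S.sym 0-hom
  coeff-map (a ∷ p) zero    = S.refl
  coeff-map (a ∷ p) (suc i) = coeff-map p i

  map-cong : ∀ {p q} → p ≋R q → mapₚ p ≋ mapₚ q
  map-cong {p} {q} e = mk≋ λ i →
    S.trans (coeff-map p i) (S.trans (H.cong (atR e i)) (S.sym (coeff-map q i)))

  map-+ : ∀ p q → mapₚ (p PR.+ₚ q) ≋ (mapₚ p PS.+ₚ mapₚ q)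
  map-+ []      q       = ≋-refl
  map-+ (a ∷ p) []      = ≋-refl
  map-+ (a ∷ p) (b ∷ q) = ∷-cong (H.+-hom a b) (map-+ p q)

  map-scale : ∀ c p → mapₚ (PR.scale c p) ≋ PS.scale H.⟦ c ⟧ (mapₚ p)
  map-scale c []      = ≋-refl
  map-scale c (a ∷ p) = ∷-cong (H.*-hom c a) (map-scale c p)

  map-* : ∀ p q → mapₚ (p PR.*ₚ q) ≋ (mapₚ p PS.*ₚ mapₚ q)
  map-* []      q = ≋-refl
  map-* (a ∷ p) q = ≋-trans (map-+ (PR.scale a q) _)
    (+ₚ-cong (map-scale a q) (∷-cong 0-hom (map-* p q)))

  mapHom : Hom (polyRing R) (polyRing S)
  mapHom = record { ⟦_⟧ = mapₚ ; cong = map-cong ; +-hom = map-+ ; *-hom = map-*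
                  ; 1-hom = ∷-cong H.1-hom ≋-refl }

  map-xpow : ∀ k → mapₚ (PR.xpow k) ≋ PS.xpow k
  map-xpow zero    = ∷-cong H.1-hom ≋-refl
  map-xpow (suc k) = ∷-cong 0-hom (map-xpow k)

  map-xⁿ-1 : ∀ k → mapₚ (PR.xⁿ-1 k) ≋ PS.xⁿ-1 k
  map-xⁿ-1 k = ≋-trans (map-+ (PR.xpow k) _) (+ₚ-cong (map-xpow k)
    (∷-cong (S.trans (neg-hom _) (S.-‿cong H.1-hom)) ≋-refl))

  map-linear : ∀ a → mapₚ (PR.linear a) ≋ PS.linear H.⟦ a ⟧
  map-linear a = ∷-cong (neg-hom a) (∷-cong H.1-hom ≋-refl)

  map-prodLin : ∀ as → mapₚ (PR.prodLin as) ≋ PS.prodLin (map H.⟦_⟧ as)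
  map-prodLin []       = Hom.1-hom mapHom
  map-prodLin (a ∷ as) = ≋-trans (map-* (PR.linear a) (PR.prodLin as))
    (≋-trans (*ₚ-congʳ _ (map-linear a)) (*ₚ-congˡ (PS.linear H.⟦ a ⟧) (map-prodLin as)))

  eval-map : ∀ {T : CR} (g : Hom S T) t p →
             CommutativeRing._≈_ T (eval g t (mapₚ p)) (eval (g ∘ʰ h) t p)
  eval-map {T} g t []      = CommutativeRing.refl T
  eval-map {T} g t (a ∷ p) = CommutativeRing.+-congˡ T (CommutativeRing.*-congˡ T (eval-map g t p))

-- Degrees, division with remainder, linear factors.

module Degree (R : CR) where
  open CommutativeRing R
  open Poly R
  open PolynomialRing R
  open IntegerSolver R
  private
    module P = CommutativeRing (polyRing R)
    module PSolver = IntegerSolver (polyRing R)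

  -- Only bounds are used: over a ring without decidable equality the exact degree cannot be
  -- computed, and lists may end in zeros. `Deg< p 0` says that `p` is zero.
  record Deg< (p : Pol) (m : ℕ) : Set where
    constructor deg<
    field above : ∀ i → m ≤ i → coeff p i ≈ 0#

  -- `Monic` speaks of the list and is lost when trailing zeros are added; this version respects
  -- `_≋_`, and `⇒Monic` returns to a list of the required shape.
  record MonicOfDegree (m : ℕ) (p : Pol) : Set where
    constructor monicOf
    field
      lead : coeff p m ≈ 1#
      rest : Deg< p (suc m)

  deg<-resp : ∀ {p q m} → p ≋ q → Deg< p m → Deg< q m
  deg<-resp (mk≋ e) (deg< d) = deg< λ i m≤i → trans (sym (e i)) (d i m≤i)

  deg<-weaken : ∀ {p m k} → m ≤ k → Deg< p m → Deg< p k
  deg<-weaken m≤k (deg< d) = deg< λ i k≤i → d i (ℕₚ.≤-trans m≤k k≤i)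

  deg<-length : ∀ p → Deg< p (length p)
  deg<-length p = deg< (go p)
    where
    go : ∀ p i → length p ≤ i → coeff p i ≈ 0#
    go []      i       _       = refl
    go (a ∷ p) (suc i) (s≤s l) = go p i l

  deg<0 : ∀ {p} → Deg< p 0 → p ≋ []
  deg<0 (deg< d) = mk≋ λ i → d i z≤n

  deg<-+ : ∀ {p q m} → Deg< p m → Deg< q m → Deg< (p +ₚ q) m
  deg<-+ {p} {q} (deg< d) (deg< e) = deg< λ i m≤i →
    trans (coeff-+ p q i) (trans (+-cong (d i m≤i) (e i m≤i)) (+-identityˡ 0#))

  deg<-neg : ∀ {p m} → Deg< p m → Deg< (negₚ p) m
  deg<-neg {p} (deg< d) = deg< λ i m≤i →
    trans (coeff-neg p i) (trans (-‿cong (d i m≤i)) (solve 0 (:- :0 := :0) refl))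

  deg<-scale : ∀ {p m} c → Deg< p m → Deg< (scale c p) m
  deg<-scale {p} c (deg< d) = deg< λ i m≤i →
    trans (coeff-scale c p i) (trans (*-congˡ (d i m≤i)) (zeroʳ c))

  deg<-pred : ∀ {p m} → Deg< p (suc m) → coeff p m ≈ 0# → Deg< p m
  deg<-pred {p} {m} (deg< d) e = deg< λ i m≤i → case i (ℕₚ.m≤n⇒m<n∨m≡n m≤i)
    where
    case : ∀ i → (m < i) ⊎ (m ≡ i) → coeff p i ≈ 0#
    case i (inj₁ m<i)     = d i m<i
    case i (inj₂ ≡.refl)  = e

  deg<-∷ : ∀ {a p m} → Deg< p m → Deg< (a ∷ p) (suc m)
  deg<-∷ (deg< d) = deg< λ where (suc i) (s≤s l) → d i l

  deg<-tail : ∀ {a p m} → Deg< (a ∷ p) (suc m) → Deg< p m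
  deg<-tail (deg< d) = deg< λ i l → d (suc i) (s≤s l)

  deg<1 : ∀ {p} → Deg< p 1 → p ≋ (coeff p 0 ∷ [])
  deg<1 (deg< d) = mk≋ λ where
    zero    → refl
    (suc i) → d (suc i) (s≤s z≤n)

  private
    -- Within the two bounds, (`m`, `k`) is the only pair of indices contributing to the coefficient
    -- at m + k. The top coefficients may be zero, so the lemma also serves to lower bounds.
    coeff-*-top : ∀ p q m k → Deg< p (suc m) → Deg< q (suc k) →
                  coeff (p *ₚ q) (m ℕ.+ k) ≈ coeff p m * coeff q k
    coeff-*-top []      q m       k d e = sym (zeroˡ _)
    coeff-*-top (a ∷ p) q zero    k d e = trans (coeff-+ (scale a q) _ k)
      (trans (+-cong (coeff-scale a q k) (at (0∷[] (*ₚ-congʳ q (deg<0 (deg<-tail d)))) k))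
             (+-identityʳ _))
    coeff-*-top (a ∷ p) q (suc m) k d e = trans (coeff-+ (scale a q) _ (suc (m ℕ.+ k)))
      (trans (+-cong (trans (coeff-scale a q _)
                (trans (*-congˡ (Deg<.above e _ (s≤s (ℕₚ.m≤n+m k m)))) (zeroʳ a)))
              (coeff-*-top p q m k (deg<-tail d) e)) (+-identityˡ _))

  deg<-* : ∀ p q {m k} → Deg< p (suc m) → Deg< q (suc k) → Deg< (p *ₚ q) (suc (m ℕ.+ k))
  deg<-* p q {m} {k} d e = deg< λ i l → lemma i (ℕₚ.m≤n⇒∃[o]m+o≡n l)
    where
    lemma : ∀ i → (∃ λ l → suc (m ℕ.+ k) ℕ.+ l ≡ i) → coeff (p *ₚ q) i ≈ 0#
    -- The bound on `q` is weakened until `i` is the top position of the product; the coefficient of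
    -- `q` there is already zero.
    lemma i (l , ≡.refl) = trans (reflexive (≡.cong (coeff (p *ₚ q)) eq))
      (trans (coeff-*-top p q m (suc k ℕ.+ l) d (deg<-weaken (s≤s (ℕₚ.≤-trans (ℕₚ.n≤1+n k) (ℕₚ.m≤m+n (suc k) l))) e))
        (trans (*-congˡ (Deg<.above e _ (ℕₚ.m≤m+n (suc k) l))) (zeroʳ _)))
      where
      eq : suc (m ℕ.+ k) ℕ.+ l ≡ m ℕ.+ (suc k ℕ.+ l)
      eq = ≡.trans (≡.cong (ℕ._+ l) (≡.sym (ℕₚ.+-suc m k))) (ℕₚ.+-assoc m (suc k) l)

  coeff-monic* : ∀ {f g m k} → MonicOfDegree m f → Deg< g (suc k) →
                 coeff (f *ₚ g) (m ℕ.+ k) ≈ coeff g k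
  coeff-monic* {f} {g} {m} {k} (monicOf l r) d =
    trans (coeff-*-top f g m k r d) (trans (*-congʳ l) (*-identityˡ _))

  monic-resp : ∀ {f g m} → f ≋ g → MonicOfDegree m f → MonicOfDegree m g
  monic-resp {m = m} e (monicOf l r) = monicOf (trans (sym (at e m)) l) (deg<-resp e r)

  monic-* : ∀ {f g m k} → MonicOfDegree m f → MonicOfDegree k g → MonicOfDegree (m ℕ.+ k) (f *ₚ g)
  monic-* {f} {g} M@(monicOf l r) (monicOf l' r') =
    monicOf (trans (coeff-monic* M r') l') (deg<-* f g r r')

  monic-one : MonicOfDegree 0 oneₚ
  monic-one = monicOf refl (deg<-length oneₚ)

  monic-linear : ∀ a → MonicOfDegree 1 (linear a)
  monic-linear a = monicOf refl (deg<-length (linear a))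

  monic-prodLin : ∀ as → MonicOfDegree (length as) (prodLin as)
  monic-prodLin []       = monic-one
  monic-prodLin (a ∷ as) = monic-* (monic-linear a) (monic-prodLin as)

  monic-snoc : ∀ p → MonicOfDegree (length p) (p ++ (1# ∷ []))
  monic-snoc p = monicOf (top p)
    (≡.subst (Deg< _) (≡.trans (Listₚ.length-++ p) (ℕₚ.+-comm (length p) 1)) (deg<-length _))
    where
    top : ∀ p → coeff (p ++ (1# ∷ [])) (length p) ≈ 1#
    top []      = refl
    top (a ∷ p) = top p

  Monic⇒ : ∀ {f} → Monic f → ∃ λ m → MonicOfDegree m f
  Monic⇒ (p , ≡.refl) = length p , monic-snoc p

  firstCoeffs : ℕ → Pol → Pol
  firstCoeffs zero    p       = []
  firstCoeffs (suc m) []      = 0# ∷ firstCoeffs m []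
  firstCoeffs (suc m) (a ∷ p) = a ∷ firstCoeffs m p

  ⇒Monic : ∀ {m f} → MonicOfDegree m f → ∃ λ f' → Monic f' × f ≋ f'
  ⇒Monic {m} {f} M = _ , (firstCoeffs m f , ≡.refl) , mk≋ (go m f M)
    where
    go : ∀ m f → MonicOfDegree m f → f ≈ₚ (firstCoeffs m f ++ (1# ∷ []))
    go zero    f       (monicOf l r) zero    = l
    go zero    f       (monicOf l r) (suc i) = Deg<.above r (suc i) (s≤s z≤n)
    go (suc m) []      (monicOf l r) zero    = refl
    go (suc m) []      (monicOf l r) (suc i) = go m [] (monicOf l (deg< λ _ _ → refl)) i
    go (suc m) (a ∷ p) (monicOf l r) zero    = refl
    go (suc m) (a ∷ p) (monicOf l r) (suc i) = go m p (monicOf l (deg<-tail r)) i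

  monic-xⁿ-1 : ∀ n → .{{ℕ.NonZero n}} → MonicOfDegree n (xⁿ-1 n)
  monic-xⁿ-1 (suc n) = ≡.subst (λ k → MonicOfDegree (suc k) (xⁿ-1 (suc n)))
    (Listₚ.length-replicate n) (monic-resp (∷-cong (sym (+-identityˡ _)) (≋-sym (+ₚ-identityʳ _))) (monic-snoc (- 1# ∷ replicate n 0#)))

  -- Built from the inside of Horner's scheme: if p = q f + r, then a + x p = (x q) f + (a + x r),
  -- and subtracting c f removes the coefficient c of x^m. As f is monic nothing is inverted, so
  -- this works over any ring.
  divMod : ∀ {m f} → MonicOfDegree m f → ∀ p →
           ∃ λ q → ∃ λ r → p ≋ (q *ₚ f +ₚ r) × Deg< r m
  divMod M []      = [] , [] , ≋-refl , deg< λ _ _ → refl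
  divMod {m} {f} M@(monicOf l d) (a ∷ p) with divMod M p
  ... | q , r , e , d' = ((c ∷ []) +ₚ X *ₚ q) , ((a ∷ r) +ₚ negₚ (scale c f)) , eq ,
    deg<-pred (deg<-+ (deg<-∷ d') (deg<-neg (deg<-scale c d)))
      (trans (coeff-+ (a ∷ r) (negₚ (scale c f)) m) (trans (+-congˡ (trans (coeff-neg (scale c f) m)
        (-‿cong (trans (coeff-scale c f m) (trans (*-congˡ l) (*-identityʳ c))))))
        (-‿inverseʳ c)))
    where
    c = coeff (a ∷ r) m
    open import Relation.Binary.Reasoning.Setoid P.setoid
    eq : (a ∷ p) ≋ (((c ∷ []) +ₚ X *ₚ q) *ₚ f +ₚ ((a ∷ r) +ₚ negₚ (scale c f)))
    eq = begin
      a ∷ p ≈⟨ ∷-split a p ⟩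
      (a ∷ []) +ₚ X *ₚ p ≈⟨ P.+-congˡ {a ∷ []} (P.*-congˡ {X} e) ⟩
      (a ∷ []) +ₚ X *ₚ (q *ₚ f +ₚ r)
        ≈⟨ PSolver.solve 6 (λ a c x q f r → a PSolver.:+ x PSolver.:* (q PSolver.:* f PSolver.:+ r)
             PSolver.:= (c PSolver.:+ x PSolver.:* q) PSolver.:* f PSolver.:+
               (a PSolver.:+ x PSolver.:* r PSolver.:- c PSolver.:* f))
             ≋-refl (a ∷ []) (c ∷ []) X q f r ⟩
      ((c ∷ []) +ₚ X *ₚ q) *ₚ f +ₚ ((a ∷ []) +ₚ X *ₚ r +ₚ negₚ ((c ∷ []) *ₚ f))
        ≈⟨ P.+-congˡ {((c ∷ []) +ₚ X *ₚ q) *ₚ f}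
             (P.+-cong (P.sym (∷-split a r)) (P.-‿cong (const-* c f))) ⟩
      ((c ∷ []) +ₚ X *ₚ q) *ₚ f +ₚ ((a ∷ r) +ₚ negₚ (scale c f)) ∎

  -- If q is bounded by k + 1, the coefficient of f q at m + k is that of q at k, hence zero; this
  -- lowers the bound on q down to 0 without deciding any coefficient.
  monic*-deg< : ∀ {m f q} → MonicOfDegree m f → Deg< (f *ₚ q) m → q ≋ []
  monic*-deg< {m} {f} {q} M (deg< d) = go (length q) (deg<-length q)
    where
    go : ∀ k → Deg< q k → q ≋ []
    go zero    e = deg<0 e
    go (suc k) e = go k (deg<-pred e
      (trans (sym (coeff-monic* M e)) (d _ (ℕₚ.m≤m+n m k))))

  monic-cancelˡ : ∀ {m f p q} → MonicOfDegree m f → (f *ₚ p) ≋ (f *ₚ q) → p ≋ q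
  monic-cancelˡ {m} {f} {p} {q} M e = P.trans
    (PSolver.solve 2 (λ p q → p PSolver.:= (p PSolver.:- q) PSolver.:+ q) ≋-refl p q)
    (P.trans (P.+-congʳ {q} (monic*-deg< {q = p +ₚ negₚ q} M (deg< λ i _ → at z i))) ≋-refl)
    where
    z : (f *ₚ (p +ₚ negₚ q)) ≋ []
    z = P.trans (PSolver.solve 3 (λ f p q → f PSolver.:* (p PSolver.:- q) PSolver.:=
          f PSolver.:* p PSolver.:- f PSolver.:* q) ≋-refl f p q)
        (P.trans (P.+-congʳ {negₚ (f *ₚ q)} e) (+ₚ-inverseʳ (f *ₚ q)))

  -- The bound on `g` descends until m + k meets N: below N the leading 1 of p would be zero, above
  -- N the top coefficient of g is zero.
  monic-cofactor : ¬ (1# ≈ 0#) → ∀ {m N f g p} → MonicOfDegree m f → MonicOfDegree N p →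
                   (f *ₚ g) ≋ p → ∃ λ k → N ≡ m ℕ.+ k × MonicOfDegree k g
  monic-cofactor 1≉0 {m} {N} {f} {g} {p} M@(monicOf l r) (monicOf l' r') e =
    go (length g) (deg<-length g)
    where
    go : ∀ k → Deg< g k → ∃ λ k → N ≡ m ℕ.+ k × MonicOfDegree k g
    go zero    d = ⊥-elim (1≉0 (trans (sym l') (trans (sym (at e N))
      (at (P.trans (*ₚ-congˡ f (deg<0 d)) (*ₚ-zeroʳ f)) N))))
    go (suc k) d with ℕₚ.<-cmp (m ℕ.+ k) N
    ... | tri< lt _ _ = ⊥-elim (1≉0 (trans (sym l') (trans (sym (at e N))
            (Deg<.above (deg<-* f g r d) N lt))))
    ... | tri≈ _ ≡.refl _ = k , ≡.refl ,
            monicOf (trans (sym (coeff-monic* M d)) (trans (at e _) l')) d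
    ... | tri> _ _ gt = go k (deg<-pred d (trans (sym (coeff-monic* M d))
            (trans (at e _) (Deg<.above r' _ gt))))

  monic-degree-unique : ¬ (1# ≈ 0#) → ∀ {m k f} → MonicOfDegree m f → MonicOfDegree k f → m ≡ k
  monic-degree-unique 1≉0 {m} {k} (monicOf l r) (monicOf l' r') with ℕₚ.<-cmp m k
  ... | tri< lt _ _ = ⊥-elim (1≉0 (trans (sym l') (Deg<.above r _ lt)))
  ... | tri≈ _ e _  = e
  ... | tri> _ _ gt = ⊥-elim (1≉0 (trans (sym l) (Deg<.above r' _ gt)))

  monic0 : ∀ {f} → MonicOfDegree 0 f → f ≋ oneₚ
  monic0 (monicOf l r) = ≋-trans (deg<1 r) (∷-cong l ≋-refl)

module Roots (R : CR) where
  open CommutativeRing R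
  open Poly R
  open PolynomialRing R
  open Degree R
  open Evaluation (idHom R) hiding (eval; evalHom)
  private
    module P = CommutativeRing (polyRing R)
  open IntegerSolver R

  evalAt : Carrier → Pol → Carrier
  evalAt a = eval (idHom R) a

  eval-linear : ∀ t a → evalAt t (linear a) ≈ t - a
  eval-linear t a = solve 2 (λ t a → :- a :+ t :* (:1 :+ t :* :0) := t :- a) refl t a

  root-factor : ∀ a f → evalAt a f ≈ 0# → ∃ λ f₁ → f ≋ (linear a *ₚ f₁)
  root-factor a f z with divMod (monic-linear a) f
  ... | q , r , e , d = q , P.trans e (P.trans (P.+-congˡ {q *ₚ linear a} r≋)
                             (P.trans (P.+-identityʳ _) (P.*-comm q (linear a))))
    where
    open import Relation.Binary.Reasoning.Setoid setoid
    r0 : coeff r 0 ≈ 0#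
    r0 = begin
      coeff r 0                                ≈⟨ sym (eval-const a (coeff r 0)) ⟩
      evalAt a (coeff r 0 ∷ [])                ≈⟨ sym (eval-cong a (deg<1 d)) ⟩
      evalAt a r                               ≈⟨ solve 2 (λ q r → r := q :* :0 :+ r) refl (evalAt a q) _ ⟩
      evalAt a q * 0# + evalAt a r             ≈⟨ +-congʳ (*-congˡ (sym (trans (eval-linear a a) (-‿inverseʳ a)))) ⟩
      evalAt a q * evalAt a (linear a) + evalAt a r ≈⟨ +-congʳ (sym (eval-* a q _)) ⟩
      evalAt a (q *ₚ linear a) + evalAt a r    ≈⟨ sym (eval-+ a (q *ₚ linear a) r) ⟩
      evalAt a (q *ₚ linear a +ₚ r)            ≈⟨ sym (eval-cong a e) ⟩
      evalAt a f                               ≈⟨ z ⟩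
      0#                                       ∎
    r≋ : r ≋ []
    r≋ = ≋-trans (deg<1 d) (≋-trans (∷-cong r0 ≋-refl) (0∷[] ≋-refl))

-- Derivatives, separability of xⁿ - 1, and the polynomials e_f.

module Derivative (R : CR) where
  open CommutativeRing R
  open Poly R
  open PolynomialRing R
  private
    module P = CommutativeRing (polyRing R)
    module C = Hom (constHom R)
  open IntegerSolver (polyRing R)
  open import Relation.Binary.Reasoning.Setoid P.setoid

  -- The recursive form (a + x p)′ = p + x p′ makes the product rule an identity for the ring
  -- solver; the formula of `efPoly`, which uses the indexed `deriv`, is matched with it in
  -- `reciprocal-deriv`.
  D : Pol → Pol
  D []      = []
  D (a ∷ p) = p +ₚ (0# ∷ D p)

  D-∷ : ∀ a p → D (a ∷ p) ≋ (p +ₚ X *ₚ D p)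
  D-∷ a p = P.+-congˡ {p} (P.sym (X* (D p)))

  D-zero : ∀ p → p ≋ [] → D p ≋ []
  D-zero []      e = ≋-refl
  D-zero (a ∷ p) e = +ₚ-cong (∷-tail[] e) (0∷[] (D-zero p (∷-tail[] e)))

  D-cong : ∀ {p q} → p ≋ q → D p ≋ D q
  D-cong {[]}    {q}     e = P.sym (D-zero q (P.sym e))
  D-cong {a ∷ p} {[]}    e = D-zero (a ∷ p) e
  D-cong {a ∷ p} {b ∷ q} e = +ₚ-cong (∷-tail e) (∷-cong refl (D-cong (∷-tail e)))

  D-+ : ∀ p q → D (p +ₚ q) ≋ (D p +ₚ D q)
  D-+ []      q       = ≋-refl
  D-+ (a ∷ p) []      = P.sym (P.+-identityʳ _)
  D-+ (a ∷ p) (b ∷ q) = begin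
    D ((a + b) ∷ (p +ₚ q))                      ≈⟨ D-∷ (a + b) (p +ₚ q) ⟩
    p +ₚ q +ₚ X *ₚ D (p +ₚ q)                   ≈⟨ P.+-congˡ {p +ₚ q} (P.*-congˡ {X} (D-+ p q)) ⟩
    p +ₚ q +ₚ X *ₚ (D p +ₚ D q)
      ≈⟨ solve 5 (λ p q x p' q' → p :+ q :+ x :* (p' :+ q') := p :+ x :* p' :+ (q :+ x :* q'))
           ≋-refl p q X (D p) (D q) ⟩
    p +ₚ X *ₚ D p +ₚ (q +ₚ X *ₚ D q)            ≈⟨ P.sym (P.+-cong (D-∷ a p) (D-∷ b q)) ⟩
    D (a ∷ p) +ₚ D (b ∷ q)                      ∎

  D-scale : ∀ c p → D (scale c p) ≋ scale c (D p)
  D-scale c []      = ≋-refl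
  D-scale c (a ∷ p) = P.trans
    (P.+-congˡ {scale c p} (P.trans (∷-cong refl (D-scale c p)) (P.sym (scale-∷0 c (D p)))))
    (P.sym (scale-+ c p (0# ∷ D p)))

  D-* : ∀ p q → D (p *ₚ q) ≋ (D p *ₚ q +ₚ p *ₚ D q)
  D-* []      q = ≋-refl
  D-* (a ∷ p) q = begin
    D (scale a q +ₚ (0# ∷ (p *ₚ q)))
      ≈⟨ D-+ (scale a q) _ ⟩
    D (scale a q) +ₚ D (0# ∷ (p *ₚ q))
      ≈⟨ P.+-cong (D-scale a q) (D-∷ 0# (p *ₚ q)) ⟩
    scale a (D q) +ₚ (p *ₚ q +ₚ X *ₚ D (p *ₚ q))
      ≈⟨ P.+-cong (P.sym (const-* a (D q))) (P.+-congˡ {p *ₚ q} (P.*-congˡ {X} (D-* p q))) ⟩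
    (a ∷ []) *ₚ D q +ₚ (p *ₚ q +ₚ X *ₚ (D p *ₚ q +ₚ p *ₚ D q))
      ≈⟨ solve 6 (λ a p q x p' q' → a :* q' :+ (p :* q :+ x :* (p' :* q :+ p :* q'))
           := (p :+ x :* p') :* q :+ (a :+ x :* p) :* q') ≋-refl (a ∷ []) p q X (D p) (D q) ⟩
    (p +ₚ X *ₚ D p) *ₚ q +ₚ ((a ∷ []) +ₚ X *ₚ p) *ₚ D q
      ≈⟨ P.sym (P.+-cong (P.*-congʳ {q} (D-∷ a p)) (P.*-congʳ {D q} (∷-split a p))) ⟩
    D (a ∷ p) *ₚ q +ₚ (a ∷ p) *ₚ D q ∎

  -- The extra factor x keeps the exponent at n, so that no predecessor of n appears.
  XD-xpow : ∀ n → (X *ₚ D (xpow n)) ≋ (C.⟦ nat n ⟧ *ₚ xpow n)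
  XD-xpow zero    = begin
    X *ₚ (0# ∷ [])           ≈⟨ P.*-congˡ {X} (0∷[] ≋-refl) ⟩
    X *ₚ []                  ≈⟨ *ₚ-zeroʳ X ⟩
    []                       ≈⟨ P.sym (P.*-congʳ {oneₚ} (0∷[] ≋-refl)) ⟩
    (0# ∷ []) *ₚ oneₚ        ∎
  XD-xpow (suc n) = begin
    X *ₚ D (0# ∷ xpow n)                 ≈⟨ P.*-congˡ {X} (D-∷ 0# (xpow n)) ⟩
    X *ₚ (xpow n +ₚ X *ₚ D (xpow n))     ≈⟨ P.*-congˡ {X} (P.+-congˡ {xpow n} (XD-xpow n)) ⟩
    X *ₚ (xpow n +ₚ C.⟦ nat n ⟧ *ₚ xpow n)
      ≈⟨ solve 3 (λ x w k → x :* (w :+ k :* w) := (:1 :+ k) :* (x :* w)) ≋-refl X (xpow n) C.⟦ nat n ⟧ ⟩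
    (oneₚ +ₚ C.⟦ nat n ⟧) *ₚ (X *ₚ xpow n) ≈⟨ P.*-congˡ {oneₚ +ₚ C.⟦ nat n ⟧} (X* (xpow n)) ⟩
    C.⟦ nat (suc n) ⟧ *ₚ xpow (suc n)    ∎

  XD-xⁿ-1 : ∀ n → (X *ₚ D (xⁿ-1 n)) ≋ (C.⟦ nat n ⟧ *ₚ (xⁿ-1 n +ₚ oneₚ))
  XD-xⁿ-1 n = begin
    X *ₚ D (xpow n +ₚ ((- 1#) ∷ []))      ≈⟨ P.*-congˡ {X} (D-+ (xpow n) _) ⟩
    X *ₚ (D (xpow n) +ₚ (0# ∷ []))        ≈⟨ P.*-congˡ {X} (P.+-congˡ {D (xpow n)} (0∷[] ≋-refl)) ⟩
    X *ₚ (D (xpow n) +ₚ [])               ≈⟨ P.*-congˡ {X} (P.+-identityʳ _) ⟩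
    X *ₚ D (xpow n)                       ≈⟨ XD-xpow n ⟩
    C.⟦ nat n ⟧ *ₚ xpow n
      ≈⟨ P.*-congˡ {C.⟦ nat n ⟧} (solve 1 (λ w → w := (w :- :1) :+ :1) ≋-refl (xpow n)) ⟩
    C.⟦ nat n ⟧ *ₚ (xⁿ-1 n +ₚ oneₚ)       ∎

  module _ (n : ℕ) (cn : Carrier) (cn-eq : IsNegInverse R n cn)
           {f g : Pol} (fg : (f *ₚ g) ≋ xⁿ-1 n) where
    private
      c N u v : Pol
      c = C.⟦ cn ⟧
      N = C.⟦ nat n ⟧
      u = negₚ (c *ₚ X *ₚ D g) +ₚ negₚ g
      v = negₚ (c *ₚ X *ₚ D f)

    -- Differentiating f g = xⁿ - 1 and multiplying by x gives x f′g + x f g′ = n(f g + 1).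
    coprime-cofactor : (u *ₚ f +ₚ v *ₚ g) ≋ oneₚ
    coprime-cofactor = begin
      u *ₚ f +ₚ v *ₚ g
        ≈⟨ solve 6 (λ c x f g f' g' →
             (:- (c :* x :* g') :- g) :* f :+ (:- (c :* x :* f')) :* g :=
             :- (c :* (x :* (f' :* g :+ f :* g'))) :- f :* g) ≋-refl c X f g (D f) (D g) ⟩
      negₚ (c *ₚ (X *ₚ (D f *ₚ g +ₚ f *ₚ D g))) +ₚ negₚ (f *ₚ g)
        ≈⟨ P.+-congʳ {negₚ (f *ₚ g)} (P.-‿cong (P.*-congˡ {c} eq)) ⟩
      negₚ (c *ₚ (N *ₚ (f *ₚ g +ₚ oneₚ))) +ₚ negₚ (f *ₚ g)
        ≈⟨ solve 3 (λ c k w → :- (c :* (k :* (w :+ :1))) :- w := :- (c :* k) :* (w :+ :1) :- w)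
             ≋-refl c N (f *ₚ g) ⟩
      negₚ (c *ₚ N) *ₚ (f *ₚ g +ₚ oneₚ) +ₚ negₚ (f *ₚ g)
        ≈⟨ P.+-congʳ {negₚ (f *ₚ g)} (P.*-congʳ {f *ₚ g +ₚ oneₚ} (P.-‿cong cN)) ⟩
      negₚ (negₚ oneₚ) *ₚ (f *ₚ g +ₚ oneₚ) +ₚ negₚ (f *ₚ g)
        ≈⟨ solve 1 (λ w → :- (:- :1) :* (w :+ :1) :- w := :1) ≋-refl (f *ₚ g) ⟩
      oneₚ ∎
      where
      eq : (X *ₚ (D f *ₚ g +ₚ f *ₚ D g)) ≋ (N *ₚ (f *ₚ g +ₚ oneₚ))
      eq = begin
        X *ₚ (D f *ₚ g +ₚ f *ₚ D g) ≈⟨ P.*-congˡ {X} (P.sym (D-* f g)) ⟩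
        X *ₚ D (f *ₚ g)             ≈⟨ P.*-congˡ {X} (D-cong fg) ⟩
        X *ₚ D (xⁿ-1 n)             ≈⟨ XD-xⁿ-1 n ⟩
        N *ₚ (xⁿ-1 n +ₚ oneₚ)       ≈⟨ P.*-congˡ {N} (P.+-congʳ {oneₚ} (P.sym fg)) ⟩
        N *ₚ (f *ₚ g +ₚ oneₚ)       ∎
      cN : (c *ₚ N) ≋ negₚ oneₚ
      cN = P.trans (P.sym (C.*-hom cn (nat n))) (C.cong cn-eq)

    -- Separability of xⁿ - 1 in the form used throughout: complementary factors are comaximal as
    -- soon as n is invertible. It is applied over F and over the fields of the tower.
    bezout-cofactor : ∃ λ u → ∃ λ v → (u *ₚ f +ₚ v *ₚ g) ≋ oneₚ
    bezout-cofactor = u , v , coprime-cofactor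

  private
    derivFrom-++ : ∀ k p q → derivFrom k (p ++ q) ≡ derivFrom k p ++ derivFrom (k ℕ.+ length p) q
    derivFrom-++ k []      q = ≡.cong (λ j → derivFrom j q) (≡.sym (ℕₚ.+-identityʳ k))
    derivFrom-++ k (a ∷ p) q = ≡.cong (nat k * a ∷_) (≡.trans (derivFrom-++ (suc k) p q)
      (≡.cong (λ j → derivFrom (suc k) p ++ derivFrom j q) (≡.sym (ℕₚ.+-suc k (length p)))))

    -- For f = p + x^m with m = `length p` these are the coefficients of ((f*)′)*: reversing sends
    -- a_i to index m - i, differentiation multiplies it by m - i and drops the leading 1, and
    -- reversing again restores the order.
    weighted : Pol → Pol
    weighted []      = []
    weighted (a ∷ p) = (nat (suc (length p)) * a) ∷ weighted p

    reverse-derivFrom : ∀ p → reverse (derivFrom 1 (reverse p)) ≡ weighted p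
    reverse-derivFrom []      = ≡.refl
    reverse-derivFrom (a ∷ p) = ≡.trans (≡.cong (λ l → reverse (derivFrom 1 l)) (Listₚ.unfold-reverse a p))
      (≡.trans (≡.cong reverse (≡.trans (derivFrom-++ 1 (reverse p) (a ∷ []))
                 (≡.cong (λ j → derivFrom 1 (reverse p) ++ nat (suc j) * a ∷ []) (Listₚ.length-reverse p))))
        (≡.trans (Listₚ.reverse-++ (derivFrom 1 (reverse p)) _)
          (≡.cong (nat (suc (length p)) * a ∷_) (reverse-derivFrom p))))

    weighted-eq : ∀ p → weighted p ≋
      (C.⟦ nat (length p) ⟧ *ₚ (p ++ oneₚ) +ₚ negₚ (X *ₚ D (p ++ oneₚ)))
    weighted-eq []      = P.sym (P.trans
      (P.+-cong (P.*-congʳ {oneₚ} (0∷[] ≋-refl)) (P.-‿cong (P.trans (P.*-congˡ {X} (0∷[] ≋-refl)) (*ₚ-zeroʳ X))))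
      ≋-refl)
    weighted-eq (a ∷ p) = begin
      (nat (suc l) * a) ∷ weighted p
        ≈⟨ ∷-split _ (weighted p) ⟩
      C.⟦ nat (suc l) * a ⟧ +ₚ X *ₚ weighted p
        ≈⟨ P.+-cong (C.*-hom (nat (suc l)) a) (P.*-congˡ {X} (weighted-eq p)) ⟩
      (oneₚ +ₚ C.⟦ nat l ⟧) *ₚ C.⟦ a ⟧ +ₚ X *ₚ (C.⟦ nat l ⟧ *ₚ f +ₚ negₚ (X *ₚ D f))
        ≈⟨ solve 5 (λ x k a f f' → (:1 :+ k) :* a :+ x :* (k :* f :- x :* f') :=
             (:1 :+ k) :* (a :+ x :* f) :- x :* (f :+ x :* f')) ≋-refl X C.⟦ nat l ⟧ C.⟦ a ⟧ f (D f) ⟩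
      (oneₚ +ₚ C.⟦ nat l ⟧) *ₚ (C.⟦ a ⟧ +ₚ X *ₚ f) +ₚ negₚ (X *ₚ (f +ₚ X *ₚ D f))
        ≈⟨ P.sym (P.+-cong (P.*-congˡ {C.⟦ nat (suc l) ⟧} (∷-split a f))
             (P.-‿cong (P.*-congˡ {X} (D-∷ a f)))) ⟩
      C.⟦ nat (suc l) ⟧ *ₚ (a ∷ f) +ₚ negₚ (X *ₚ D (a ∷ f)) ∎
      where
      l = length p
      f = p ++ oneₚ

  -- ((f*)′)* = (deg f) f - x f′.
  reciprocal-deriv : ∀ p → reverse (deriv (reverse (p ++ oneₚ))) ≋
    (C.⟦ nat (length p) ⟧ *ₚ (p ++ oneₚ) +ₚ negₚ (X *ₚ D (p ++ oneₚ)))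
  reciprocal-deriv p = P.trans (P.reflexive (≡.trans
    (≡.cong (λ l → reverse (deriv l)) (Listₚ.reverse-++ p oneₚ)) (reverse-derivFrom p)))
    (weighted-eq p)

  open Divisibility (polyRing R) using () renaming (_∣_ to _∣P_; m∣*m to P-m∣*m; _by_ to _byP_)

  g∣ef : ∀ cn f g → g ∣P efPoly cn f g
  g∣ef cn f g = P-m∣*m {g} (scale cn (reverse (deriv (reverse f))))

  -- Modulo f the polynomial is -c x f′ g with c = -1/n, and this is the term `v *ₚ g` of the
  -- identity in `coprime-cofactor`, hence congruent to 1.
  f∣ef-1 : ∀ n cn → IsNegInverse R n cn → ∀ {f g} → Monic f → (f *ₚ g) ≋ xⁿ-1 n →
           f ∣P (efPoly cn f g +ₚ negₚ oneₚ)
  f∣ef-1 n cn cn-eq {f} {g} (p , ≡.refl) fg =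
    (c *ₚ M *ₚ g +ₚ c *ₚ X *ₚ D g +ₚ g) byP P.sym (begin
      scale cn (reverse (deriv (reverse f))) *ₚ g +ₚ negₚ oneₚ
        ≈⟨ P.+-cong (P.*-congʳ {g} (P.trans (P.sym (const-* cn _)) (P.*-congˡ {c} (reciprocal-deriv p))))
             (P.-‿cong (P.sym (coprime-cofactor n cn cn-eq {f} {g} fg))) ⟩
      (c *ₚ (M *ₚ f +ₚ negₚ (X *ₚ D f))) *ₚ g +ₚ negₚ
        ((negₚ (c *ₚ X *ₚ D g) +ₚ negₚ g) *ₚ f +ₚ negₚ (c *ₚ X *ₚ D f) *ₚ g)
        ≈⟨ solve 7 (λ c x f g f' g' m → c :* (m :* f :- x :* f') :* g :-
             ((:- (c :* x :* g') :- g) :* f :+ :- (c :* x :* f') :* g) :=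
             f :* (c :* m :* g :+ c :* x :* g' :+ g)) ≋-refl c X f g (D f) (D g) M ⟩
      f *ₚ (c *ₚ M *ₚ g +ₚ c *ₚ X *ₚ D g +ₚ g) ∎)
      where
      c M : Pol
      c = C.⟦ cn ⟧
      M = C.⟦ nat (length p) ⟧

-- Fields with decidable equality: Bézout identities, irreducibles, factorisation.

module DiscreteField (F : Field) (_≟_ : ∀ x y → Dec (Field._≈_ F x y)) where
  open Field F
  open Poly commRing
  open PolynomialRing commRing
  open Degree commRing
  open Divisibility (polyRing commRing)
  private
    module P = CommutativeRing (polyRing commRing)
  open IntegerSolver (polyRing commRing)
  open import Relation.Binary.Reasoning.Setoid P.setoid

  ≋[]? : ∀ p → Dec (p ≋ [])
  ≋[]? []      = yes ≋-refl
  ≋[]? (a ∷ p) = map′ (λ (e , f) → ≋-trans (∷-cong e f) (0∷[] ≋-refl))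
                      (λ e → at e 0 , ∷-tail[] e) ((a ≟ 0#) ×-dec ≋[]? p)

  record Normalised (p : Pol) (k : ℕ) : Set where
    field
      deg         : ℕ
      deg<k       : deg < k
      monic       : Pol
      isMonic     : MonicOfDegree deg monic
      unit unit⁻¹ : Pol
      unit-deg    : Deg< unit 1
      unit-inv    : (unit *ₚ unit⁻¹) ≋ oneₚ
      factorised  : p ≋ (unit *ₚ monic)

  -- Coefficients are compared with 0 from the bound downwards; the first nonzero one becomes the
  -- unit.
  normalise : ∀ k p → Deg< p k → p ≋ [] ⊎ Normalised p k
  normalise zero    p d = inj₁ (deg<0 d)
  normalise (suc k) p d with coeff p k ≟ 0#
  ... | yes z with normalise k p (deg<-pred d z)
  ...   | inj₁ e = inj₁ e
  ...   | inj₂ N = inj₂ record { Normalised N ; deg<k = ℕₚ.m<n⇒m<1+n (Normalised.deg<k N) }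
  normalise (suc k) p d | no nz with inverse (coeff p k) nz
  ... | c' , cc' = inj₂ record
    { deg = k ; deg<k = ℕₚ.n<1+n k ; monic = scale c' p
    ; isMonic = monicOf (trans (coeff-scale c' p k) (trans (*-comm _ _) cc')) (deg<-scale c' d)
    ; unit = coeff p k ∷ [] ; unit⁻¹ = c' ∷ []
    ; unit-deg = deg<-length (coeff p k ∷ [])
    ; unit-inv = P.trans (P.sym (Hom.*-hom (constHom commRing) _ _)) (∷-cong cc' ≋-refl)
    ; factorised = P.sym (P.trans (const-* _ (scale c' p)) (P.trans (scale-scale _ c' p)
        (P.trans (scale-cong cc' ≋-refl) (scale-1 p)))) }

  open Normalised

  normalised-∣ : ∀ {p k} (N : Normalised p k) → monic N ∣ p
  normalised-∣ N = unit N by P.trans (P.*-comm _ (unit N)) (P.sym (factorised N))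

  ∣-normalised : ∀ {p k} (N : Normalised p k) → p ∣ monic N
  ∣-normalised {p} N = unit⁻¹ N by (begin
    p *ₚ unit⁻¹ N                     ≈⟨ P.*-congʳ {unit⁻¹ N} (factorised N) ⟩
    unit N *ₚ monic N *ₚ unit⁻¹ N     ≈⟨ solve 3 (λ u m v → u :* m :* v := m :* (u :* v)) ≋-refl (unit N) (monic N) (unit⁻¹ N) ⟩
    monic N *ₚ (unit N *ₚ unit⁻¹ N)   ≈⟨ P.*-congˡ {monic N} (unit-inv N) ⟩
    monic N *ₚ oneₚ                   ≈⟨ P.*-identityʳ _ ⟩
    monic N                           ∎)

  monic-∣? : ∀ {m f} → MonicOfDegree m f → ∀ p → Dec (f ∣ p)
  monic-∣? {m} {f} M p with divMod M p
  ... | q , r , e , d with ≋[]? r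
  ...   | yes z = yes (q by P.sym (P.trans e (P.trans (P.+-congˡ {q *ₚ f} z)
                    (P.trans (P.+-identityʳ _) (P.*-comm q f)))))
  ...   | no nz = no λ (h by fh) → nz (r-zero h fh)
    where
    r-zero : ∀ h → (f *ₚ h) ≋ p → r ≋ []
    r-zero h fh = P.trans r≋ (P.trans (P.*-congˡ {f} (monic*-deg< M (deg<-resp r≋ d))) (*ₚ-zeroʳ f))
      where
      r≋ : r ≋ (f *ₚ (h +ₚ negₚ q))
      r≋ = begin
        r                                    ≈⟨ solve 3 (λ q f r → r := q :* f :+ r :- q :* f) ≋-refl q f r ⟩
        q *ₚ f +ₚ r +ₚ negₚ (q *ₚ f)         ≈⟨ P.+-congʳ {negₚ (q *ₚ f)} (P.trans (P.sym e) (P.sym fh)) ⟩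
        f *ₚ h +ₚ negₚ (q *ₚ f)              ≈⟨ solve 3 (λ f h q → f :* h :- q :* f := f :* (h :- q)) ≋-refl f h q ⟩
        f *ₚ (h +ₚ negₚ q)                   ∎

  _∣?_ : ∀ f p → Dec (f ∣ p)
  f ∣? p with normalise (length f) f (deg<-length f)
  ... | inj₁ z = map′ (λ e → [] by P.trans (*ₚ-zeroʳ f) (P.sym e))
                      (λ (h by e) → P.trans (P.sym e) (*ₚ-congʳ h z)) (≋[]? p)
  ... | inj₂ N = map′ (∣-trans (∣-normalised N)) (∣-trans (normalised-∣ N)) (monic-∣? (isMonic N) p)

  record Bezout (p q : Pol) : Set where
    field
      common u v  : Pol
      common∣p    : common ∣ p
      common∣q    : common ∣ q
      combo    : (u *ₚ p +ₚ v *ₚ q) ≋ common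

  private
    -- Induction on a degree bound for `q`. Division is by the monic associate of `q`, which is
    -- `unit⁻¹ N` times `q`; this accounts for the factor `unit⁻¹ N` in the coefficients.
    euclid : ∀ k p q → Deg< q k → Bezout p q
    euclid k p q d with normalise k q d
    euclid k p q d | inj₁ z = record
      { common = p ; u = oneₚ ; v = [] ; common∣p = ∣-refl ; common∣q = ∣-respʳ (P.sym z) ∣0
      ; combo = P.trans (P.+-identityʳ _) (P.*-identityˡ p) }
    euclid zero    p q d | inj₂ N with deg<k N
    ... | ()
    euclid (suc k) p q d | inj₂ N with divMod (isMonic N) p
    ... | t , r , e , dr with euclid k q r (deg<-weaken (ℕₚ.≤-pred (deg<k N)) dr)
    ...   | B = record
      { common = B.common ; u = B.v ; v = B.u +ₚ negₚ (B.v *ₚ (t *ₚ unit⁻¹ N))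
      ; common∣p = ∣-respʳ (P.sym p≋) (∣+ (∣*ˡ (t *ₚ unit⁻¹ N) B.common∣p) B.common∣q)
      ; common∣q = B.common∣p
      ; combo = P.trans (P.+-congʳ {(B.u +ₚ negₚ (B.v *ₚ (t *ₚ unit⁻¹ N))) *ₚ q} (P.*-congˡ {B.v} p≋))
          (P.trans (solve 5 (λ u v t q r → v :* (t :* q :+ r) :+ (u :- v :* t) :* q := u :* q :+ v :* r)
             ≋-refl B.u B.v (t *ₚ unit⁻¹ N) q r) B.combo) }
      where
      module B = Bezout B
      p≋ : p ≋ (t *ₚ unit⁻¹ N *ₚ q +ₚ r)
      p≋ = P.trans e (P.+-congʳ {r} (P.trans (P.*-congˡ {t} (P.trans (P.sym (product (∣-normalised N)))
             (P.*-comm q (unit⁻¹ N)))) (P.sym (P.*-assoc t (unit⁻¹ N) q))))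

  bezout : ∀ p q → Bezout p q
  bezout p q = euclid (length q) p q (deg<-length q)

  record Irr (f : Pol) : Set where
    constructor mkIrr
    field
      ≉0       : ¬ (f ≋ [])
      ∤1       : ¬ (f ∣ oneₚ)
      no-split : ∀ g h → (g *ₚ h) ≋ f → g ∣ oneₚ ⊎ h ∣ oneₚ
  open Irr public

  IsUnit⇒ : ∀ {p} → IsUnit p → p ∣ oneₚ
  IsUnit⇒ (u , e) = u by mk≋ e

  ⇒IsUnit : ∀ {p} → p ∣ oneₚ → IsUnit p
  ⇒IsUnit (u by e) = u , at e

  Irreducible⇒Irr : ∀ {f} → Irreducible f → Irr f
  Irreducible⇒Irr {f} (a , b , c) = mkIrr (λ z → a (at z)) (λ u → b (⇒IsUnit u))
    λ g h e → Sum.map (IsUnit⇒ {g}) (IsUnit⇒ {h}) (c g h (at e))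

  Irr⇒Irreducible : ∀ {f} → Irr f → Irreducible f
  Irr⇒Irreducible {f} I = (λ z → ≉0 I (mk≋ z)) , (λ u → ∤1 I (IsUnit⇒ {f} u)) ,
    λ g h e → Sum.map ⇒IsUnit ⇒IsUnit (no-split I g h (mk≋ e))

  irr-resp : ∀ {p q} → p ≋ q → Irr p → Irr q
  irr-resp e I = mkIrr (λ z → ≉0 I (P.trans e z)) (λ u → ∤1 I (∣-respˡ (P.sym e) u))
    λ g h z → no-split I g h (P.trans z (P.sym e))

  -- The common divisor found by the Euclidean algorithm is one side of a factorisation of f: if it
  -- is a unit, scaling gives 1; if its cofactor is a unit, f divides it and hence p.
  irreducible-dichotomy : ∀ {f} → Irr f → ∀ p →
                          f ∣ p ⊎ ∃ λ u → ∃ λ v → (u *ₚ f +ₚ v *ₚ p) ≋ oneₚ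
  irreducible-dichotomy {f} I p = case (no-split I common (cofactor common∣p) (product common∣p))
    where
    open Bezout (bezout f p)
    case : common ∣ oneₚ ⊎ cofactor common∣p ∣ oneₚ → f ∣ p ⊎ ∃ λ u → ∃ λ v → (u *ₚ f +ₚ v *ₚ p) ≋ oneₚ
    case (inj₁ (w by e)) = inj₂ (w *ₚ u , w *ₚ v , P.trans
      (solve 5 (λ u v f p w → w :* u :* f :+ w :* v :* p := (u :* f :+ v :* p) :* w) ≋-refl u v f p w)
      (P.trans (P.*-congʳ {w} combo) e))
    case (inj₂ (w by e)) = inj₁ (∣-trans (w by (begin
      f *ₚ w                          ≈⟨ P.*-congʳ {w} (P.sym (product common∣p)) ⟩
      common *ₚ cofactor common∣p *ₚ w         ≈⟨ P.*-assoc common (cofactor common∣p) w ⟩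
      common *ₚ (cofactor common∣p *ₚ w)       ≈⟨ P.*-congˡ {common} e ⟩
      common *ₚ oneₚ                     ≈⟨ P.*-identityʳ common ⟩
      common                             ∎)) common∣q)

  bezout-∣ : ∀ {f p q} u v → (u *ₚ f +ₚ v *ₚ p) ≋ oneₚ → f ∣ (p *ₚ q) → f ∣ q
  bezout-∣ {f} {p} {q} u v e d = ∣-respʳ
    (P.trans (solve 5 (λ u v f p q → u :* q :* f :+ v :* (p :* q) := (u :* f :+ v :* p) :* q) ≋-refl u v f p q)
      (P.trans (P.*-congʳ {q} e) (P.*-identityˡ q)))
    (∣+ (m∣*m (u *ₚ q)) (∣*ˡ v d))

  irreducible-prime : ∀ {f} → Irr f → ∀ p q → f ∣ (p *ₚ q) → f ∣ p ⊎ f ∣ q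
  irreducible-prime irr p q d with irreducible-dichotomy irr p
  ... | inj₁ f∣p         = inj₁ f∣p
  ... | inj₂ (u , v , e) = inj₂ (bezout-∣ u v e d)

  monic≉0 : ∀ {m p} → MonicOfDegree m p → ¬ (p ≋ [])
  monic≉0 {m} (monicOf l _) z = 1≉0 (trans (sym l) (at z m))

-- The computational content of finiteness, without an enumeration. It passes from a field to
-- polynomials of bounded degree, and so to residue rings modulo a monic polynomial, which carries
-- it up to L.
Searchable : CR → Set₁
Searchable R = (Q : Carrier → Set) → (∀ {a b} → a ≈ b → Q a → Q b) → (∀ a → Dec (Q a)) → Dec (∃ Q)
  where open CommutativeRing R

module SearchableField (F : Field) (_≟_ : ∀ x y → Dec (Field._≈_ F x y))
                       (search : Searchable (Field.commRing F)) where
  open Field F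
  open Poly commRing
  open PolynomialRing commRing
  open Degree commRing
  open DiscreteField F _≟_
  open Divisibility (polyRing commRing)
  private
    module P = CommutativeRing (polyRing commRing)
  open import Relation.Binary.Reasoning.Setoid P.setoid

  searchPol : ∀ k (Q : Pol → Set) → (∀ {p q} → p ≋ q → Q p → Q q) → (∀ p → Dec (Q p)) →
              Dec (∃ λ p → Deg< p k × Q p)
  searchPol zero    Q resp dec = map′ (λ q → [] , deg< (λ _ _ → refl) , q)
                                      (λ (p , d , q) → resp (deg<0 d) q) (dec [])
  searchPol (suc k) Q resp dec = map′
    (λ (a , p , d , q) → (a ∷ p) , deg<-∷ d , q) from
    (search (λ a → ∃ λ p → Deg< p k × Q (a ∷ p))
      (λ e (p , d , q) → p , d , resp (∷-cong e ≋-refl) q)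
      (λ a → searchPol k (λ p → Q (a ∷ p)) (λ e → resp (∷-cong refl e)) (λ p → dec (a ∷ p))))
    where
    from : (∃ λ p → Deg< p (suc k) × Q p) → ∃ λ a → ∃ λ p → Deg< p k × Q (a ∷ p)
    from ([]      , d , q) = 0# , [] , deg< (λ _ _ → refl) , resp (≋-sym (0∷[] ≋-refl)) q
    from ((a ∷ p) , d , q) = a , p , deg<-tail d , q

  IsProperFactor : Pol → Pol → Set
  IsProperFactor p d = (d ∣ p) × (¬ (d ∣ oneₚ)) × (¬ (p ∣ d))

  -- Bounds the search for divisors in `factorise`.
  monic-factor-deg : ∀ {m p g} → MonicOfDegree m p → g ∣ p → Deg< g (suc m)
  monic-factor-deg {m} {p} {g} M (h by e) with normalise (length g) g (deg<-length g)
  ... | inj₁ z = ⊥-elim (monic≉0 M (P.trans (P.sym e) (*ₚ-congʳ h z)))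
  ... | inj₂ N with monic-cofactor 1≉0 (isMonic N) M (product (∣-trans (normalised-∣ N) (h by e)))
    where open Normalised
  ...   | k , ≡.refl , _ = deg<-resp (P.sym (Normalised.factorised N))
          (deg<-weaken (s≤s (ℕₚ.m≤m+n (Normalised.deg N) k))
            (deg<-* (Normalised.unit N) (Normalised.monic N) (Normalised.unit-deg N) (MonicOfDegree.rest (Normalised.isMonic N))))

  -- A proper divisor is searched for among the polynomials of degree at most that of `p`; if there
  -- is none, every factor is a unit or an associate of `p`. Positive degrees are written as
  -- successors, so the inequalities say that both factors have smaller degree.
  factorise : ∀ {m p} → MonicOfDegree (suc m) p →
    Irr p ⊎ ∃ λ p₁ → ∃ λ p₂ → ∃ λ m₁ → ∃ λ m₂ →
      MonicOfDegree (suc m₁) p₁ × MonicOfDegree (suc m₂) p₂ × ((p₁ *ₚ p₂) ≋ p) × m₁ < m × m₂ < m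
  factorise {m} {p} M with searchPol (suc (suc m)) (IsProperFactor p)
      (λ e (a , b , c) → ∣-respˡ e a , (λ z → b (∣-respˡ (≋-sym e) z)) , (λ z → c (∣-respʳ (≋-sym e) z)))
      (λ d → (d ∣? p) ×-dec (¬? (d ∣? oneₚ) ×-dec ¬? (p ∣? d)))
  ... | no none = inj₁ (mkIrr (monic≉0 M) p-nonunit irr)
    where
    p-nonunit : ¬ (p ∣ oneₚ)
    p-nonunit (u by e) with monic-cofactor 1≉0 M monic-one e
    ... | _ , () , _
    irr : ∀ g h → (g *ₚ h) ≋ p → g ∣ oneₚ ⊎ h ∣ oneₚ
    irr g h e with g ∣? oneₚ | p ∣? g
    ... | yes u | _ = inj₁ u
    ... | no ¬u | no ¬p∣g = ⊥-elim (none (g , monic-factor-deg M (h by e) , (h by e) , ¬u , ¬p∣g))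
    -- From g = p w and g h = p, cancelling p leaves w h = 1.
    ... | no ¬u | yes (w by pw) = inj₂ (w by (P.trans (P.*-comm h w) (monic-cancelˡ M (begin
      p *ₚ (w *ₚ h) ≈⟨ P.sym (P.*-assoc p w h) ⟩
      p *ₚ w *ₚ h   ≈⟨ P.*-congʳ {h} pw ⟩
      g *ₚ h        ≈⟨ e ⟩
      p             ≈⟨ P.sym (P.*-identityʳ p) ⟩
      p *ₚ oneₚ     ∎))))
  ... | yes (d , _ , d∣p , ¬u , ¬p∣d) with normalise (length d) d (deg<-length d)
  ...   | inj₁ z = ⊥-elim (monic≉0 M (P.trans (P.sym (product d∣p)) (*ₚ-congʳ (cofactor d∣p) z)))
  ...   | inj₂ N = inj₂ (proper (Normalised.deg N) (Normalised.isMonic N) (∣-trans (normalised-∣ N) d∣p))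
    where
    proper : ∀ m₁ → MonicOfDegree m₁ (Normalised.monic N) → Normalised.monic N ∣ p →
      ∃ λ p₁ → ∃ λ p₂ → ∃ λ m₁ → ∃ λ m₂ →
      MonicOfDegree (suc m₁) p₁ × MonicOfDegree (suc m₂) p₂ × ((p₁ *ₚ p₂) ≋ p) × m₁ < m × m₂ < m
    proper zero     M₁ _       = ⊥-elim (¬u (∣-trans (∣-normalised N) (∣-reflexive (monic0 M₁))))
    proper (suc m₁) M₁ (e by q) with monic-cofactor 1≉0 M₁ M q
    ... | zero , _ , M₂ = ⊥-elim (¬p∣d (∣-trans (∣-reflexive (P.sym (P.trans
            (P.sym (P.*-identityʳ _)) (P.trans (P.*-congˡ {Normalised.monic N} (P.sym (monic0 M₂))) q))))
            (normalised-∣ N)))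
    ... | suc m₂ , eq , M₂ = Normalised.monic N , e , m₁ , m₂ , M₁ , M₂ , q ,
            ≡.subst (m₁ <_) (≡.sym m≡) (ℕₚ.m<m+n m₁ (s≤s z≤n)) ,
            ≡.subst (m₂ <_) (≡.sym m≡) (ℕₚ.m≤n+m (suc m₂) m₁)
      where
      m≡ : m ≡ m₁ ℕ.+ suc m₂
      m≡ = ℕₚ.suc-injective eq

  -- `T` is any property that a product passes on to one of its factors. The trivial `T` gives a
  -- plain irreducible factor for the tower; `Missed` finds a component on which a given element
  -- does not vanish.
  irreducible-factor : (T : Pol → Set) → (∀ {p q} → p ≋ q → T p → T q) →
    (∀ p q → T (p *ₚ q) → T p ⊎ T q) → ∀ {m p} → MonicOfDegree (suc m) p → T p →
    ∃ λ f → Monic f × Irr f × f ∣ p × T f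
  irreducible-factor T resp split {m} = go m ℕₚ.≤-refl
    where
    go : ∀ k {m p} → m ≤ k → MonicOfDegree (suc m) p → T p → ∃ λ f → Monic f × Irr f × f ∣ p × T f
    go k {m} {p} m≤k M t with factorise M
    ... | inj₁ irr with ⇒Monic M
    ...   | f , mf , e = f , mf , irr-resp e irr , ∣-reflexive (P.sym e) , resp e t
    go zero    m≤k M t | inj₂ (_ , _ , _ , _ , _ , _ , _ , l , _) with ℕₚ.<-≤-trans l m≤k
    ... | ()
    go (suc k) m≤k M t | inj₂ (p₁ , p₂ , m₁ , m₂ , M₁ , M₂ , e , l₁ , l₂) with split p₁ p₂ (resp (≋-sym e) t)
    ... | inj₁ t₁ with go k (ℕₚ.≤-pred (ℕₚ.≤-trans l₁ m≤k)) M₁ t₁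
    ...   | f , mf , irr , d , tf = f , mf , irr , ∣-trans d (p₂ by e) , tf
    go (suc k) m≤k M t | inj₂ (p₁ , p₂ , m₁ , m₂ , M₁ , M₂ , e , l₁ , l₂) | inj₂ t₂
      with go k (ℕₚ.≤-pred (ℕₚ.≤-trans l₂ m≤k)) M₂ t₂
    ...   | f , mf , irr , d , tf = f , mf , irr , ∣-trans d (p₁ by P.trans (P.*-comm p₂ p₁) e) , tf

-- The algebra R ⊕ R y: central elements and criteria for primitive central idempotents.

-- The pair (a , b) stands for a + b y, where y² = 1 and y r = σ(r) y.
module TwistedAlgebra (R : CR) (σ : Hom R R)
    (σσ : ∀ a → CommutativeRing._≈_ R (Hom.⟦_⟧ σ (Hom.⟦_⟧ σ a)) a) where
  open CommutativeRing R
  open Hom σ renaming (⟦_⟧ to S; cong to S-cong; +-hom to S-+; *-hom to S-*; 1-hom to S-1)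
  open HomProperties σ
  open IntegerSolver R
  open import Relation.Binary.Reasoning.Setoid setoid

  A : Set
  A = Carrier × Carrier

  infix 4 _≈ᴬ_
  record _≈ᴬ_ (z w : A) : Set where
    constructor mkᴬ
    field
      fst≈ : proj₁ z ≈ proj₁ w
      snd≈ : proj₂ z ≈ proj₂ w
  open _≈ᴬ_ public

  ≈ᴬ-refl : ∀ {z} → z ≈ᴬ z
  ≈ᴬ-refl = mkᴬ refl refl

  ≈ᴬ-sym : ∀ {z w} → z ≈ᴬ w → w ≈ᴬ z
  ≈ᴬ-sym (mkᴬ a b) = mkᴬ (sym a) (sym b)

  ≈ᴬ-trans : ∀ {z w v} → z ≈ᴬ w → w ≈ᴬ v → z ≈ᴬ v
  ≈ᴬ-trans (mkᴬ a b) (mkᴬ c d) = mkᴬ (trans a c) (trans b d)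

  infixl 7 _·_
  _·_ : A → A → A
  (a , b) · (c , d) = a * c + b * S d , a * d + b * S c

  0ᴬ : A
  0ᴬ = 0# , 0#

  ·-cong : ∀ {z z' w w'} → z ≈ᴬ z' → w ≈ᴬ w' → z · w ≈ᴬ z' · w'
  ·-cong (mkᴬ a b) (mkᴬ c d) = mkᴬ (+-cong (*-cong a c) (*-cong b (S-cong d)))
                                   (+-cong (*-cong a d) (*-cong b (S-cong c)))

  ·-assoc : ∀ z w v → z · w · v ≈ᴬ z · (w · v)
  ·-assoc (a , b) (c , d) (e , f) = mkᴬ
    (trans (solve 8 (λ a b c d sc sd e sf → (a :* c :+ b :* sd) :* e :+ (a :* d :+ b :* sc) :* sf :=
        a :* (c :* e :+ d :* sf) :+ b :* (sc :* sf :+ sd :* e)) refl a b c d (S c) (S d) e (S f))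
      (+-congˡ (*-congˡ (sym (begin
        S (c * f + d * S e)         ≈⟨ S-+ _ _ ⟩
        S (c * f) + S (d * S e)     ≈⟨ +-cong (S-* _ _) (S-* _ _) ⟩
        S c * S f + S d * S (S e)   ≈⟨ +-congˡ (*-congˡ (σσ e)) ⟩
        S c * S f + S d * e         ∎)))))
    (trans (solve 8 (λ a b c d sc sd f se → (a :* c :+ b :* sd) :* f :+ (a :* d :+ b :* sc) :* se :=
        a :* (c :* f :+ d :* se) :+ b :* (sc :* se :+ sd :* f)) refl a b c d (S c) (S d) f (S e))
      (+-congˡ (*-congˡ (sym (begin
        S (c * e + d * S f)         ≈⟨ S-+ _ _ ⟩
        S (c * e) + S (d * S f)     ≈⟨ +-cong (S-* _ _) (S-* _ _) ⟩
        S c * S e + S d * S (S f)   ≈⟨ +-congˡ (*-congˡ (σσ f)) ⟩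
        S c * S e + S d * f         ∎)))))

  Centralᴬ : A → Set
  Centralᴬ e = ∀ w → e · w ≈ᴬ w · e

  Idempotentᴬ : A → Set
  Idempotentᴬ e = e · e ≈ᴬ e

  record PCI (e : A) : Set where
    field
      central    : Centralᴬ e
      idempotent : Idempotentᴬ e
      nonzero    : ¬ (e ≈ᴬ 0ᴬ)
      minimal    : ∀ w → Centralᴬ w → Idempotentᴬ w → e · w ≈ᴬ w → w ≈ᴬ 0ᴬ ⊎ w ≈ᴬ e
  open PCI public

  -- The product is a nonzero central idempotent lying below both, so minimality makes it equal to
  -- each.
  pci-unique : ∀ {e e'} → PCI e → PCI e' → ¬ (e · e' ≈ᴬ 0ᴬ) → e ≈ᴬ e'
  pci-unique {e} {e'} p p' nz = ≈ᴬ-trans (≈ᴬ-sym (pick (minimal p z cz iz ez))) (pick (minimal p' z cz iz e'z))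
    where
    z = e · e'
    pick : ∀ {w} → z ≈ᴬ 0ᴬ ⊎ z ≈ᴬ w → z ≈ᴬ w
    pick (inj₁ q) = ⊥-elim (nz q)
    pick (inj₂ q) = q
    infixr 2 _»_
    _»_ : ∀ {a b c} → a ≈ᴬ b → b ≈ᴬ c → a ≈ᴬ c
    _»_ = ≈ᴬ-trans
    cz : Centralᴬ z
    cz w = ·-assoc e e' w » ·-cong ≈ᴬ-refl (central p' w) » ≈ᴬ-sym (·-assoc e w e')
         » ·-cong (central p w) ≈ᴬ-refl » ·-assoc w e e'
    ez : e · z ≈ᴬ z
    ez = ≈ᴬ-sym (·-assoc e e e') » ·-cong (idempotent p) ≈ᴬ-refl
    e'z : e' · z ≈ᴬ z
    e'z = central p' z » ·-assoc e e' e' » ·-cong ≈ᴬ-refl (idempotent p')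
    iz : Idempotentᴬ z
    iz = ·-assoc e e' z » ·-cong ≈ᴬ-refl e'z » ez

  -- The equations for a and b come from commuting with y, the last one from commuting with (c , 0).
  central-parts : ∀ {a b} → Centralᴬ (a , b) → (S a ≈ a) × (S b ≈ b) × (∀ c → b * S c ≈ b * c)
  central-parts {a} {b} C = Sa , Sb , λ c → trans (sym (left a b c (snd≈ (C (c , 0#))))) (*-comm c b)
    where
    y : (a , b) · (0# , 1#) ≈ᴬ (0# , 1#) · (a , b)
    y = C (0# , 1#)
    Sb : S b ≈ b
    Sb = begin
      S b                    ≈⟨ solve 2 (λ a b → b := :0 :* a :+ :1 :* b) refl a (S b) ⟩
      0# * a + 1# * S b      ≈⟨ sym (fst≈ y) ⟩
      a * 0# + b * S 1#      ≈⟨ +-congˡ (*-congˡ S-1) ⟩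
      a * 0# + b * 1#        ≈⟨ solve 2 (λ a b → a :* :0 :+ b :* :1 := b) refl a b ⟩
      b                      ∎
    Sa : S a ≈ a
    Sa = begin
      S a                    ≈⟨ solve 2 (λ a b → a := :0 :* b :+ :1 :* a) refl (S a) b ⟩
      0# * b + 1# * S a      ≈⟨ sym (snd≈ y) ⟩
      a * 1# + b * S 0#      ≈⟨ +-congˡ (*-congˡ 0-hom) ⟩
      a * 1# + b * 0#        ≈⟨ solve 2 (λ a b → a :* :1 :+ b :* :0 := a) refl a b ⟩
      a                      ∎
    left : ∀ a b c → a * 0# + b * S c ≈ c * b + 0# * S a → c * b ≈ b * S c
    left a b c e = begin
      c * b                  ≈⟨ solve 3 (λ c b a → c :* b := c :* b :+ :0 :* a) refl c b (S a) ⟩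
      c * b + 0# * S a       ≈⟨ sym e ⟩
      a * 0# + b * S c       ≈⟨ solve 2 (λ a x → a :* :0 :+ x := x) refl a _ ⟩
      b * S c                ∎

  parts-central : ∀ {a b} → S a ≈ a → S b ≈ b → (∀ c → b * S c ≈ b * c) → Centralᴬ (a , b)
  parts-central {a} {b} Sa Sb Sc (c , d) = mkᴬ
    (trans (+-congˡ (Sc d)) (trans (solve 4 (λ a b c d → a :* c :+ b :* d := c :* a :+ d :* b) refl a b c d)
      (+-congˡ (*-congˡ (sym Sb)))))
    (trans (+-congˡ (Sc c)) (trans (solve 4 (λ a b c d → a :* d :+ b :* c := c :* b :+ d :* a) refl a b c d)
      (+-congˡ (*-congˡ (sym Sa)))))

  -- Primitive idempotents of the commutative ring `R`.
  record Atom (u : Carrier) : Set where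
    field
      idem  : u * u ≈ u
      ≉0    : ¬ (u ≈ 0#)
      atom  : ∀ a → u * a ≈ a → a * a ≈ a → a ≈ 0# ⊎ a ≈ u

  -- On the component of `u` the element σ(c) - c, with c = `at`, is invertible with inverse `w`: a
  -- witnessed form of σ not being the identity there.
  record Moves (u : Carrier) : Set where
    constructor moves
    field
      at w : Carrier
      move : w * (S at - at) * u ≈ u

  private
    -- As b annihilates σ(c) - c, which is invertible on the component of `u`, it vanishes on that
    -- component.
    killed : ∀ {u} → Moves u → ∀ {b} → (∀ c → b * S c ≈ b * c) → u * b ≈ 0#
    killed {u} (moves c w m) {b} Sc = begin
      u * b                      ≈⟨ *-congʳ (sym m) ⟩
      w * (S c - c) * u * b      ≈⟨ solve 5 (λ w s c u b → w :* (s :- c) :* u :* b := w :* u :* (b :* s :- b :* c)) refl w (S c) c u b ⟩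
      w * u * (b * S c - b * c)  ≈⟨ *-congˡ (trans (+-congʳ (Sc c)) (-‿inverseʳ _)) ⟩
      w * u * 0#                 ≈⟨ zeroʳ _ ⟩
      0#                         ∎

    pure-· : ∀ u z → (u , 0#) · z ≈ᴬ (u * proj₁ z , u * proj₂ z)
    pure-· u (a , b) = mkᴬ (solve 3 (λ u a s → u :* a :+ :0 :* s := u :* a) refl u a (S b))
                           (solve 3 (λ u a s → u :* a :+ :0 :* s := u :* a) refl u b (S a))

    pure-central : ∀ {u} → S u ≈ u → Centralᴬ (u , 0#)
    pure-central Su = parts-central Su 0-hom λ c → trans (zeroˡ _) (sym (zeroˡ _))

    pure-idem : ∀ {u} → u * u ≈ u → Idempotentᴬ (u , 0#)
    pure-idem {u} uu = ≈ᴬ-trans (pure-· u (u , 0#)) (mkᴬ uu (zeroʳ _))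

    idem-fst : ∀ {a b} → b ≈ 0# → Idempotentᴬ (a , b) → a * a ≈ a
    idem-fst {a} {b} b0 i = trans (trans (solve 2 (λ a s → a :* a := a :* a :+ :0 :* s) refl a (S b))
      (+-congˡ (*-congʳ (sym b0)))) (fst≈ i)

  pci-fixed : ∀ {u} → Atom u → S u ≈ u → Moves u → PCI (u , 0#)
  pci-fixed {u} At Su M = record
    { central    = pure-central Su
    ; idempotent = pure-idem idem
    ; nonzero    = λ z → ≉0 (fst≈ z)
    ; minimal    = prim }
    where
    open Atom At
    prim : ∀ w → Centralᴬ w → Idempotentᴬ w → (u , 0#) · w ≈ᴬ w → w ≈ᴬ 0ᴬ ⊎ w ≈ᴬ (u , 0#)
    prim (a , b) c i l = Sum.map (λ e → mkᴬ e b0) (λ e → mkᴬ e b0) (atom a ua (idem-fst b0 i))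
      where
      l' : (u * a , u * b) ≈ᴬ (a , b)
      l' = ≈ᴬ-trans (≈ᴬ-sym (pure-· u (a , b))) l
      ua : u * a ≈ a
      ua = fst≈ l'
      b0 : b ≈ 0#
      b0 = trans (sym (snd≈ l')) (killed M (proj₂ (proj₂ (central-parts c))))

  -- A σ-fixed `a` satisfies v a = σ(u a), so below u + v it is determined by u a, to which the atom
  -- property applies. The y-part is killed on both components, the witness for `v` being the
  -- σ-image of the one for `u`.
  pci-swapped : ∀ {u v} → Atom u → S u ≈ v → S v ≈ u → u * v ≈ 0# → Moves u → PCI (u + v , 0#)
  pci-swapped {u} {v} At Su Sv uv M = record
    { central    = pure-central (trans (S-+ u v) (trans (+-cong Su Sv) (+-comm v u)))
    ; idempotent = pure-idem (begin
        (u + v) * (u + v)           ≈⟨ solve 2 (λ u v → (u :+ v) :* (u :+ v) := u :* u :+ v :* v :+ (u :* v :+ u :* v)) refl u v ⟩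
        u * u + v * v + (u * v + u * v) ≈⟨ +-cong (+-cong idem vv) (+-cong uv uv) ⟩
        u + v + (0# + 0#)           ≈⟨ solve 1 (λ x → x :+ (:0 :+ :0) := x) refl _ ⟩
        u + v                       ∎)
    ; nonzero    = λ z → ≉0 (trans (sym (absorb refl)) (trans (*-congˡ (fst≈ z)) (zeroʳ u)))
    ; minimal    = prim }
    where
    open Atom At
    vv : v * v ≈ v
    vv = trans (*-cong (sym Su) (sym Su)) (trans (sym (S-* u u)) (trans (S-cong idem) Su))
    absorb : ∀ {x} → x ≈ u + v → u * x ≈ u
    absorb {x} e = begin
      u * x          ≈⟨ *-congˡ e ⟩
      u * (u + v)    ≈⟨ distribˡ u u v ⟩
      u * u + u * v  ≈⟨ +-cong idem uv ⟩
      u + 0#         ≈⟨ +-identityʳ u ⟩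
      u              ∎
    vM : Moves v
    vM = moves (S (Moves.at M)) (S (Moves.w M)) (begin
      S w * (S (S c) - S c) * v       ≈⟨ *-congˡ (sym Su) ⟩
      S w * (S (S c) - S c) * S u     ≈⟨ *-congʳ (*-congˡ (sym (sub-hom _ _))) ⟩
      S w * S (S c - c) * S u         ≈⟨ *-congʳ (sym (S-* _ _)) ⟩
      S (w * (S c - c)) * S u         ≈⟨ sym (S-* _ _) ⟩
      S (w * (S c - c) * u)           ≈⟨ S-cong (Moves.move M) ⟩
      S u                             ≈⟨ Su ⟩
      v                               ∎)
      where
      c = Moves.at M
      w = Moves.w M
    prim : ∀ w → Centralᴬ w → Idempotentᴬ w → (u + v , 0#) · w ≈ᴬ w → w ≈ᴬ 0ᴬ ⊎ w ≈ᴬ (u + v , 0#)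
    prim (a , b) c i l = Sum.map
        (λ e → mkᴬ (trans (sym split) (trans (+-cong e (trans va (trans (S-cong e) 0-hom))) (+-identityˡ _))) b0)
        (λ e → mkᴬ (trans (sym split) (+-cong e (trans va (trans (S-cong e) Su)))) b0)
        (atom (u * a) (trans (sym (*-assoc u u a)) (*-congʳ idem))
          (trans (solve 2 (λ u a → u :* a :* (u :* a) := u :* u :* (a :* a)) refl u a)
            (*-cong idem (idem-fst b0 i))))
      where
      l' : ((u + v) * a , (u + v) * b) ≈ᴬ (a , b)
      l' = ≈ᴬ-trans (≈ᴬ-sym (pure-· (u + v) (a , b))) l
      Sc = proj₂ (proj₂ (central-parts c))
      b0 : b ≈ 0#
      b0 = begin
        b               ≈⟨ sym (snd≈ l') ⟩
        (u + v) * b     ≈⟨ distribʳ b u v ⟩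
        u * b + v * b   ≈⟨ +-cong (killed M Sc) (killed vM Sc) ⟩
        0# + 0#         ≈⟨ +-identityˡ 0# ⟩
        0#              ∎
      split : u * a + v * a ≈ a
      split = trans (sym (distribʳ a u v)) (fst≈ l')
      va : v * a ≈ S (u * a)
      va = trans (*-cong (sym Su) (sym (proj₁ (central-parts c)))) (sym (S-* u a))

  module _ {u h t : Carrier} (At : Atom u) (Su : ∀ c → u * S c ≈ u * c) (Suu : S u ≈ u)
           (2h : h + h ≈ 1#) (Sh : S h ≈ h) (tt : t * t ≈ 1#) (St : S t ≈ t) where
    open Atom At
    private
      x y : Carrier
      x = h * u
      y = t * x
      Sx : S x ≈ x
      Sx = trans (S-* h u) (*-cong Sh Suu)
      Sy : S y ≈ y
      Sy = trans (S-* t x) (*-cong St Sx)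
      yS : ∀ c → y * S c ≈ y * c
      yS c = begin
        t * (h * u) * S c   ≈⟨ solve 4 (λ t h u c → t :* (h :* u) :* c := t :* h :* (u :* c)) refl t h u (S c) ⟩
        t * h * (u * S c)   ≈⟨ *-congˡ (Su c) ⟩
        t * h * (u * c)     ≈⟨ solve 4 (λ t h u c → t :* h :* (u :* c) := t :* (h :* u) :* c) refl t h u c ⟩
        t * (h * u) * c     ∎

    -- With `h` = 1/2 and `t` standing for ±1 this is u (1 + t y)/2, both signs at once. A central
    -- idempotent (a , b) below it satisfies b = t a, and idempotency then says that 2a is an
    -- idempotent of `R` below `u`.
    pci-split : PCI (x , y)
    pci-split = record
      { central    = parts-central Sx Sy yS
      ; idempotent = mkᴬ
          (begin
            x * x + y * S y                   ≈⟨ +-congˡ (*-congˡ Sy) ⟩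
            x * x + t * x * (t * x)           ≈⟨ solve 2 (λ x t → x :* x :+ t :* x :* (t :* x) := (:1 :+ t :* t) :* (x :* x)) refl x t ⟩
            (1# + t * t) * (x * x)            ≈⟨ *-congʳ (+-congˡ tt) ⟩
            (1# + 1#) * (h * u * (h * u))     ≈⟨ solve 2 (λ h u → (:1 :+ :1) :* (h :* u :* (h :* u)) := (h :+ h) :* (h :* (u :* u))) refl h u ⟩
            (h + h) * (h * (u * u))           ≈⟨ *-cong 2h (*-congˡ idem) ⟩
            1# * x                            ≈⟨ *-identityˡ x ⟩
            x                                 ∎)
          (begin
            x * y + y * S x                   ≈⟨ +-congˡ (*-congˡ Sx) ⟩
            h * u * (t * (h * u)) + t * (h * u) * (h * u)
              ≈⟨ solve 3 (λ h u t → h :* u :* (t :* (h :* u)) :+ t :* (h :* u) :* (h :* u) := (h :+ h) :* (t :* (h :* (u :* u)))) refl h u t ⟩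
            (h + h) * (t * (h * (u * u)))     ≈⟨ *-cong 2h (*-congˡ (*-congˡ idem)) ⟩
            1# * y                            ≈⟨ *-identityˡ y ⟩
            y                                 ∎)
      ; nonzero    = λ z → ≉0 (begin
          u                ≈⟨ sym (*-identityˡ u) ⟩
          1# * u           ≈⟨ *-congʳ (sym 2h) ⟩
          (h + h) * u      ≈⟨ distribʳ u h h ⟩
          x + x            ≈⟨ +-cong (fst≈ z) (fst≈ z) ⟩
          0# + 0#          ≈⟨ +-identityˡ 0# ⟩
          0#               ∎)
      ; minimal    = prim }
      where
      prim : ∀ w → Centralᴬ w → Idempotentᴬ w → (x , y) · w ≈ᴬ w → w ≈ᴬ 0ᴬ ⊎ w ≈ᴬ (x , y)
      prim (a , b) c i l = Sum.map
          (λ e → mkᴬ (half e) (trans b≈ta (trans (*-congˡ (half e)) (zeroʳ t))))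
          (λ e → mkᴬ (half' e) (trans b≈ta (*-congˡ (half' e))))
          (atom (a + a) (trans (distribˡ u a a) (+-cong ua ua)) aa)
        where
        h·2 : ∀ x → h * (x + x) ≈ x
        h·2 x = trans (solve 2 (λ h x → h :* (x :+ x) := (h :+ h) :* x) refl h x) (trans (*-congʳ 2h) (*-identityˡ x))
        Sa = proj₁ (central-parts c)
        Sb = proj₁ (proj₂ (central-parts c))
        la : a ≈ x * (a + t * b)
        la = begin
          a                     ≈⟨ sym (fst≈ l) ⟩
          x * a + t * x * S b   ≈⟨ +-congˡ (*-congˡ Sb) ⟩
          x * a + t * x * b     ≈⟨ solve 4 (λ x a t b → x :* a :+ t :* x :* b := x :* (a :+ t :* b)) refl x a t b ⟩
          x * (a + t * b)       ∎
        b≈ta : b ≈ t * a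
        b≈ta = begin
          b                          ≈⟨ sym (snd≈ l) ⟩
          x * b + t * x * S a        ≈⟨ +-congˡ (*-congˡ Sa) ⟩
          x * b + t * x * a          ≈⟨ +-congʳ (trans (sym (*-identityˡ _)) (*-congʳ (sym tt))) ⟩
          t * t * (x * b) + t * x * a ≈⟨ solve 4 (λ x a t b → t :* t :* (x :* b) :+ t :* x :* a := t :* (x :* (a :+ t :* b))) refl x a t b ⟩
          t * (x * (a + t * b))      ≈⟨ *-congˡ (sym la) ⟩
          t * a                      ∎
        ua : u * a ≈ a
        ua = begin
          u * a                          ≈⟨ *-congˡ la ⟩
          u * (h * u * (a + t * b))      ≈⟨ solve 3 (λ u h z → u :* (h :* u :* z) := h :* (u :* u) :* z) refl u h (a + t * b) ⟩
          h * (u * u) * (a + t * b)      ≈⟨ *-congʳ (*-congˡ idem) ⟩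
          x * (a + t * b)                ≈⟨ sym la ⟩
          a                              ∎
        aa : (a + a) * (a + a) ≈ a + a
        aa = begin
          (a + a) * (a + a)              ≈⟨ solve 1 (λ a → (a :+ a) :* (a :+ a) := a :* a :+ :1 :* (a :* a) :+ (a :* a :+ :1 :* (a :* a))) refl a ⟩
          a * a + 1# * (a * a) + (a * a + 1# * (a * a)) ≈⟨ +-cong eq eq ⟩
          a + a                          ∎
          where
          eq : a * a + 1# * (a * a) ≈ a
          eq = begin
            a * a + 1# * (a * a)         ≈⟨ +-congˡ (*-congʳ (sym tt)) ⟩
            a * a + t * t * (a * a)      ≈⟨ +-congˡ (solve 2 (λ t a → t :* t :* (a :* a) := t :* a :* (t :* a)) refl t a) ⟩
            a * a + t * a * (t * a)      ≈⟨ +-congˡ (*-cong (sym b≈ta) (sym (trans Sb b≈ta))) ⟩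
            a * a + b * S b              ≈⟨ fst≈ i ⟩
            a                            ∎
        half : a + a ≈ 0# → a ≈ 0#
        half e = trans (sym (h·2 a)) (trans (*-congˡ e) (zeroʳ h))
        half' : a + a ≈ u → a ≈ x
        half' e = trans (sym (h·2 a)) (*-congˡ e)

-- The ring of polynomials modulo xⁿ - 1 and the substitution x ↦ x^s.

module Powers (R : CR) where
  open CommutativeRing R
  open Poly R using (pow)

  pow-cong : ∀ {a b} → a ≈ b → ∀ k → pow a k ≈ pow b k
  pow-cong e zero    = refl
  pow-cong e (suc k) = *-cong e (pow-cong e k)

  pow-+ : ∀ a i j → pow a (i ℕ.+ j) ≈ pow a i * pow a j
  pow-+ a zero    j = sym (*-identityˡ _)
  pow-+ a (suc i) j = trans (*-congˡ (pow-+ a i j)) (sym (*-assoc _ _ _))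

  pow-1# : ∀ k → pow 1# k ≈ 1#
  pow-1# zero    = refl
  pow-1# (suc k) = trans (*-identityˡ _) (pow-1# k)

  pow-* : ∀ a i j → pow a (i ℕ.* j) ≈ pow (pow a j) i
  pow-* a zero    j = refl
  pow-* a (suc i) j = trans (pow-+ a j (i ℕ.* j)) (*-congˡ (pow-* a i j))

  pow-swap : ∀ a i j → pow (pow a i) j ≈ pow (pow a j) i
  pow-swap a i j = trans (sym (pow-* a j i))
    (trans (reflexive (≡.cong (pow a) (ℕₚ.*-comm j i))) (pow-* a i j))

  pow-multiple : ∀ {a n} → pow a n ≈ 1# → ∀ k → pow a (k ℕ.* n) ≈ 1#
  pow-multiple {a} {n} e k = trans (pow-* a k n) (trans (pow-cong e k) (pow-1# k))

  pow-% : ∀ {a n} .{{_ : NonZero n}} → pow a n ≈ 1# → ∀ i → pow a i ≈ pow a (i % n)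
  pow-% {a} {n} e i = trans (reflexive (≡.cong (pow a) (m≡m%n+[m/n]*n i n)))
    (trans (pow-+ a (i % n) _) (trans (*-congˡ (pow-multiple e (i / n))) (*-identityʳ _)))

  pow-mod-cong : ∀ {a n} .{{_ : NonZero n}} → pow a n ≈ 1# → ∀ {i j} → i % n ≡ j % n → pow a i ≈ pow a j
  pow-mod-cong {a} e {i} {j} q = trans (pow-% e i) (trans (reflexive (≡.cong (pow a) q)) (sym (pow-% e j)))

  pow-involution : ∀ {a n} .{{_ : NonZero n}} → pow a n ≈ 1# → ∀ {s} → (s ℕ.* s) % n ≡ 1 % n →
                   pow (pow a s) s ≈ a
  pow-involution {a} e {s} q = trans (sym (pow-* a s s))
    (trans (pow-mod-cong e {s ℕ.* s} {1} q) (*-identityʳ a))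

module CyclicQuotient (R : CR) (n : ℕ) .{{nz : NonZero n}} (s : ℕ) (ss : (s ℕ.* s) % n ≡ 1 % n) where
  open Poly R using (Pol; xpow; xⁿ-1; oneₚ; _*ₚ_; _+ₚ_)
  open PolynomialRing R using (X; xpow≋pow; negₚ; mk≋)
  private
    module P = CommutativeRing (polyRing R)
  open Quotient (polyRing R) (xⁿ-1 n) public renaming (quotient to Rₙ)
  private
    module Q = CommutativeRing Rₙ
  module E = Evaluation (constHom R) (xpow s)

  compose : Pol → Pol
  compose = eval (constHom R) (xpow s)

  composeHom : Hom (polyRing R) (polyRing R)
  composeHom = evalHom (constHom R) (xpow s)

  pow≈/ : ∀ p k → Poly.pow (polyRing R) p k ≈/ Poly.pow Rₙ p k
  pow≈/ p k = HomProperties.pow-hom π p k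

  Xⁿ : Poly.pow Rₙ X n ≈/ oneₚ
  Xⁿ = Q.trans (Q.sym (pow≈/ X n)) (mk/ (P.1# Divisibility.by
    P.trans (P.*-identityʳ _) (P.+-congʳ {negₚ oneₚ} (xpow≋pow n))))

  xpow≈/ : ∀ k → xpow k ≈/ Poly.pow Rₙ X k
  xpow≈/ k = Q.trans (≈⇒≈/ (xpow≋pow k)) (pow≈/ X k)

  private
    open Powers Rₙ

    -- In the quotient (x^s)^n = (x^n)^s = 1, so the substitution descends to it.
    kills : compose (xⁿ-1 n) ≈/ []
    kills = Q.trans (≈⇒≈/ (E.eval-xⁿ-1 n)) (Q.trans (Q.+-congʳ {negₚ oneₚ}
      (Q.trans (pow≈/ (xpow s) n) (Q.trans (pow-cong (xpow≈/ s) n)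
        (Q.trans (pow-swap X s n) (Q.trans (pow-cong Xⁿ s) (pow-1# s)))))) (Q.-‿inverseʳ oneₚ))

  σ : Hom Rₙ Rₙ
  σ = lift (π ∘ʰ composeHom) kills

  -- Both sides are ring maps from polynomials to the quotient that fix constants, so only `X`
  -- matters, where s² ≡ 1 mod n applies.
  σσ : ∀ p → compose (compose p) ≈/ p
  σσ p = Q.trans (unique (σ ∘ʰ σ ∘ʰ π)
      (λ a → Q.trans (Hom.cong σ {compose (a ∷ [])} {a ∷ []} (≈⇒≈/ (E.eval-const a))) (≈⇒≈/ (E.eval-const a)))
      XX p)
    (Q.sym (unique π (λ a → Q.refl) Q.refl p))
    where
    unique = Evaluation.eval-unique (π ∘ʰ constHom R) X
    XX : compose (compose X) ≈/ X
    XX = Q.trans (Hom.cong σ {compose X} {xpow s} (≈⇒≈/ E.eval-X))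
      (Q.trans (≈⇒≈/ (E.eval-xpow s)) (Q.trans (pow≈/ (xpow s) s)
        (Q.trans (pow-cong (xpow≈/ s) s) (pow-involution Xⁿ {s} ss))))

  open TwistedAlgebra Rₙ σ σσ public

-- The group algebra identified with R ⊕ R y.

module Convolution (R : CR) (I : Set) (_∙_ : I → I → I) (δ : I → I → CommutativeRing.Carrier R)
    (sum : (I → CommutativeRing.Carrier R) → CommutativeRing.Carrier R)
    (sum-cong : ∀ {φ ψ : I → CommutativeRing.Carrier R} → (∀ i → CommutativeRing._≈_ R (φ i) (ψ i)) →
                CommutativeRing._≈_ R (sum φ) (sum ψ))
    (sum-+ : ∀ (φ ψ : I → CommutativeRing.Carrier R) → CommutativeRing._≈_ R
             (sum (λ i → CommutativeRing._+_ R (φ i) (ψ i))) (CommutativeRing._+_ R (sum φ) (sum ψ)))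
    (sum-* : ∀ (c : CommutativeRing.Carrier R) (φ : I → CommutativeRing.Carrier R) → CommutativeRing._≈_ R
             (sum (λ i → CommutativeRing._*_ R c (φ i))) (CommutativeRing._*_ R c (sum φ)))
    (sum-δ : ∀ (i : I) (φ : I → CommutativeRing.Carrier R) → CommutativeRing._≈_ R
             (sum (λ j → CommutativeRing._*_ R (δ i j) (φ j))) (φ i)) where
  open CommutativeRing R
  open IntegerSolver R

  -- The factor δ (h ∙ k) g is the indicator of h ∙ k = g. As a coefficient, rather than a
  -- conditional, it makes bilinearity a matter of ring laws and sums.
  conv : (I → Carrier) → (I → Carrier) → I → Carrier
  conv a b g = sum λ h → sum λ k → δ (h ∙ k) g * (a h * b k)

  private
    inner : (I → Carrier) → I → I → Carrier
    inner b g h = sum λ k → δ (h ∙ k) g * b k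

    expand : ∀ a b g → conv a b g ≈ sum λ h → a h * inner b g h
    expand a b g = sum-cong λ h → trans
      (sum-cong λ k → solve 3 (λ d a b → d :* (a :* b) := a :* (d :* b)) refl (δ (h ∙ k) g) (a h) (b k))
      (sum-* (a h) _)

  conv-cong : ∀ {a a' b b'} → (∀ i → a i ≈ a' i) → (∀ i → b i ≈ b' i) → ∀ g → conv a b g ≈ conv a' b' g
  conv-cong e f g = sum-cong λ h → sum-cong λ k → *-congˡ (*-cong (e h) (f k))

  conv-distribʳ : ∀ a b c g → conv (λ i → a i + b i) c g ≈ conv a c g + conv b c g
  conv-distribʳ a b c g = trans (expand _ c g) (trans (sum-cong λ h → distribʳ _ (a h) (b h))
    (trans (sum-+ _ _) (sym (+-cong (expand a c g) (expand b c g)))))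

  conv-distribˡ : ∀ a b c g → conv a (λ i → b i + c i) g ≈ conv a b g + conv a c g
  conv-distribˡ a b c g = trans (expand a _ g) (trans
    (sum-cong λ h → trans (*-congˡ (trans (sum-cong λ k → distribˡ _ (b k) (c k)) (sum-+ _ _))) (distribˡ (a h) _ _))
    (trans (sum-+ _ _) (sym (+-cong (expand a b g) (expand a c g)))))

  conv-scaleˡ : ∀ x a b g → conv (λ i → x * a i) b g ≈ x * conv a b g
  conv-scaleˡ x a b g = trans (expand _ b g) (trans (sum-cong λ h → *-assoc x (a h) _)
    (trans (sum-* x _) (*-congˡ (sym (expand a b g)))))

  conv-scaleʳ : ∀ x a b g → conv a (λ i → x * b i) g ≈ x * conv a b g
  conv-scaleʳ x a b g = trans
    (sum-cong λ h → trans (sum-cong λ k → solve 4 (λ d a x b → d :* (a :* (x :* b)) := x :* (d :* (a :* b)))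
      refl (δ (h ∙ k) g) (a h) x (b k)) (sum-* x _)) (sum-* x _)

  conv-δ : ∀ g h k → conv (δ g) (δ h) k ≈ δ (g ∙ h) k
  conv-δ g h k = trans (expand (δ g) (δ h) k) (trans (sum-δ g (inner (δ h) k))
    (trans (sum-cong λ l → *-comm _ _) (sum-δ h (λ l → δ (g ∙ l) k))))

-- δ k j plays the role of x^k y^j.
record MonomialAlgebra (R : CR) (n s : ℕ) : Set₁ where
  open CommutativeRing R using (0#; 1#) renaming (Carrier to C; _≈_ to _≈R_; _+_ to _+R_; _*_ to _*R_)
  infix 4 _≈_
  infixl 6 _+_
  infixl 7 _⋆_
  field
    M     : Set
    _≈_   : M → M → Set
    _+_   : M → M → M
    0ᴹ    : M
    +-isCommutativeMonoid : IsCommutativeMonoid _≈_ _+_ 0ᴹ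
    _•_   : C → M → M
    •-cong : ∀ {c d a b} → c ≈R d → a ≈ b → (c • a) ≈ (d • b)
    •-+   : ∀ c a b → (c • (a + b)) ≈ (c • a) + (c • b)
    +-•   : ∀ c d a → ((c +R d) • a) ≈ (c • a) + (d • a)
    *-•   : ∀ c d a → ((c *R d) • a) ≈ (c • (d • a))
    1-•   : ∀ a → (1# • a) ≈ a
    0-•   : ∀ a → (0# • a) ≈ 0ᴹ
    •-0   : ∀ c → (c • 0ᴹ) ≈ 0ᴹ
    _⋆_   : M → M → M
    ⋆-cong : ∀ {a a' b b'} → a ≈ a' → b ≈ b' → (a ⋆ b) ≈ (a' ⋆ b')
    ⋆-distribʳ : ∀ a b c → ((a + b) ⋆ c) ≈ (a ⋆ c) + (b ⋆ c)
    ⋆-distribˡ : ∀ a b c → (a ⋆ (b + c)) ≈ (a ⋆ b) + (a ⋆ c)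
    ⋆-scaleˡ : ∀ x a b → ((x • a) ⋆ b) ≈ (x • (a ⋆ b))
    ⋆-scaleʳ : ∀ x a b → (a ⋆ (x • b)) ≈ (x • (a ⋆ b))
    δ     : ℕ → Fin 2 → M
    δ-⋆   : ∀ i j k l → (δ i j ⋆ δ k l) ≈ δ (i ℕ.+ k ℕ.* s ℕ.^ toℕ j) ((toℕ j ℕ.+ toℕ l) mod 2)
    δ-period : ∀ k j → δ (n ℕ.+ k) j ≈ δ k j

  +-commutativeMonoid : CommutativeMonoid 0ℓ 0ℓ
  +-commutativeMonoid = record { isCommutativeMonoid = +-isCommutativeMonoid }

module Linear {R : CR} {n s : ℕ} (MA : MonomialAlgebra R n s) where
  open MonomialAlgebra MA
  open CommutativeMonoid +-commutativeMonoid using (setoid; refl; sym; trans; reflexive; identityˡ; identityʳ; ∙-cong; ∙-congˡ; ∙-congʳ; commutativeSemigroup)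
  open import Algebra.Properties.CommutativeSemigroup commutativeSemigroup using (interchange)
  private module R = CommutativeRing R
  open Poly R
  open PolynomialRing R
  private
    module P = CommutativeRing (polyRing R)
    module PS = IntegerSolver (polyRing R)
    module C = Hom (constHom R)
  open import Relation.Binary.Reasoning.Setoid setoid

  -- Σ pₜ x^(θ t) y^j, where pₜ are the coefficients of p.
  lin : Fin 2 → (ℕ → ℕ) → Pol → M
  lin j θ []      = 0ᴹ
  lin j θ (a ∷ p) = a • δ (θ 0) j + lin j (θ ∘ suc) p

  T : Fin 2 → Pol → M
  T j = lin j (λ t → t)

  lin-θ : ∀ j {θ θ'} → (∀ t → δ (θ t) j ≈ δ (θ' t) j) → ∀ p → lin j θ p ≈ lin j θ' p
  lin-θ j e []      = refl
  lin-θ j e (a ∷ p) = ∙-cong (•-cong R.refl (e 0)) (lin-θ j (λ t → e (suc t)) p)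

  lin-≡ : ∀ j {θ θ'} → (∀ t → θ t ≡ θ' t) → ∀ p → lin j θ p ≈ lin j θ' p
  lin-≡ j e = lin-θ j (λ t → reflexive (≡.cong (λ k → δ k j) (e t)))

  lin-zero : ∀ j θ p → p ≋ [] → lin j θ p ≈ 0ᴹ
  lin-zero j θ []      e = refl
  lin-zero j θ (a ∷ p) e = trans (∙-cong (trans (•-cong (at e 0) refl) (0-• _)) (lin-zero j _ p (∷-tail[] e))) (identityˡ 0ᴹ)

  lin-cong : ∀ j θ {p q} → p ≋ q → lin j θ p ≈ lin j θ q
  lin-cong j θ {[]}    {q}     e = sym (lin-zero j θ q (P.sym e))
  lin-cong j θ {a ∷ p} {[]}    e = lin-zero j θ (a ∷ p) e
  lin-cong j θ {a ∷ p} {b ∷ q} e = ∙-cong (•-cong (at e 0) refl) (lin-cong j _ (∷-tail e))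

  lin-+ : ∀ j θ p q → lin j θ (p +ₚ q) ≈ lin j θ p + lin j θ q
  lin-+ j θ []      q       = sym (identityˡ _)
  lin-+ j θ (a ∷ p) []      = sym (identityʳ _)
  lin-+ j θ (a ∷ p) (b ∷ q) = trans (∙-cong (+-• a b _) (lin-+ j _ p q)) (interchange _ _ _ _)

  lin-scale : ∀ j θ c p → lin j θ (scale c p) ≈ (c • lin j θ p)
  lin-scale j θ c []      = sym (•-0 c)
  lin-scale j θ c (a ∷ p) = trans (∙-cong (*-• c a _) (lin-scale j _ c p)) (sym (•-+ c _ _))

  lin-xpow : ∀ j θ r → lin j θ (xpow r) ≈ δ (θ r) j
  lin-xpow j θ zero    = trans (identityʳ _) (1-• _)
  lin-xpow j θ (suc r) = trans (∙-cong (0-• _) (lin-xpow j (θ ∘ suc) r)) (identityˡ _)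

  private
    T-monomial : ∀ j a r → T j (C.⟦ a ⟧ *ₚ xpow r) ≈ (a • δ r j)
    T-monomial j a r = trans (lin-cong j _ (const-* a (xpow r)))
      (trans (lin-scale j _ a (xpow r)) (•-cong R.refl (lin-xpow j (λ t → t) r)))

    xpow-+ : ∀ i k → xpow (i ℕ.+ k) ≋ (xpow i *ₚ xpow k)
    xpow-+ i k = P.trans (xpow≋pow (i ℕ.+ k)) (P.trans (Powers.pow-+ (polyRing R) X i k)
      (P.*-cong (P.sym (xpow≋pow i)) (P.sym (xpow≋pow k))))

  -- The source of the substitution x ↦ x^s: exponents k + t m produced by the group law amount to
  -- x^k p(x^m).
  lin-affine : ∀ j m k p → lin j (λ t → k ℕ.+ t ℕ.* m) p ≈ T j (xpow k *ₚ eval (constHom R) (xpow m) p)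
  lin-affine j m k []      = sym (lin-zero j _ (xpow k *ₚ []) (*ₚ-zeroʳ (xpow k)))
  lin-affine j m k (a ∷ p) = begin
    a • δ (k ℕ.+ 0) j + lin j (λ t → k ℕ.+ suc t ℕ.* m) p
      ≈⟨ ∙-cong (trans (reflexive (≡.cong (λ z → a • δ z j) (ℕₚ.+-identityʳ k))) (sym (T-monomial j a k)))
           (trans (lin-≡ j (λ t → ≡.sym (ℕₚ.+-assoc k m (t ℕ.* m))) p) (lin-affine j m (k ℕ.+ m) p)) ⟩
    T j (C.⟦ a ⟧ *ₚ xpow k) + T j (xpow (k ℕ.+ m) *ₚ q)
      ≈⟨ sym (lin-+ j _ (C.⟦ a ⟧ *ₚ xpow k) _) ⟩
    T j (C.⟦ a ⟧ *ₚ xpow k +ₚ xpow (k ℕ.+ m) *ₚ q)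
      ≈⟨ lin-cong j _ (P.trans (P.+-congˡ {C.⟦ a ⟧ *ₚ xpow k} (P.*-congʳ {q} (xpow-+ k m)))
           (PS.solve 4 (λ a x y q → a PS.:* x PS.:+ x PS.:* y PS.:* q PS.:= x PS.:* (a PS.:+ y PS.:* q))
             ≋-refl C.⟦ a ⟧ (xpow k) (xpow m) q)) ⟩
    T j (xpow k *ₚ (C.⟦ a ⟧ +ₚ xpow m *ₚ q)) ∎
    where q = eval (constHom R) (xpow m) p

  -- Lets products without a twist, where the exponent is s^0 = 1, be treated as a case of the
  -- twisted ones.
  eval-xpow1 : ∀ p → p ≋ eval (constHom R) (xpow 1) p
  eval-xpow1 = Evaluation.eval-unique (constHom R) (xpow 1) (idHom (polyRing R)) (λ _ → ≋-refl) ≋-refl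

  private
    ⋆-zeroʳ : ∀ a → (a ⋆ 0ᴹ) ≈ 0ᴹ
    ⋆-zeroʳ a = trans (⋆-cong refl (sym (0-• 0ᴹ))) (trans (⋆-scaleʳ R.0# a 0ᴹ) (0-• _))

    ⋆-zeroˡ : ∀ a → (0ᴹ ⋆ a) ≈ 0ᴹ
    ⋆-zeroˡ a = trans (⋆-cong (sym (0-• 0ᴹ)) refl) (trans (⋆-scaleˡ R.0# 0ᴹ a) (0-• _))

    δ⋆lin : ∀ k j l θ q → (δ k j ⋆ lin l θ q) ≈
            lin ((toℕ j ℕ.+ toℕ l) mod 2) (λ t → k ℕ.+ θ t ℕ.* s ℕ.^ toℕ j) q
    δ⋆lin k j l θ []      = ⋆-zeroʳ _
    δ⋆lin k j l θ (a ∷ q) = trans (⋆-distribˡ _ _ _) (∙-cong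
      (trans (⋆-scaleʳ a _ _) (•-cong R.refl (δ-⋆ k j (θ 0) l))) (δ⋆lin k j l (θ ∘ suc) q))

    lin⋆T : ∀ j l q k p → (lin j (k ℕ.+_) p ⋆ T l q) ≈
            T ((toℕ j ℕ.+ toℕ l) mod 2) (xpow k *ₚ (p *ₚ eval (constHom R) (xpow (s ℕ.^ toℕ j)) q))
    lin⋆T j l q k []      = trans (⋆-zeroˡ _) (sym (lin-zero _ _ (xpow k *ₚ []) (*ₚ-zeroʳ (xpow k))))
    lin⋆T j l q k (a ∷ p) = begin
      (a • δ (k ℕ.+ 0) j + lin j ((k ℕ.+_) ∘ suc) p) ⋆ T l q
        ≈⟨ ⋆-distribʳ _ _ (T l q) ⟩
      (a • δ (k ℕ.+ 0) j) ⋆ T l q + lin j ((k ℕ.+_) ∘ suc) p ⋆ T l q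
        ≈⟨ ∙-cong (trans (⋆-scaleˡ a _ _) (•-cong R.refl (trans
               (⋆-cong (reflexive (≡.cong (λ z → δ z j) (ℕₚ.+-identityʳ k))) refl)
               (trans (δ⋆lin k j l (λ t → t) q) (lin-affine j' (s ℕ.^ toℕ j) k q)))))
             (trans (⋆-cong (lin-≡ j (ℕₚ.+-suc k) p) refl) (lin⋆T j l q (suc k) p)) ⟩
      (a • T j' (xpow k *ₚ q')) + T j' (xpow (suc k) *ₚ (p *ₚ q'))
        ≈⟨ ∙-congʳ (sym (lin-scale j' _ a (xpow k *ₚ q'))) ⟩
      T j' (scale a (xpow k *ₚ q')) + T j' (xpow (suc k) *ₚ (p *ₚ q'))
        ≈⟨ sym (lin-+ j' _ (scale a (xpow k *ₚ q')) _) ⟩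
      T j' (scale a (xpow k *ₚ q') +ₚ xpow (suc k) *ₚ (p *ₚ q'))
        ≈⟨ lin-cong j' _ (P.trans (P.+-cong (P.sym (const-* a (xpow k *ₚ q'))) (P.*-congʳ {p *ₚ q'} (P.sym (X* (xpow k)))))
             (P.trans (PS.solve 5 (λ a x k p q → a PS.:* (k PS.:* q) PS.:+ x PS.:* k PS.:* (p PS.:* q) PS.:=
                k PS.:* ((a PS.:+ x PS.:* p) PS.:* q)) ≋-refl C.⟦ a ⟧ X (xpow k) p q')
               (P.*-congˡ {xpow k} (P.*-congʳ {q'} (P.sym (∷-split a p)))))) ⟩
      T j' (xpow k *ₚ ((a ∷ p) *ₚ q')) ∎
      where
      j' = (toℕ j ℕ.+ toℕ l) mod 2
      q' = eval (constHom R) (xpow (s ℕ.^ toℕ j)) q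

  -- Moving y^j past q(x) replaces x by x^(s^j).
  T⋆T : ∀ j l p q → (T j p ⋆ T l q) ≈
        T ((toℕ j ℕ.+ toℕ l) mod 2) (p *ₚ eval (constHom R) (xpow (s ℕ.^ toℕ j)) q)
  T⋆T j l p q = trans (lin⋆T j l q 0 p) (lin-cong ((toℕ j ℕ.+ toℕ l) mod 2) (λ t → t)
    (*ₚ-identityˡ (p *ₚ eval (constHom R) (xpow (s ℕ.^ toℕ j)) q)))

  T-inverse : ∀ j p → T j p + T j (negₚ p) ≈ 0ᴹ
  T-inverse j p = trans (sym (lin-+ j _ p _)) (lin-zero j _ (p +ₚ negₚ p) (+ₚ-inverseʳ p))

  -- Exponents of `δ` range over all naturals with period n, so multiplication by x^n has no effect
  -- on the image; hence `T` factors through the quotient by xⁿ - 1.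
  T-periodic : ∀ j p → T j (xⁿ-1 n *ₚ p) ≈ 0ᴹ
  T-periodic j p = begin
    T j (xⁿ-1 n *ₚ p)
      ≈⟨ lin-cong j _ (PS.solve 2 (λ w p → (w PS.:- PS.:1) PS.:* p PS.:= w PS.:* p PS.:- p) ≋-refl (xpow n) p) ⟩
    T j (xpow n *ₚ p +ₚ negₚ p)              ≈⟨ lin-+ j _ (xpow n *ₚ p) _ ⟩
    T j (xpow n *ₚ p) + T j (negₚ p)         ≈⟨ ∙-congʳ shift ⟩
    T j p + T j (negₚ p)                     ≈⟨ T-inverse j p ⟩
    0ᴹ                                       ∎
    where
    shift : T j (xpow n *ₚ p) ≈ T j p
    shift = begin
      T j (xpow n *ₚ p)                                 ≈⟨ lin-cong j _ (P.*-congˡ {xpow n} (eval-xpow1 p)) ⟩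
      T j (xpow n *ₚ eval (constHom R) (xpow 1) p)      ≈⟨ sym (lin-affine j 1 n p) ⟩
      lin j (λ t → n ℕ.+ t ℕ.* 1) p                     ≈⟨ lin-≡ j (λ t → ≡.cong (n ℕ.+_) (ℕₚ.*-identityʳ t)) p ⟩
      lin j (n ℕ.+_) p                                  ≈⟨ lin-θ j (λ t → δ-period t j) p ⟩
      T j p                                             ∎

  open Quotient (polyRing R) (xⁿ-1 n)

  T-cong/ : ∀ j {p q} → p ≈/ q → T j p ≈ T j q
  T-cong/ j {p} {q} (mk/ (c Divisibility.by e)) = begin
    T j p                           ≈⟨ lin-cong j _ (PS.solve 2 (λ p q → p PS.:= p PS.:- q PS.:+ q) ≋-refl p q) ⟩
    T j (p +ₚ negₚ q +ₚ q)          ≈⟨ lin-+ j _ (p +ₚ negₚ q) q ⟩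
    T j (p +ₚ negₚ q) + T j q       ≈⟨ ∙-congʳ (trans (lin-cong j _ (P.sym e)) (T-periodic j c)) ⟩
    0ᴹ + T j q                      ≈⟨ identityˡ _ ⟩
    T j q                           ∎

  ΦM : Pol × Pol → M
  ΦM (a , b) = T fzero a + T (fsuc fzero) b

  ΦM-⋆ : ∀ a b c d → let σ = eval (constHom R) (xpow s) in
         (ΦM (a , b) ⋆ ΦM (c , d)) ≈ ΦM (a *ₚ c +ₚ b *ₚ σ d , a *ₚ d +ₚ b *ₚ σ c)
  ΦM-⋆ a b c d = begin
    (T₀ a + T₁ b) ⋆ (T₀ c + T₁ d)
      ≈⟨ trans (⋆-distribʳ (T₀ a) (T₁ b) _) (∙-cong (⋆-distribˡ (T₀ a) (T₀ c) (T₁ d)) (⋆-distribˡ (T₁ b) (T₀ c) (T₁ d))) ⟩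
    T₀ a ⋆ T₀ c + T₀ a ⋆ T₁ d + (T₁ b ⋆ T₀ c + T₁ b ⋆ T₁ d)
      ≈⟨ ∙-cong (∙-cong (straight fzero a c) (straight (fsuc fzero) a d))
           (trans (CommutativeMonoid.comm +-commutativeMonoid _ _) (∙-cong (twist (fsuc fzero) b d) (twist fzero b c))) ⟩
    T₀ (a *ₚ c) + T₁ (a *ₚ d) + (T₀ (b *ₚ σ d) + T₁ (b *ₚ σ c))
      ≈⟨ interchange _ _ _ _ ⟩
    T₀ (a *ₚ c) + T₀ (b *ₚ σ d) + (T₁ (a *ₚ d) + T₁ (b *ₚ σ c))
      ≈⟨ sym (∙-cong (lin-+ fzero _ (a *ₚ c) _) (lin-+ (fsuc fzero) _ (a *ₚ d) _)) ⟩
    ΦM (a *ₚ c +ₚ b *ₚ σ d , a *ₚ d +ₚ b *ₚ σ c) ∎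
    where
    σ = eval (constHom R) (xpow s)
    T₀ = T fzero
    T₁ = T (fsuc fzero)
    straight : ∀ l p q → (T fzero p ⋆ T l q) ≈ T (toℕ l mod 2) (p *ₚ q)
    straight l p q = trans (T⋆T fzero l p q) (lin-cong (toℕ l mod 2) _ (P.*-congˡ {p} (P.sym (eval-xpow1 q))))
    twist : ∀ l p q → (T (fsuc fzero) p ⋆ T l q) ≈ T ((1 ℕ.+ toℕ l) mod 2) (p *ₚ σ q)
    -- For j = 1 the exponent s ^ 1 unfolds to s * 1.
    twist l p q = trans (T⋆T (fsuc fzero) l p q) (reflexive (≡.cong
      (λ m → T ((1 ℕ.+ toℕ l) mod 2) (p *ₚ eval (constHom R) (xpow m) q)) (ℕₚ.*-identityʳ s)))

module GroupAlgebraModel (R : CR) (n : ℕ) .{{nz : NonZero n}} (s : ℕ) (ss : (s ℕ.* s) % n ≡ 1 % n) where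
  open CommutativeRing R
  open GroupAlgebra R n s renaming (_·_ to _·ᴳ_)
  open Poly R
  open PolynomialRing R
  open CyclicQuotient R n s ss
  private
    module P = CommutativeRing (polyRing R)
  open IntegerSolver R
  open import Relation.Binary.Reasoning.Setoid setoid

  private
    δ-same : ∀ g → δ g g ≈ 1#
    δ-same g with g ≟G g
    ... | yes _ = refl
    ... | no ne = ⊥-elim (ne ≡.refl)

    δ-diff : ∀ {g h} → g ≢ h → δ g h ≈ 0#
    δ-diff {g} {h} ne with g ≟G h
    ... | yes e = ⊥-elim (ne e)
    ... | no _  = refl

    if-δ : ∀ g k x → (if ⌊ g ≟G k ⌋ then x else 0#) ≈ δ g k * x
    if-δ g k x with g ≟G k
    ... | yes _ = sym (*-identityˡ x)
    ... | no _  = sym (zeroˡ x)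

    sumFin-cong : ∀ {m} {φ ψ : Fin m → Carrier} → (∀ i → φ i ≈ ψ i) → sumFin φ ≈ sumFin ψ
    sumFin-cong {zero}  e = refl
    sumFin-cong {suc m} e = +-cong (e fzero) (sumFin-cong (λ i → e (fsuc i)))

    sumFin-+ : ∀ {m} (φ ψ : Fin m → Carrier) → sumFin (λ i → φ i + ψ i) ≈ sumFin φ + sumFin ψ
    sumFin-+ {zero}  φ ψ = sym (+-identityˡ 0#)
    sumFin-+ {suc m} φ ψ = trans (+-congˡ (sumFin-+ (φ ∘ fsuc) (ψ ∘ fsuc)))
      (solve 4 (λ a b c d → a :+ b :+ (c :+ d) := a :+ c :+ (b :+ d)) refl _ _ _ _)

    sumFin-* : ∀ {m} c (φ : Fin m → Carrier) → sumFin (λ i → c * φ i) ≈ c * sumFin φ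
    sumFin-* {zero}  c φ = sym (zeroʳ c)
    sumFin-* {suc m} c φ = trans (+-congˡ (sumFin-* c (φ ∘ fsuc))) (sym (distribˡ _ _ _))

    sumFin-0 : ∀ {m} (φ : Fin m → Carrier) → (∀ i → φ i ≈ 0#) → sumFin φ ≈ 0#
    sumFin-0 {zero}  φ e = refl
    sumFin-0 {suc m} φ e = trans (+-cong (e fzero) (sumFin-0 (φ ∘ fsuc) (λ i → e (fsuc i)))) (+-identityˡ 0#)

    sumFin-single : ∀ {m} (φ : Fin m → Carrier) i → (∀ j → i ≢ j → φ j ≈ 0#) → sumFin φ ≈ φ i
    sumFin-single φ fzero    e = trans (+-congˡ (sumFin-0 (φ ∘ fsuc) (λ i → e (fsuc i) λ ()))) (+-identityʳ _)
    sumFin-single φ (fsuc i) e = trans (+-cong (e fzero λ ())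
      (sumFin-single (φ ∘ fsuc) i (λ j ne → e (fsuc j) (λ q → ne (Finₚ.suc-injective q))))) (+-identityˡ _)

    sumG-cong : ∀ {φ ψ : G → Carrier} → (∀ g → φ g ≈ ψ g) → sumG φ ≈ sumG ψ
    sumG-cong {φ} {ψ} e = sumFin-cong {n} λ i → sumFin-cong {2} {λ j → φ (i , j)} {λ j → ψ (i , j)} λ j → e (i , j)

    sumG-+ : ∀ (φ ψ : G → Carrier) → sumG (λ g → φ g + ψ g) ≈ sumG φ + sumG ψ
    sumG-+ φ ψ = trans (sumFin-cong {n} λ i → sumFin-+ (λ j → φ (i , j)) (λ j → ψ (i , j)))
                       (sumFin-+ {n} (λ i → sumFin λ j → φ (i , j)) (λ i → sumFin λ j → ψ (i , j)))

    sumG-* : ∀ c (φ : G → Carrier) → sumG (λ g → c * φ g) ≈ c * sumG φ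
    sumG-* c φ = trans (sumFin-cong {n} λ i → sumFin-* c (λ j → φ (i , j)))
                       (sumFin-* {n} c (λ i → sumFin λ j → φ (i , j)))

    sumG-δ : ∀ g (φ : G → Carrier) → sumG (λ h → δ g h * φ h) ≈ φ g
    sumG-δ (i , j) φ = trans
      (sumFin-single (λ i' → sumFin λ j' → δ (i , j) (i' , j') * φ (i' , j')) i
        (λ i' ne → sumFin-0 (λ j' → δ (i , j) (i' , j') * φ (i' , j')) λ j' → off (i' , j') (λ q → ne (≡.cong proj₁ q))))
      (trans (sumFin-single (λ j' → δ (i , j) (i , j') * φ (i , j')) j (λ j' ne → off (i , j') (λ q → ne (≡.cong proj₂ q))))
        (trans (*-congʳ (δ-same (i , j))) (*-identityˡ _)))
      where
      off : ∀ h → (i , j) ≢ h → δ (i , j) h * φ h ≈ 0#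
      off h ne = trans (*-congʳ (δ-diff ne)) (zeroˡ _)

  module Conv = Convolution R G _·ᴳ_ δ sumG sumG-cong sumG-+ sumG-* sumG-δ

  ⋆≈conv : ∀ a b g → (a ⋆ b) g ≈ Conv.conv a b g
  ⋆≈conv a b g = sumG-cong {λ h → sumG λ k → if ⌊ (h ·ᴳ k) ≟G g ⌋ then a h * b k else 0#}
    {λ h → sumG λ k → δ (h ·ᴳ k) g * (a h * b k)} λ h → sumG-cong
      {λ k → if ⌊ (h ·ᴳ k) ≟G g ⌋ then a h * b k else 0#} {λ k → δ (h ·ᴳ k) g * (a h * b k)}
      λ k → if-δ (h ·ᴳ k) g (a h * b k)

  private
    toℕ-mod : ∀ i → toℕ (i mod n) ≡ i % n
    toℕ-mod i = Finₚ.toℕ-fromℕ< (m%n<n i n)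

    mod-≡ : ∀ {i k} → i % n ≡ k % n → i mod n ≡ k mod n
    mod-≡ {i} {k} e = Finₚ.toℕ-injective (≡.trans (toℕ-mod i) (≡.trans e (≡.sym (toℕ-mod k))))

    %-affine : ∀ i k m → (i % n ℕ.+ (k % n) ℕ.* m) % n ≡ (i ℕ.+ k ℕ.* m) % n
    %-affine i k m = ≡.trans (%-distribˡ-+ (i % n) _ n) (≡.trans
        (≡.cong₂ (λ y z → (y ℕ.+ z) % n) (m%n%n≡m%n i n) mul) (≡.sym (%-distribˡ-+ i (k ℕ.* m) n)))
      where
      mul : ((k % n) ℕ.* m) % n ≡ (k ℕ.* m) % n
      mul = ≡.trans (%-distribˡ-* (k % n) m n) (≡.trans
        (≡.cong (λ z → (z ℕ.* (m % n)) % n) (m%n%n≡m%n k n)) (≡.sym (%-distribˡ-* k m n)))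

    ·-mod : ∀ i j k l → (i mod n , j) ·ᴳ (k mod n , l) ≡
            ((i ℕ.+ k ℕ.* s ℕ.^ toℕ j) mod n , (toℕ j ℕ.+ toℕ l) mod 2)
    ·-mod i j k l = ≡.cong (_, ((toℕ j ℕ.+ toℕ l) mod 2)) (≡.trans
      (≡.cong₂ (λ y z → (y ℕ.+ z ℕ.* s ℕ.^ toℕ j) mod n) (toℕ-mod i) (toℕ-mod k))
      (mod-≡ (%-affine i k (s ℕ.^ toℕ j))))

  groupAlgebra : MonomialAlgebra R n s
  groupAlgebra = record
    { M = RG ; _≈_ = _≈G_ ; _+_ = _+G_ ; 0ᴹ = 0G
    ; +-isCommutativeMonoid = record
      { isMonoid = record
        { isSemigroup = record
          { isMagma = record
            { isEquivalence = record { refl = λ g → refl ; sym = λ e g → sym (e g) ; trans = λ e f g → trans (e g) (f g) }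
            ; ∙-cong = λ e f g → +-cong (e g) (f g) }
          ; assoc = λ a b c g → +-assoc (a g) (b g) (c g) }
        ; identity = (λ a g → +-identityˡ (a g)) , (λ a g → +-identityʳ (a g)) }
      ; comm = λ a b g → +-comm (a g) (b g) }
    ; _•_ = scaleG
    ; •-cong = λ e f g → *-cong e (f g)
    ; •-+ = λ c a b g → distribˡ c (a g) (b g)
    ; +-• = λ c d a g → distribʳ (a g) c d
    ; *-• = λ c d a g → *-assoc c d (a g)
    ; 1-• = λ a g → *-identityˡ (a g)
    ; 0-• = λ a g → zeroˡ (a g)
    ; •-0 = λ c g → zeroʳ c
    ; _⋆_ = _⋆_
    ; ⋆-cong = λ {a} {a'} {b} {b'} e f g → trans (⋆≈conv a b g) (trans (Conv.conv-cong e f g) (sym (⋆≈conv a' b' g)))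
    ; ⋆-distribʳ = λ a b c g → trans (⋆≈conv (a +G b) c g) (trans (Conv.conv-distribʳ a b c g) (sym (+-cong (⋆≈conv a c g) (⋆≈conv b c g))))
    ; ⋆-distribˡ = λ a b c g → trans (⋆≈conv a (b +G c) g) (trans (Conv.conv-distribˡ a b c g) (sym (+-cong (⋆≈conv a b g) (⋆≈conv a c g))))
    ; ⋆-scaleˡ = λ x a b g → trans (⋆≈conv (scaleG x a) b g) (trans (Conv.conv-scaleˡ x a b g) (*-congˡ (sym (⋆≈conv a b g))))
    ; ⋆-scaleʳ = λ x a b g → trans (⋆≈conv a (scaleG x b) g) (trans (Conv.conv-scaleʳ x a b g) (*-congˡ (sym (⋆≈conv a b g))))
    ; δ = λ k j → δ (k mod n , j)
    ; δ-⋆ = λ i j k l g → trans (⋆≈conv (δ (i mod n , j)) (δ (k mod n , l)) g)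
        (trans (Conv.conv-δ (i mod n , j) (k mod n , l) g) (reflexive (≡.cong (λ h → δ h g) (·-mod i j k l))))
    ; δ-period = λ k j g → reflexive (≡.cong (λ z → δ (z , j) g)
        (mod-≡ (≡.trans (≡.cong (_% n) (ℕₚ.+-comm n k)) ([m+n]%n≡m%n k n)))) }

  open MonomialAlgebra groupAlgebra using (⋆-cong)
  open Linear groupAlgebra

  private
    lin-other : ∀ {j j'} → j ≢ j' → ∀ θ p i → lin j θ p (i , j') ≈ 0#
    lin-other ne θ []      i = refl
    lin-other ne θ (a ∷ p) i = trans (+-cong (trans (*-congˡ (δ-diff λ e → ne (≡.cong proj₂ e))) (zeroʳ a))
      (lin-other ne (θ ∘ suc) p i)) (+-identityˡ 0#)

    δ-coeff-no : ∀ {j k} (i : Fin n) → k < n → k ≢ toℕ i → δ (k mod n , j) (i , j) ≈ 0#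
    δ-coeff-no {j} {k} i k<n ne = δ-diff λ e → ne (≡.trans (≡.sym (m<n⇒m%n≡m k<n))
      (≡.trans (≡.sym (toℕ-mod k)) (≡.cong (toℕ ∘ proj₁) e)))

    δ-coeff-yes : ∀ {j k} (i : Fin n) → k < n → k ≡ toℕ i → δ (k mod n , j) (i , j) ≈ 1#
    δ-coeff-yes {j} {k} i k<n e = trans (reflexive (≡.cong (λ z → δ (z , j) (i , j))
      (Finₚ.toℕ-injective (≡.trans (toℕ-mod k) (≡.trans (m<n⇒m%n≡m k<n) e))))) (δ-same (i , j))

    +length : ∀ k {a : Carrier} p → k ℕ.+ length (a ∷ p) ≤ n → suc k ℕ.+ length p ≤ n
    +length k p = ≡.subst (_≤ n) (ℕₚ.+-suc k (length p))

    -- Since k + length p ≤ n the exponents do not wrap around modulo n, so no monomial with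
    -- exponent at least k reaches an index below k.
    lin-below : ∀ j k p → k ℕ.+ length p ≤ n → ∀ i → toℕ i < k → lin j (k ℕ.+_) p (i , j) ≈ 0#
    lin-below j k []      l i i<k = refl
    lin-below j k (a ∷ p) l i i<k = trans (+-cong
      (trans (*-congˡ (δ-coeff-no i (≡.subst (_< n) (≡.sym (ℕₚ.+-identityʳ k)) (ℕₚ.≤-trans (s≤s (ℕₚ.m≤m+n k (length p))) (+length k {a} p l)))
         (λ e → ℕₚ.<-irrefl (≡.trans (≡.sym e) (ℕₚ.+-identityʳ k)) i<k))) (zeroʳ a))
      (trans (lin-≡ j (ℕₚ.+-suc k) p (i , j))
        (lin-below j (suc k) p (+length k {a} p l) i (ℕₚ.m<n⇒m<1+n i<k)))) (+-identityˡ 0#)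

    lin-coeff : ∀ j k p → k ℕ.+ length p ≤ n → ∀ i t → toℕ i ≡ k ℕ.+ t → lin j (k ℕ.+_) p (i , j) ≈ coeff p t
    lin-coeff j k []      l i t       e = refl
    lin-coeff j k (a ∷ p) l i zero    e = trans (+-cong
      (trans (*-congˡ (δ-coeff-yes i (≡.subst (_< n) e (Finₚ.toℕ<n i)) (≡.sym e))) (*-identityʳ a))
      (trans (lin-≡ j (ℕₚ.+-suc k) p (i , j))
        (lin-below j (suc k) p (+length k {a} p l) i (s≤s (ℕₚ.≤-reflexive (≡.trans e (ℕₚ.+-identityʳ k))))))) (+-identityʳ a)
    lin-coeff j k (a ∷ p) l i (suc t) e = trans (+-cong
      (trans (*-congˡ (δ-coeff-no i (≡.subst (_< n) (≡.sym (ℕₚ.+-identityʳ k)) (ℕₚ.≤-trans (s≤s (ℕₚ.m≤m+n k (length p))) (+length k {a} p l)))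
         (λ q → ℕₚ.<-irrefl (≡.trans (≡.sym (ℕₚ.+-identityʳ k)) (≡.trans q e)) (ℕₚ.m<m+n k (s≤s z≤n))))) (zeroʳ a))
      (trans (lin-≡ j (ℕₚ.+-suc k) p (i , j))
        (lin-coeff j (suc k) p (+length k {a} p l) i t (≡.trans e (ℕₚ.+-suc k t))))) (+-identityˡ _)

  T-coeff : ∀ j p → length p ≤ n → ∀ i → T j p (i , j) ≈ coeff p (toℕ i)
  T-coeff j p l i = lin-coeff j 0 p l i (toℕ i) ≡.refl

  open Degree R

  private
    -- Reading off coefficients through `T-coeff` needs a short list, while division only bounds the
    -- degree; trailing zeros are cut here.
    shorten : ∀ m p → Deg< p m → ∃ λ p' → (p ≋ p') × length p' ≤ m
    shorten zero    p       d = [] , deg<0 d , z≤n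
    shorten (suc m) []      d = [] , ≋-refl , z≤n
    shorten (suc m) (a ∷ p) d with shorten m p (deg<-tail d)
    ... | p' , e , l = (a ∷ p') , ∷-cong refl e , s≤s l

  -- By periodicity the remainder modulo xⁿ - 1 has the same image as `p`, and its coefficients are
  -- the values of that image, so they all vanish.
  T-injective : ∀ j p → (∀ i → T j p (i , j) ≈ 0#) → p ≈/ []
  T-injective j p z with divMod (monic-xⁿ-1 n) p
  ... | q , r , e , d with shorten n r d
  ...   | r' , e' , l = ∣⇒≈/0 (q Divisibility.by P.sym (P.trans e (P.trans (P.+-congˡ {q *ₚ xⁿ-1 n} r0)
                          (P.trans (P.+-identityʳ _) (P.*-comm q (xⁿ-1 n))))))
    where
    coeff0 : ∀ i → coeff r' (toℕ i) ≈ 0#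
    coeff0 i = begin
      coeff r' (toℕ i)                                ≈⟨ sym (T-coeff j r' l i) ⟩
      T j r' (i , j)                                  ≈⟨ sym (lin-cong j _ e' (i , j)) ⟩
      T j r (i , j)                                   ≈⟨ sym (+-identityˡ _) ⟩
      0# + T j r (i , j)                              ≈⟨ +-congʳ (sym (T-periodic j q (i , j))) ⟩
      T j (xⁿ-1 n *ₚ q) (i , j) + T j r (i , j)       ≈⟨ sym (lin-+ j _ (xⁿ-1 n *ₚ q) r (i , j)) ⟩
      T j (xⁿ-1 n *ₚ q +ₚ r) (i , j)                  ≈⟨ lin-cong j _ (P.trans (P.+-congʳ {r} (P.*-comm (xⁿ-1 n) q)) (P.sym e)) (i , j) ⟩
      T j p (i , j)                                   ≈⟨ z i ⟩
      0#                                              ∎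
    r0 : r ≋ []
    r0 = P.trans e' (mk≋ λ i → zeroAt i (i ℕ.<? n))
      where
      zeroAt : ∀ i → Dec (i < n) → coeff r' i ≈ 0#
      zeroAt i (yes i<n) = trans (reflexive (≡.cong (coeff r') (≡.sym (Finₚ.toℕ-fromℕ< i<n)))) (coeff0 (Fin.fromℕ< i<n))
      zeroAt i (no i≮n)  = Deg<.above (deg<-length r') i (ℕₚ.≤-trans l (ℕₚ.≮⇒≥ i≮n))

  Φ : A → RG
  Φ = ΦM

  Φ-cong : ∀ {z w} → z ≈ᴬ w → Φ z ≈G Φ w
  Φ-cong (mkᴬ e f) g = +-cong (T-cong/ fzero e g) (T-cong/ (fsuc fzero) f g)

  Φ-0 : Φ 0ᴬ ≈G 0G
  Φ-0 g = +-identityˡ 0#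

  private
    Φ-fst : ∀ a b i → Φ (a , b) (i , fzero) ≈ T fzero a (i , fzero)
    Φ-fst a b i = trans (+-congˡ (lin-other (λ ()) _ b i)) (+-identityʳ _)

    Φ-snd : ∀ a b i → Φ (a , b) (i , fsuc fzero) ≈ T (fsuc fzero) b (i , fsuc fzero)
    Φ-snd a b i = trans (+-congʳ (lin-other (λ ()) _ a i)) (+-identityˡ _)

    T-injective₂ : ∀ j p q → (∀ i → T j p (i , j) ≈ T j q (i , j)) → p ≈/ q
    T-injective₂ j p q e = mk/ (≈/0⇒∣ (T-injective j (p +ₚ negₚ q) λ i →
      trans (lin-+ j _ p (negₚ q) (i , j)) (trans (+-congʳ (e i))
        (T-inverse j q (i , j)))))

  Φ-injective : ∀ {z w} → Φ z ≈G Φ w → z ≈ᴬ w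
  Φ-injective {a , b} {c , d} e = mkᴬ
    (T-injective₂ fzero a c λ i → trans (sym (Φ-fst a b i)) (trans (e (i , fzero)) (Φ-fst c d i)))
    (T-injective₂ (fsuc fzero) b d λ i → trans (sym (Φ-snd a b i)) (trans (e (i , fsuc fzero)) (Φ-snd c d i)))

  Φ-surjective : ∀ e → ∃ λ z → Φ z ≈G e
  Φ-surjective e = (pol fzero , pol (fsuc fzero)) , λ where
      (i , fzero)      → trans (Φ-fst (pol fzero) (pol (fsuc fzero)) i) (T-pol fzero i)
      (i , fsuc fzero) → trans (Φ-snd (pol fzero) (pol (fsuc fzero)) i) (T-pol (fsuc fzero) i)
    where
    pol : Fin 2 → Pol
    pol j = tabulate (λ i → e (i , j))
    coeff-tabulate : ∀ {m} (φ : Fin m → Carrier) i → coeff (tabulate φ) (toℕ i) ≡ φ i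
    coeff-tabulate φ fzero    = ≡.refl
    coeff-tabulate φ (fsuc i) = coeff-tabulate (φ ∘ fsuc) i
    T-pol : ∀ j i → T j (pol j) (i , j) ≈ e (i , j)
    T-pol j i = trans (T-coeff j (pol j) (ℕₚ.≤-reflexive (Listₚ.length-tabulate _)) i)
      (reflexive (coeff-tabulate (λ i → e (i , j)) i))

  Φ-· : ∀ z w → Φ z ⋆ Φ w ≈G Φ (z · w)
  Φ-· (a , b) (c , d) = ΦM-⋆ a b c d

  T₀≈toRG : ∀ p → T fzero p ≈G toRG p
  T₀≈toRG = go 0
    where
    go : ∀ k p → lin fzero (k ℕ.+_) p ≈G toRGFrom k p
    go k []      g = refl
    go k (a ∷ p) g = +-cong (reflexive (≡.cong (λ z → a * δ (z mod n , fzero) g) (ℕₚ.+-identityʳ k)))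
      (trans (lin-≡ fzero (ℕₚ.+-suc k) p g) (go (suc k) p g))

  Φ-pure : ∀ p → Φ (p , []) ≈G toRG p
  Φ-pure p g = trans (+-identityʳ _) (T₀≈toRG p g)

  Φ-pure-+ : ∀ p q → Φ (p +ₚ q , []) ≈G (Φ (p , []) +G Φ (q , []))
  Φ-pure-+ p q g = trans (+-congʳ (lin-+ fzero (λ t → t) p q g))
    (solve 2 (λ x y → x :+ y :+ :0 := x :+ :0 :+ (y :+ :0)) refl (T fzero p g) (T fzero q g))

  open import Function.Bundles using (_⇔_; mk⇔)

  -- Being a primitive central idempotent involves only products, 0 and equality, and `Φ` is a
  -- multiplicative bijection that preserves 0.
  pci⇔ : ∀ {z} → PCI z ⇔ PrimitiveCentralIdempotent (Φ z)
  pci⇔ {z} = mk⇔ to from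
    where
    infixr 5 _»_
    _»_ : ∀ {a b c : RG} → a ≈G b → b ≈G c → a ≈G c
    (e » f) g = trans (e g) (f g)
    symG : ∀ {a b : RG} → a ≈G b → b ≈G a
    symG e g = sym (e g)
    reflG : ∀ {a : RG} → a ≈G a
    reflG g = refl
    mult : ∀ {a b z w} → Φ z ≈G a → Φ w ≈G b → a ⋆ b ≈G Φ (z · w)
    mult {a} {b} {z} {w} e f = ⋆-cong {a} {Φ z} {b} {Φ w} (symG {Φ z} e) (symG {Φ w} f) » Φ-· z w
    back : ∀ {a b z w v} → Φ z ≈G a → Φ w ≈G b → a ⋆ b ≈G Φ v → z · w ≈ᴬ v
    back {a} {b} {z} {w} {v} e f h = Φ-injective (symG {a ⋆ b} (mult {a} {b} {z} {w} e f) » h)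
    to : PCI z → PrimitiveCentralIdempotent (Φ z)
    to p = (λ b → let (w , e) = Φ-surjective b in
              mult {Φ z} {b} {z} {w} (reflG {Φ z}) e » Φ-cong (central p w) » symG {b ⋆ Φ z} (mult {b} {Φ z} {w} {z} e (reflG {Φ z})))
         , Φ-· z z » Φ-cong (idempotent p)
         , (λ e → nonzero p (Φ-injective (e » symG Φ-0)))
         , λ e' c i l → let (w , e) = Φ-surjective e' in
             Sum.map (λ q → symG {Φ w} e » Φ-cong q » Φ-0) (λ q → symG {Φ w} e » Φ-cong q)
               (minimal p w
                 (λ v → back {e'} {Φ v} {w} {v} {v · w} e (reflG {Φ v}) (c (Φ v) » mult {Φ v} {e'} {v} {w} (reflG {Φ v}) e))
                 (back {e'} {e'} {w} {w} {w} e e (i » symG {Φ w} e))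
                 (back {Φ z} {e'} {z} {w} {w} (reflG {Φ z}) e (l » symG {Φ w} e)))
    from : PrimitiveCentralIdempotent (Φ z) → PCI z
    from (c , i , nz , m) = record
      { central    = λ w → back {Φ z} {Φ w} {z} {w} {w · z} (reflG {Φ z}) (reflG {Φ w}) (c (Φ w) » Φ-· w z)
      ; idempotent = back {Φ z} {Φ z} {z} {z} {z} (reflG {Φ z}) (reflG {Φ z}) i
      ; nonzero    = λ e → nz (Φ-cong e » Φ-0)
      ; minimal    = λ w c' i' l → Sum.map (λ q → Φ-injective (q » symG Φ-0)) Φ-injective
          (m (Φ w)
            (λ b → let (v , e) = Φ-surjective b in
              mult {Φ w} {b} {w} {v} (reflG {Φ w}) e » Φ-cong (c' v) » symG {b ⋆ Φ w} (mult {b} {Φ w} {v} {w} e (reflG {Φ w})))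
            (Φ-· w w » Φ-cong i')
            (Φ-· z w » Φ-cong l)) }

-- Splitting xⁿ - 1 in a finite field L between F and K.

monic-map : ∀ {A B : CR} (h : Hom A B) {m f} → Degree.MonicOfDegree A m f →
            Degree.MonicOfDegree B m (map (Hom.⟦_⟧ h) f)
monic-map {A} {B} h {m} {f} (Degree.monicOf l (Degree.deg< d)) = Degree.monicOf
  (trans (coeff-map f m) (trans (H.cong l) H.1-hom))
  (Degree.deg< λ i le → trans (coeff-map f i) (trans (H.cong (d i le)) 0-hom))
  where
  open CommutativeRing B
  open MapPolynomial h
  module H = Hom h
  open HomProperties h

module LinearFactors (R : CR) where
  open CommutativeRing R
  open Poly R
  open PolynomialRing R
  open Degree R
  open Roots R
  private
    module P = CommutativeRing (polyRing R)
    module Ev a = Evaluation (idHom R) a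
  open IntegerSolver (polyRing R)

  member-root : ∀ {a as} → a ∈ as → evalAt a (prodLin as) ≈ 0#
  member-root {a} {b ∷ bs} (here e)  = trans (Ev.eval-* a (linear b) (prodLin bs))
    (trans (*-congʳ (trans (eval-linear a b) (trans (+-congʳ e) (-‿inverseʳ b)))) (zeroˡ _))
  member-root {a} {b ∷ bs} (there m) = trans (Ev.eval-* a (linear b) (prodLin bs))
    (trans (*-congˡ (member-root m)) (zeroʳ _))

  cancel-linear : ∀ {r f g g₁ p} → g ≋ (linear r *ₚ g₁) → (f *ₚ g) ≋ (linear r *ₚ p) → (f *ₚ g₁) ≋ p
  cancel-linear {r} {f} {g} {g₁} {p} e q = monic-cancelˡ (monic-linear r) (P.trans
    (solve 3 (λ r f g → r :* (f :* g) := f :* (r :* g)) ≋-refl (linear r) f g₁)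
    (P.trans (P.*-congˡ {f} (P.sym e)) q))

module FieldRoots (K : Field) where
  open Field K
  open Poly commRing
  open PolynomialRing commRing
  open Degree commRing
  open Roots commRing
  open LinearFactors commRing
  private
    module P = CommutativeRing (polyRing commRing)
    module Ev a = Evaluation (idHom commRing) a
  open IntegerSolver commRing
  open import Relation.Binary.Reasoning.Setoid setoid

  Invertible : Carrier → Set
  Invertible x = ∃ λ y → x * y ≈ 1#

  -- If f is invertible at r, then g vanishes there and x - r can be cancelled on both sides; once
  -- the list is exhausted, f would divide 1. The conclusion is a negation because a list in K
  -- cannot be searched for a root.
  factor-has-root : ∀ {m f} g rs → MonicOfDegree (suc m) f → (f *ₚ g) ≋ prodLin rs →
                    ¬ All (λ r → Invertible (evalAt r f)) rs
  factor-has-root g [] M e _ with monic-cofactor 1≉0 M monic-one e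
  ... | _ , () , _
  factor-has-root {m} {f} g (r ∷ rs) M e ((y , fy) ∷ all) =
    let (g₁ , q) = root-factor r g gr
    in factor-has-root g₁ rs M (cancel-linear {r} {f} {g} {g₁} {prodLin rs} q e) all
    where
    gr : evalAt r g ≈ 0#
    gr = begin
      evalAt r g                            ≈⟨ sym (*-identityˡ _) ⟩
      1# * evalAt r g                       ≈⟨ *-congʳ (sym fy) ⟩
      evalAt r f * y * evalAt r g           ≈⟨ solve 3 (λ f y g → f :* y :* g := y :* (f :* g)) refl _ y _ ⟩
      y * (evalAt r f * evalAt r g)         ≈⟨ *-congˡ (sym (Ev.eval-* r f g)) ⟩
      y * evalAt r (f *ₚ g)                 ≈⟨ *-congˡ (trans (Ev.eval-cong r {f *ₚ g} {prodLin (r ∷ rs)} e) (member-root {r} {r ∷ rs} (here refl))) ⟩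
      y * 0#                                ≈⟨ zeroʳ y ⟩
      0#                                    ∎

  -- Since c differs from 1, the element 1 - c is invertible, and c (1 - c) = 0. This is the point
  -- where a negative statement yields an equation in K.
  idempotent-stable : ∀ {c} → c * c ≈ c → ¬ (c ≈ 1#) → c ≈ 0#
  idempotent-stable {c} cc c≉1 with inverse (1# - c) (λ z → c≉1 (begin
      c                ≈⟨ solve 1 (λ c → c := :1 :- (:1 :- c)) refl c ⟩
      1# - (1# - c)    ≈⟨ +-congˡ (-‿cong z) ⟩
      1# - 0#          ≈⟨ solve 0 (:1 :- :0 := :1) refl ⟩
      1#               ∎))
  ... | y , e = begin
      c                      ≈⟨ sym (*-identityʳ c) ⟩
      c * 1#                 ≈⟨ *-congˡ (sym e) ⟩
      c * ((1# - c) * y)     ≈⟨ solve 2 (λ c y → c :* ((:1 :- c) :* y) := (c :- c :* c) :* y) refl c y ⟩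
      (c - c * c) * y        ≈⟨ *-congʳ (trans (+-congˡ (-‿cong cc)) (-‿inverseʳ c)) ⟩
      0# * y                 ≈⟨ zeroˡ y ⟩
      0#                     ∎

  -- K need not have decidable equality, so a root of φ is not picked from a list but
  -- assembled from it: E is an idempotent telling whether r is a root of φ.
  module RootSelection {L : CR} (j : Hom L commRing) (φ : Poly.Pol L) where
    val : Carrier → Carrier
    val a = eval j a φ

    record Test (r : Carrier) : Set where
      field
        E      : Carrier
        E-idem : E * E ≈ E
        E-root : val r * E ≈ 0#
        E-inv  : E ≈ 0# → Invertible (val r)
    open Test

    -- Choice between a, where E is 1, and b, where E is 0, made by arithmetic.
    mix : Carrier → Carrier → Carrier → Carrier
    mix E a b = E * a + (1# - E) * b

    -- An idempotent E splits the ring as a product along E and 1 - E, and polynomial maps act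
    -- factorwise; in the computation all cross terms are multiples of E² - E.
    eval-mix : ∀ {E} → E * E ≈ E → ∀ a b p → eval j (mix E a b) p ≈ mix E (eval j a p) (eval j b p)
    eval-mix {E} EE a b []      = solve 1 (λ e → :0 := e :* :0 :+ (:1 :- e) :* :0) refl E
    eval-mix {E} EE a b (c ∷ p) = begin
      c' + mix E a b * eval j (mix E a b) p
        ≈⟨ +-congˡ (*-congˡ (eval-mix EE a b p)) ⟩
      c' + mix E a b * mix E p₁ p₂
        ≈⟨ solve 6 (λ c e a b p q → c :+ (e :* a :+ (:1 :- e) :* b) :* (e :* p :+ (:1 :- e) :* q) :=
             e :* (c :+ a :* p) :+ (:1 :- e) :* (c :+ b :* q) :+ (e :* e :- e) :* (a :* p :- a :* q :- b :* p :+ b :* q))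
             refl c' E a b p₁ p₂ ⟩
      mix E (c' + a * p₁) (c' + b * p₂) + (E * E - E) * (a * p₁ - a * p₂ - b * p₁ + b * p₂)
        ≈⟨ +-congˡ (trans (*-congʳ (trans (+-congʳ EE) (-‿inverseʳ E))) (zeroˡ _)) ⟩
      mix E (c' + a * p₁) (c' + b * p₂) + 0#
        ≈⟨ +-identityʳ _ ⟩
      mix E (c' + a * p₁) (c' + b * p₂) ∎
      where
      c' = Hom.⟦_⟧ j c
      p₁ = eval j a p
      p₂ = eval j b p

    -- `c` is the idempotent for the event that no entry of the list is a root, obtained as the
    -- product of the 1 - E; away from it `root` is a root of φ.
    record Selected (rs : List Carrier) : Set where
      field
        root c : Carrier
        c-idem : c * c ≈ c
        c-root : val root * (1# - c) ≈ 0#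
        c-none : c ≈ 1# → All (λ r → Invertible (val r)) rs

    select : ∀ rs → All Test rs → Selected rs
    select []       []       = record
      -- The default root is arbitrary: with c = 1 its value is multiplied by 0.
      { root = 0# ; c = 1# ; c-idem = *-identityˡ 1#
      ; c-root = trans (*-congˡ (-‿inverseʳ 1#)) (zeroʳ _) ; c-none = λ _ → [] }
    select (r ∷ rs) (t ∷ ts) = record
      { root = mix (E t) r S.root ; c = (1# - E t) * S.c
      ; c-idem = begin
          (1# - E t) * S.c * ((1# - E t) * S.c)
            ≈⟨ solve 2 (λ e c → (:1 :- e) :* c :* ((:1 :- e) :* c) := (:1 :- e :+ (e :* e :- e)) :* (c :* c)) refl (E t) S.c ⟩
          (1# - E t + (E t * E t - E t)) * (S.c * S.c)
            ≈⟨ *-cong (trans (+-congˡ (d0 t)) (+-identityʳ _)) S.c-idem ⟩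
          (1# - E t) * S.c ∎
      ; c-root = begin
          val (mix (E t) r S.root) * (1# - (1# - E t) * S.c)
            ≈⟨ *-congʳ (eval-mix (E-idem t) r S.root φ) ⟩
          mix (E t) (val r) (val S.root) * (1# - (1# - E t) * S.c)
            ≈⟨ solve 4 (λ e r a c → (e :* r :+ (:1 :- e) :* a) :* (:1 :- (:1 :- e) :* c) :=
                 r :* e :* (:1 :- (:1 :- e) :* c) :+ (:1 :- e) :* (a :* (:1 :- c)) :- (e :* e :- e) :* a :* c)
                 refl (E t) (val r) (val S.root) S.c ⟩
          val r * E t * (1# - (1# - E t) * S.c) + (1# - E t) * (val S.root * (1# - S.c)) - (E t * E t - E t) * val S.root * S.c
            ≈⟨ +-cong (+-cong (*-congʳ (E-root t)) (*-congˡ S.c-root)) (-‿cong (*-congʳ (*-congʳ (d0 t)))) ⟩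
          0# * (1# - (1# - E t) * S.c) + (1# - E t) * 0# - 0# * val S.root * S.c
            ≈⟨ solve 4 (λ x y z w → :0 :* x :+ y :* :0 :- :0 :* z :* w := :0) refl _ _ _ _ ⟩
          0# ∎
      ; c-none = λ e → E-inv t (E≈0 e) ∷ S.c-none (trans (sym (trans (*-congʳ (trans (+-congˡ (-‿cong (E≈0 e)))
          (solve 0 (:1 :- :0 := :1) refl))) (*-identityˡ S.c))) e) }
      where
      module S = Selected (select rs ts)
      d0 : ∀ {r} (t : Test r) → E t * E t - E t ≈ 0#
      d0 t = trans (+-congʳ (E-idem t)) (-‿inverseʳ _)
      E≈0 : (1# - E t) * S.c ≈ 1# → E t ≈ 0#
      E≈0 e = begin
        E t                               ≈⟨ sym (*-identityʳ _) ⟩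
        E t * 1#                          ≈⟨ *-congˡ (sym e) ⟩
        E t * ((1# - E t) * S.c)          ≈⟨ solve 2 (λ e c → e :* ((:1 :- e) :* c) := :- ((e :* e :- e) :* c)) refl (E t) S.c ⟩
        - ((E t * E t - E t) * S.c)       ≈⟨ -‿cong (trans (*-congʳ (d0 t)) (zeroˡ _)) ⟩
        - 0#                              ≈⟨ solve 0 (:- :0 := :0) refl ⟩
        0#                                ∎

  module _ {L : CR} (j : Hom L commRing) (n : ℕ)
           (cn : CommutativeRing.Carrier L)
           (cn-eq : IsNegInverse L n cn)
           (rs : List Carrier) (splits : xⁿ-1 n ≋ prodLin rs) where
    private
      module L = Poly L
      module M = MapPolynomial j

    -- `factor-has-root` excludes that φ is invertible at every listed element, so the idempotent
    -- `c` of the selection is not 1, hence 0, and the selected element is a root.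
    root-of-factor : ∀ {m φ g} → Degree.MonicOfDegree L (suc m) φ →
                     PolynomialRing._≋_ L (φ L.*ₚ g) (L.xⁿ-1 n) → ∃ λ a → eval j a φ ≈ 0#
    root-of-factor {m} {φ} {g} Mφ φg = S.root , (begin
        eval j S.root φ                ≈⟨ sym (*-identityʳ _) ⟩
        eval j S.root φ * 1#           ≈⟨ *-congˡ (solve 0 (:1 := :1 :- :0) refl) ⟩
        eval j S.root φ * (1# - 0#)    ≈⟨ *-congˡ (+-congˡ (-‿cong (sym c≈0))) ⟩
        eval j S.root φ * (1# - S.c)   ≈⟨ S.c-root ⟩
        0#                             ∎)
      where
      open RootSelection j φ
      fg : (map (Hom.⟦_⟧ j) φ *ₚ map (Hom.⟦_⟧ j) g) ≋ prodLin rs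
      fg = P.trans (P.sym (M.map-* φ g)) (P.trans (M.map-cong φg) (P.trans (M.map-xⁿ-1 n) splits))
      B = Derivative.bezout-cofactor L n cn cn-eq {φ} {g} φg
      u v : L.Pol
      u = proj₁ B
      v = proj₁ (proj₂ B)
      uv : PolynomialRing._≋_ L (u L.*ₚ φ L.+ₚ v L.*ₚ g) L.oneₚ
      uv = proj₂ (proj₂ B)
      at-id : ∀ r p → evalAt r (map (Hom.⟦_⟧ j) p) ≈ eval j r p
      at-id r p = trans (M.eval-map (idHom commRing) r p) (go p)
        where
        go : ∀ p → eval (idHom commRing ∘ʰ j) r p ≈ eval j r p
        go []      = refl
        go (a ∷ p) = +-congˡ (*-congˡ (go p))
      test : ∀ {r} → r ∈ rs → Test r
      test {r} r∈ = record
        -- In 1 = U φ(r) + V g(r) the two summands have product 0, because φ(r) g(r) = 0; so they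
        -- are complementary idempotents.
        { E      = V * g'
        ; E-idem = begin
            V * g' * (V * g')        ≈⟨ solve 3 (λ a v g → v :* g :* (v :* g) := v :* g :* (a :+ v :* g) :- v :* (a :* g)) refl (U * f') V g' ⟩
            V * g' * (U * f' + V * g') - V * (U * f' * g')
              ≈⟨ +-cong (*-congˡ UV) (-‿cong (trans (solve 4 (λ u v f g → v :* (u :* f :* g) := u :* v :* (f :* g)) refl U V f' g') (*-congˡ FG))) ⟩
            V * g' * 1# - U * V * 0#   ≈⟨ solve 2 (λ a b → a :* :1 :- b :* :0 := a) refl _ _ ⟩
            V * g'                     ∎
        ; E-root = trans (solve 3 (λ v f g → f :* (v :* g) := v :* (f :* g)) refl V f' g') (trans (*-congˡ FG) (zeroʳ V))
        ; E-inv  = λ e → U , (begin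
            f' * U               ≈⟨ solve 2 (λ f u → f :* u := u :* f :+ :0) refl f' U ⟩
            U * f' + 0#          ≈⟨ +-congˡ (sym e) ⟩
            U * f' + V * g'      ≈⟨ UV ⟩
            1#                   ∎) }
        where
        module E = Evaluation j r
        f' = eval j r φ
        g' = eval j r g
        U  = eval j r u
        V  = eval j r v
        UV : U * f' + V * g' ≈ 1#
        UV = trans (sym (trans (E.eval-+ (u L.*ₚ φ) (v L.*ₚ g)) (+-cong (E.eval-* u φ) (E.eval-* v g))))
               (trans (E.eval-cong uv) (Hom.1-hom (evalHom j r)))
        FG : f' * g' ≈ 0#
        FG = begin
          f' * g'                               ≈⟨ sym (*-cong (at-id r φ) (at-id r g)) ⟩
          evalAt r (map (Hom.⟦_⟧ j) φ) * evalAt r (map (Hom.⟦_⟧ j) g) ≈⟨ sym (Ev.eval-* r (map (Hom.⟦_⟧ j) φ) _) ⟩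
          evalAt r (map (Hom.⟦_⟧ j) φ *ₚ map (Hom.⟦_⟧ j) g)           ≈⟨ Ev.eval-cong r fg ⟩
          evalAt r (prodLin rs)                 ≈⟨ member-root r∈ ⟩
          0#                                    ∎
      tests : All Test rs
      tests = All.tabulateₛ setoid test
      module S = Selected (select rs tests)
      c≈0 : S.c ≈ 0#
      c≈0 = idempotent-stable S.c-idem λ c1 → factor-has-root (map (Hom.⟦_⟧ j) g) rs (monic-map j Mφ) fg
        (All.map (λ {r} (y , e) → y , trans (*-congʳ (at-id r φ)) e) (S.c-none c1))

record FiniteField : Set₁ where
  field
    field′ : Field
    _≟_    : ∀ x y → Dec (Field._≈_ field′ x y)
    search : Searchable (Field.commRing field′)
  open Field field′ public

-- The interface to L[x]/(φ) is its universal property: a map on L extends once a root of φ is given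
-- in the target. The tower is built from this and never looks at residue classes.
record RootExtension (L : FiniteField) (φ : Poly.Pol (FiniteField.commRing L)) : Set₁ where
  open FiniteField L using (commRing)
  field
    extension : FiniteField
  module L′ = FiniteField extension
  field
    embed     : Hom commRing L′.commRing
    root      : L′.Carrier
    is-root   : eval embed root φ L′.≈ L′.0#
    extend    : ∀ {S : CR} (j : Hom commRing S) a → CommutativeRing._≈_ S (eval j a φ) (CommutativeRing.0# S) →
                Σ (Hom L′.commRing S) λ j′ → ∀ b → CommutativeRing._≈_ S (Hom.⟦_⟧ j′ (Hom.⟦_⟧ embed b)) (Hom.⟦_⟧ j b)

module SplitOff {A B : CR} (1≉0 : ¬ (CommutativeRing._≈_ B (CommutativeRing.1# B) (CommutativeRing.0# B)))
    (h : Hom A B) where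
  private
    module A = Poly A
    module B = CommutativeRing B
    module PB = CommutativeRing (polyRing B)
  open PolynomialRing A using () renaming (_≋_ to _≋A_)
  open Poly B
  open PolynomialRing B
  open Degree B
  open MapPolynomial h
  open IntegerSolver (polyRing B)

  split-off : ∀ {k} n as g a → (A.prodLin as A.*ₚ g) ≋A A.xⁿ-1 n → Degree.MonicOfDegree A (suc k) g →
              eval h a g B.≈ B.0# →
              ∃ λ g₁ → ((prodLin (a ∷ map (Hom.⟦_⟧ h) as) *ₚ g₁) ≋ xⁿ-1 n) × MonicOfDegree k g₁
  split-off {k} n as g a e M z with Roots.root-factor B a (mapₚ g) (B.trans (eval-map (idHom B) a g) (B.trans (id-eval g) z))
    where
    id-eval : ∀ p → eval (idHom B ∘ʰ h) a p B.≈ eval h a p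
    id-eval []      = B.refl
    id-eval (c ∷ p) = B.+-congˡ (B.*-congˡ (id-eval p))
  ... | g₁ , q with monic-cofactor 1≉0 (monic-linear a) (monic-map h M) (PB.sym q)
  ...   | k' , ≡.refl , M₁ = g₁ , PB.trans
      (solve 3 (λ l p g → l :* p :* g := p :* (l :* g)) PB.refl (linear a) (prodLin (map (Hom.⟦_⟧ h) as)) g₁)
      (PB.trans (PB.*-cong (PB.sym (map-prodLin as)) (PB.sym q))
        (PB.trans (PB.sym (map-* (A.prodLin as) g)) (PB.trans (map-cong e) (map-xⁿ-1 n)))) , M₁

module Adjoin (L : FiniteField) {φ : Poly.Pol (FiniteField.commRing L)}
    (irr : DiscreteField.Irr (FiniteField.field′ L) (FiniteField._≟_ L) φ) {m : ℕ}
    (Mφ : Degree.MonicOfDegree (FiniteField.commRing L) m φ) where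
  open FiniteField L
  open Poly commRing
  open PolynomialRing commRing
  open Degree commRing
  open DiscreteField field′ _≟_ using (Irr; irreducible-dichotomy; monic-∣?)
  open SearchableField field′ _≟_ search using (searchPol)
  open Divisibility (polyRing commRing)
  open Quotient (polyRing commRing) φ
  private
    module P = CommutativeRing (polyRing commRing)
    module Q = CommutativeRing quotient
  open IntegerSolver (polyRing commRing) using (solve; _:=_; _:+_; _:*_; _:-_; :-_)

  private
    -- The irreducible φ is comaximal with any x that it does not divide, and the coefficient of x
    -- in the Bézout identity is the inverse.
    inverse/ : ∀ x → ¬ (x ≈/ []) → ∃ λ y → (x *ₚ y) ≈/ oneₚ
    inverse/ x nz with irreducible-dichotomy irr x
    ... | inj₁ d           = ⊥-elim (nz (∣⇒≈/0 d))
    ... | inj₂ (u , v , e) = v , mk/ (negₚ u by P.trans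
          (solve 4 (λ u v f x → f :* (:- u) := x :* v :- (u :* f :+ v :* x)) ≋-refl u v φ x)
          (P.+-congˡ {x *ₚ v} (P.-‿cong e)))

    -- Every class contains a remainder of degree below `m`, so a search in bounded degree suffices.
    search/ : Searchable quotient
    search/ S resp dec = map′ (λ (p , _ , s) → p , s) reduce
      (searchPol m S (λ e → resp (≈⇒≈/ e)) dec)
      where
      reduce : ∃ S → ∃ λ p → Deg< p m × S p
      reduce (p , s) with divMod Mφ p
      ... | q , r , e , d = r , d , resp (mk/ (q by P.trans
            (solve 3 (λ q f r → f :* q := q :* f :+ r :- r) ≋-refl q φ r) (P.+-congʳ {negₚ r} (P.sym e)))) s

  extension : FiniteField
  extension = record
    { field′ = record { commRing = quotient ; 1≉0 = λ e → Irr.∤1 irr (≈/0⇒∣ e) ; inverse = inverse/ }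
    ; _≟_ = λ x y → map′ mk/ un/ (monic-∣? Mφ (x +ₚ negₚ y))
    ; search = search/ }

  private
    embed′ : Hom commRing quotient
    embed′ = π ∘ʰ constHom commRing

    root-vanishes : eval embed′ X φ ≈/ []
    root-vanishes = Q.trans {eval embed′ X φ} {φ} {[]}
      (Q.sym {φ} {eval embed′ X φ} (Evaluation.eval-unique embed′ X π (λ a → Q.refl {a ∷ []}) (Q.refl {X}) φ)) (∣⇒≈/0 ∣-refl)

    extend′ : ∀ {S : CR} (j : Hom commRing S) a → CommutativeRing._≈_ S (eval j a φ) (CommutativeRing.0# S) →
              Σ (Hom quotient S) λ j′ → ∀ b → CommutativeRing._≈_ S (Hom.⟦_⟧ j′ (Hom.⟦_⟧ embed′ b)) (Hom.⟦_⟧ j b)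
    extend′ j a z = lift (evalHom j a) z , Evaluation.eval-const j a

  rootExtension : RootExtension L φ
  rootExtension = record
    { extension = extension ; embed = embed′ ; root = X ; is-root = root-vanishes ; extend = extend′ }

module SplittingTower (F : FiniteField) (K : Field)
    (ι : Hom (FiniteField.commRing F) (Field.commRing K))
    (n : ℕ) .{{_ : NonZero n}} (cn : FiniteField.Carrier F)
    (cn-eq : IsNegInverse (FiniteField.commRing F) n cn)
    (rs : List (Field.Carrier K))
    (splits : PolynomialRing._≋_ (Field.commRing K) (Poly.xⁿ-1 (Field.commRing K) n) (Poly.prodLin (Field.commRing K) rs)) where

  record Splitting : Set₁ where
    field
      L       : FiniteField
      into    : Hom (FiniteField.commRing F) (FiniteField.commRing L)
      onto    : Hom (FiniteField.commRing L) (Field.commRing K)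
      factors : ∀ a → Field._≈_ K (Hom.⟦_⟧ onto (Hom.⟦_⟧ into a)) (Hom.⟦_⟧ ι a)
      roots   : List (FiniteField.Carrier L)
      split   : PolynomialRing._≋_ (FiniteField.commRing L)
                  (Poly.prodLin (FiniteField.commRing L) roots) (Poly.xⁿ-1 (FiniteField.commRing L) n)

  cn-hom : ∀ {L : CR} (i : Hom (FiniteField.commRing F) L) →
           IsNegInverse L n (Hom.⟦_⟧ i cn)
  cn-hom {L} i = trans (*-congˡ (sym (nat-hom n))) (trans (sym (Hom.*-hom i _ _))
    (trans (Hom.cong i cn-eq) (trans (neg-hom _) (-‿cong (Hom.1-hom i)))))
    where
    open CommutativeRing L
    open HomProperties i

  private
    Monicᴸ : (L : FiniteField) → ℕ → Poly.Pol (FiniteField.commRing L) → Set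
    Monicᴸ L = Degree.MonicOfDegree (FiniteField.commRing L)

    PartialSplit : (L : FiniteField) → List (FiniteField.Carrier L) → Poly.Pol (FiniteField.commRing L) → Set
    PartialSplit L as g = PolynomialRing._≋_ commRing (Poly._*ₚ_ commRing (Poly.prodLin commRing as) g) (Poly.xⁿ-1 commRing n)
      where open FiniteField L using (commRing)

    -- Induction on the degree of the part `g` of xⁿ - 1 not yet split. A root of an irreducible
    -- factor φ of `g` is adjoined; a root of φ in K, available because φ divides xⁿ - 1, extends
    -- the map into K to the new field.
    tower : ∀ k (L : FiniteField) (i : Hom (FiniteField.commRing F) (FiniteField.commRing L))
      (j : Hom (FiniteField.commRing L) (Field.commRing K)) →
      (∀ a → Field._≈_ K (Hom.⟦_⟧ j (Hom.⟦_⟧ i a)) (Hom.⟦_⟧ ι a)) →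
      ∀ as g → PartialSplit L as g → Monicᴸ L k g → Splitting
    tower zero L i j ij as g e M = record
      { L = L ; into = i ; onto = j ; factors = ij ; roots = as
      ; split = P.trans (P.sym (P.trans (P.*-congˡ {prodLin as} (monic0 M)) (P.*-identityʳ _))) e }
      where
      open FiniteField L using (commRing)
      open Poly commRing
      open Degree commRing
      module P = CommutativeRing (polyRing commRing)
    tower (suc k) L i j ij as g e M = next (irreducible-factor (λ _ → ⊤) (λ _ _ → _) (λ _ _ _ → inj₁ _) M _)
      where
      open FiniteField L hiding (trans; sym)
      open Poly commRing
      open PolynomialRing commRing
      open Degree commRing
      open DiscreteField field′ _≟_ using (Irr; ∤1)
      open SearchableField field′ _≟_ search using (irreducible-factor)
      open Divisibility (polyRing commRing)
      module P = CommutativeRing (polyRing commRing)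
      module K = Field K
      open IntegerSolver (polyRing commRing)

      next : (∃ λ f → Monic f × Irr f × f ∣ g × ⊤) → Splitting
      next (φ , mφ , irr , φ∣g , _) = go (Monic⇒ mφ)
        where
        w : Pol
        w = cofactor φ∣g
        go : (∃ λ m → MonicOfDegree m φ) → Splitting
        go (zero  , Mφ) = ⊥-elim (∤1 irr (∣-reflexive (monic0 Mφ)))
        go (suc m , Mφ) = step (Adjoin.rootExtension L irr Mφ)
          where
          cofactorφ : (φ *ₚ (w *ₚ prodLin as)) ≋ xⁿ-1 n
          cofactorφ = P.trans (solve 3 (λ f w p → f :* (w :* p) := p :* (f :* w)) ≋-refl φ w (prodLin as))
            (P.trans (P.*-congˡ {prodLin as} (product φ∣g)) e)
          step : RootExtension L φ → Splitting
          step E = finish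
            (FieldRoots.root-of-factor K j n (Hom.⟦_⟧ i cn) (cn-hom i) rs splits {m} {φ} {w *ₚ prodLin as} Mφ cofactorφ)
            (SplitOff.split-off L′.1≉0 embed n as g root e M g-root)
            where
            open RootExtension E
            g-root : eval embed root g L′.≈ L′.0#
            g-root = L′.trans (Evaluation.eval-cong embed root {g} {φ *ₚ w} (P.sym (product φ∣g)))
              (L′.trans (Evaluation.eval-* embed root φ w) (L′.trans (L′.*-congʳ is-root) (L′.zeroˡ _)))
            finish : (∃ λ a → eval j a φ K.≈ K.0#) →
              (∃ λ g₁ → PartialSplit extension (root ∷ map (Hom.⟦_⟧ embed) as) g₁ × Monicᴸ extension k g₁) → Splitting
            finish (a , φa) (g₁ , e₁ , M₁) = tower k extension (embed ∘ʰ i) (proj₁ (extend j a φa))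
              (λ b → K.trans (proj₂ (extend j a φa) (Hom.⟦_⟧ i b)) (ij b)) (root ∷ map (Hom.⟦_⟧ embed) as) g₁ e₁ M₁

  splitting : Splitting
  splitting = tower n F (idHom _) ι (λ a → Field.refl K) [] (Poly.xⁿ-1 R n)
    (CommutativeRing.*-identityˡ (polyRing R) _) (Degree.monic-xⁿ-1 R n)
    where R = FiniteField.commRing F

module SplitField (L : Field) (_≟_ : ∀ x y → Dec (Field._≈_ L x y)) where
  open Field L
  open Poly commRing
  open PolynomialRing commRing
  open Degree commRing
  open Roots commRing
  open LinearFactors commRing
  open Powers commRing
  private
    module P = CommutativeRing (polyRing commRing)
    module Ev a = Evaluation (idHom commRing) a
  open IntegerSolver commRing
  open import Relation.Binary.Reasoning.Setoid setoid

  no-zero-divisors : ∀ {a b} → a * b ≈ 0# → a ≈ 0# ⊎ b ≈ 0#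
  no-zero-divisors {a} {b} e with a ≟ 0#
  ... | yes z = inj₁ z
  ... | no nz with inverse a nz
  ...   | y , ay = inj₂ (begin
    b              ≈⟨ sym (*-identityˡ b) ⟩
    1# * b         ≈⟨ *-congʳ (sym ay) ⟩
    a * y * b      ≈⟨ solve 3 (λ a y b → a :* y :* b := y :* (a :* b)) refl a y b ⟩
    y * (a * b)    ≈⟨ *-congˡ e ⟩
    y * 0#         ≈⟨ zeroʳ y ⟩
    0#             ∎)

  sub≈0 : ∀ {a b} → a - b ≈ 0# → a ≈ b
  sub≈0 {a} {b} e = trans (solve 2 (λ a b → a := a :- b :+ b) refl a b) (trans (+-congʳ e) (+-identityˡ b))

  root-member : ∀ {a} as → evalAt a (prodLin as) ≈ 0# → a ∈ as
  root-member {a} []       e = ⊥-elim (1≉0 (trans (sym (Hom.1-hom (evalHom (idHom commRing) a))) e))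
  root-member {a} (b ∷ bs) e = [ (λ z → here (sub≈0 (trans (sym (eval-linear a b)) z))) , (λ z → there (root-member bs z)) ]′
    (no-zero-divisors {evalAt a (linear b)} {evalAt a (prodLin bs)} (trans (sym (Ev.eval-* a (linear b) (prodLin bs))) e))

  -- Each linear factor x - r goes to f or to g, according to which of the two vanishes at r; this
  -- is decidable here.
  split-factor : ∀ {m} rs f g → MonicOfDegree m f → (f *ₚ g) ≋ prodLin rs → ∃ λ bs → f ≋ prodLin bs
  split-factor {zero}  []       f g M e = [] , monic0 M
  split-factor {suc m} []       f g M e with monic-cofactor 1≉0 M monic-one e
  ... | _ , () , _
  split-factor {m} (r ∷ rs) f g M e = by-root (evalAt r f ≟ 0#)
    where
    at-r : evalAt r f * evalAt r g ≈ 0#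
    at-r = trans (sym (Ev.eval-* r f g)) (trans (Ev.eval-cong r {f *ₚ g} {prodLin (r ∷ rs)} e) (member-root {r} {r ∷ rs} (here refl)))
    take : ∀ f₁ → f ≋ (linear r *ₚ f₁) → ∀ k → m ≡ suc k → MonicOfDegree k f₁ → ∃ λ bs → f ≋ prodLin bs
    take f₁ q k _ M₁ = let (bs , q') = split-factor rs f₁ g M₁ (P.trans (P.*-comm f₁ g)
                              (cancel-linear {r} {g} {f} {f₁} {prodLin rs} q (P.trans (P.*-comm g f) e)))
                        in (r ∷ bs) , P.trans q (P.*-congˡ {linear r} q')
    by-root : Dec (evalAt r f ≈ 0#) → ∃ λ bs → f ≋ prodLin bs
    by-root (yes z) = let (f₁ , q) = root-factor r f z
                          (k , eq , M₁) = monic-cofactor 1≉0 {g = f₁} (monic-linear r) M (P.sym q)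
                      in take f₁ q k eq M₁
    by-root (no nz) = [ (λ z → ⊥-elim (nz z)) , (λ z → let (g₁ , q) = root-factor r g z in
      split-factor rs f g₁ M (cancel-linear {r} {f} {g} {g₁} {prodLin rs} q e)) ]′ (no-zero-divisors at-r)

  Distinct : List Carrier → Set
  Distinct = AllPairs (λ a b → ¬ (a ≈ b))

  -- After x - c is split off, the quotient still vanishes at the remaining roots, since these
  -- differ from c.
  distinct-roots-divide : ∀ cs h → Distinct cs → All (λ c → evalAt c h ≈ 0#) cs → ∃ λ k → h ≋ (prodLin cs *ₚ k)
  distinct-roots-divide []       h []        []       = h , P.sym (P.*-identityˡ h)
  distinct-roots-divide (c ∷ cs) h (d ∷ ds) (z ∷ zs) =
    let (h₁ , q) = root-factor c h z
        (k , q') = distinct-roots-divide cs h₁ ds (All.zipWith (λ {c'} (ne , z') → still-root h₁ q c' ne z') (d , zs))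
    in k , P.trans q (P.trans (P.*-congˡ {linear c} q') (P.sym (P.*-assoc (linear c) (prodLin cs) k)))
    where
    still-root : ∀ h₁ → h ≋ (linear c *ₚ h₁) → ∀ c' → ¬ (c ≈ c') → evalAt c' h ≈ 0# → evalAt c' h₁ ≈ 0#
    still-root h₁ q c' ne z' = [ (λ e → ⊥-elim (ne (sym (sub≈0 (trans (sym (eval-linear c' c)) e))))) , (λ e → e) ]′
      (no-zero-divisors {evalAt c' (linear c)} {evalAt c' h₁} (trans (sym (Ev.eval-* c' (linear c) h₁)) (trans (sym (Ev.eval-cong c' {h} {linear c *ₚ h₁} q)) z')))

  module _ (n : ℕ) .{{_ : NonZero n}} (cn : Carrier) (cn-eq : IsNegInverse commRing n cn) where

    -- Separability: x - b is comaximal with its cofactor in xⁿ - 1, and that cofactor would vanish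
    -- at b if b occurred again.
    distinct : ∀ bs g → (prodLin bs *ₚ g) ≋ xⁿ-1 n → Distinct bs
    distinct []       g e = []
    distinct (b ∷ bs) g e = fresh bs (λ m → m) ∷ distinct bs (linear b *ₚ g)
        (P.trans (P.sym (P.*-assoc (prodLin bs) (linear b) g)) (P.trans (P.*-congʳ {g} (P.*-comm (prodLin bs) (linear b))) e))
      where
      e' : (linear b *ₚ (prodLin bs *ₚ g)) ≋ xⁿ-1 n
      e' = P.trans (P.sym (P.*-assoc (linear b) (prodLin bs) g)) e
      separated : (∃ λ u → ∃ λ v → (u *ₚ linear b +ₚ v *ₚ (prodLin bs *ₚ g)) ≋ oneₚ) → ¬ (b ∈ bs)
      separated (u , v , uv) m = 1≉0 (begin
        1#                                  ≈⟨ sym (Hom.1-hom (evalHom (idHom commRing) b)) ⟩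
        evalAt b oneₚ                       ≈⟨ sym (Ev.eval-cong b uv) ⟩
        evalAt b (u *ₚ linear b +ₚ v *ₚ (prodLin bs *ₚ g))
          ≈⟨ trans (Ev.eval-+ b (u *ₚ linear b) (v *ₚ (prodLin bs *ₚ g))) (+-cong (Ev.eval-* b u (linear b))
               (trans (Ev.eval-* b v (prodLin bs *ₚ g)) (*-congˡ (Ev.eval-* b (prodLin bs) g)))) ⟩
        evalAt b u * evalAt b (linear b) + evalAt b v * (evalAt b (prodLin bs) * evalAt b g)
          ≈⟨ +-cong (*-congˡ (trans (eval-linear b b) (-‿inverseʳ b))) (*-congˡ (*-congʳ (member-root m))) ⟩
        evalAt b u * 0# + evalAt b v * (0# * evalAt b g)
          ≈⟨ solve 3 (λ u v g → u :* :0 :+ v :* (:0 :* g) := :0) refl (evalAt b u) (evalAt b v) (evalAt b g) ⟩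
        0# ∎)
      not-member : ¬ (b ∈ bs)
      not-member = separated (Derivative.bezout-cofactor commRing n cn cn-eq {linear b} {prodLin bs *ₚ g} e')
      fresh : ∀ cs → (∀ {x} → x ∈ cs → x ∈ bs) → All (λ c → ¬ (b ≈ c)) cs
      fresh []       sub = []
      fresh (c ∷ cs) sub = (λ bc → not-member (sub (here bc))) ∷ fresh cs (λ m → sub (there m))

    nth-root : ∀ {bs g a} → (prodLin bs *ₚ g) ≋ xⁿ-1 n → a ∈ bs → pow a n ≈ 1#
    nth-root {bs} {g} {a} e m = sub≈0 (begin
      pow a n - 1#                       ≈⟨ sym (Ev.eval-xⁿ-1 a n) ⟩
      evalAt a (xⁿ-1 n)                  ≈⟨ sym (Ev.eval-cong a e) ⟩
      evalAt a (prodLin bs *ₚ g)         ≈⟨ Ev.eval-* a (prodLin bs) g ⟩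
      evalAt a (prodLin bs) * evalAt a g ≈⟨ *-congʳ (member-root m) ⟩
      0# * evalAt a g                    ≈⟨ zeroˡ _ ⟩
      0#                                 ∎)

    module _ (s : ℕ) (ss : (s ℕ.* s) % n ≡ 1 % n) where
      private
        _^s : Carrier → Carrier
        a ^s = pow a s

      members : ∀ as → All (_∈ as) as
      members as = All.tabulateₛ setoid (λ m → m)

      private
        -- Distinctness of the bs survives a ↦ a^s, as this map is involutive on n-th roots of unity.
        powers-divide : ∀ bs g h → (prodLin bs *ₚ g) ≋ xⁿ-1 n →
                        (∀ {b} → b ∈ bs → evalAt (b ^s) h ≈ 0#) → ∃ λ k → h ≋ (prodLin (map _^s bs) *ₚ k)
        powers-divide bs g h e to-h = distinct-roots-divide (map _^s bs) h
          (AllPairsₚ.map⁺ (restrict bs (λ m → m) (distinct bs g e)))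
          (Allₚ.map⁺ (All.map to-h (members bs)))
          where
          restrict : ∀ cs → (∀ {x} → x ∈ cs → x ∈ bs) → Distinct cs → AllPairs (λ a b → ¬ (a ^s ≈ b ^s)) cs
          restrict []       sub []       = []
          restrict (c ∷ cs) sub (d ∷ ds) =
            All.zipWith (λ {c'} (ne , m) eq → ne (trans (sym (pow-involution {c} (nth-root {bs} {g} e (sub (here refl))) {s} ss))
              (trans (pow-cong eq s) (pow-involution {c'} (nth-root {bs} {g} e (sub (there m))) {s} ss)))) (d , members cs)
            ∷ restrict cs (λ m → sub (there m)) ds

      -- The product over the s-th powers of either list divides the product over the other list.
      -- Hence both lists have the same length, and the monic cofactor is 1.
      powers-split : ∀ bs cs g g' → (prodLin bs *ₚ g) ≋ xⁿ-1 n → (prodLin cs *ₚ g') ≋ xⁿ-1 n →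
        (∀ {b} → b ∈ bs → evalAt (b ^s) (prodLin cs) ≈ 0#) →
        (∀ {c} → c ∈ cs → evalAt (c ^s) (prodLin bs) ≈ 0#) →
        prodLin cs ≋ prodLin (map _^s bs)
      powers-split bs cs g g' e e' bc cb
        with powers-divide bs g (prodLin cs) e bc | powers-divide cs g' (prodLin bs) e' cb
      ... | k , q | k' , q'
        with monic-cofactor 1≉0 (monic-prodLin (map _^s bs)) (monic-prodLin cs) (P.sym q)
           | monic-cofactor 1≉0 (monic-prodLin (map _^s cs)) (monic-prodLin bs) (P.sym q')
      ... | zero , _ , M | _ = P.trans q (P.trans (P.*-congˡ {prodLin (map _^s bs)} (monic0 M)) (P.*-identityʳ _))
      ... | suc l , eq , _ | l' , eq' , _ = ⊥-elim (ℕₚ.<-irrefl ≡.refl (ℕₚ.<-≤-trans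
            (≡.subst (length bs <_) (≡.sym (≡.trans eq (≡.cong (ℕ._+ suc l) (Listₚ.length-map _^s bs)))) (ℕₚ.m<m+n (length bs) (s≤s z≤n)))
            (≡.subst (length cs ≤_) (≡.sym (≡.trans eq' (≡.cong (ℕ._+ l') (Listₚ.length-map _^s cs)))) (ℕₚ.m≤m+n (length cs) l'))))

-- Divisibility conditions turned into statements on roots in K.

eval-compose : ∀ {R S : CR} (h : Hom R S) s t p → CommutativeRing._≈_ S
  (eval h t (eval (constHom R) (Poly.xpow R s) p)) (eval h (Poly.pow S t s) p)
eval-compose {R} {S} h s t = Evaluation.eval-unique h (Poly.pow S t s)
  (evalHom h t ∘ʰ evalHom (constHom R) (Poly.xpow R s))
  (λ a → trans (Evaluation.eval-cong h t (Evaluation.eval-const (constHom R) (Poly.xpow R s) a)) (Evaluation.eval-const h t a))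
  (trans (Evaluation.eval-cong h t (Evaluation.eval-X (constHom R) (Poly.xpow R s))) (Evaluation.eval-xpow h t s))
  where open CommutativeRing S

eval-id∘ : ∀ {R S : CR} (h : Hom R S) t p → CommutativeRing._≈_ S (eval (idHom S ∘ʰ h) t p) (eval h t p)
eval-id∘ {R} {S} h t []      = CommutativeRing.refl S
eval-id∘ {R} {S} h t (a ∷ p) = CommutativeRing.+-congˡ S (CommutativeRing.*-congˡ S (eval-id∘ h t p))

evalAt-map : ∀ {R S : CR} (h : Hom R S) t p → CommutativeRing._≈_ S (Roots.evalAt S t (map (Hom.⟦_⟧ h) p)) (eval h t p)
evalAt-map {R} {S} h t p = CommutativeRing.trans S (MapPolynomial.eval-map h (idHom S) t p) (eval-id∘ h t p)

module StarConstruction (F : FiniteField) (K : Field)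
    (ι : Hom (FiniteField.commRing F) (Field.commRing K))
    (n : ℕ) .{{nz : NonZero n}} (cn : FiniteField.Carrier F)
    (cn-eq : IsNegInverse (FiniteField.commRing F) n cn)
    (rs : List (Field.Carrier K))
    (splits : PolynomialRing._≋_ (Field.commRing K) (Poly.xⁿ-1 (Field.commRing K) n) (Poly.prodLin (Field.commRing K) rs))
    (s : ℕ) (ss : (s ℕ.* s) % n ≡ 1 % n)
    (splitting : SplittingTower.Splitting F K ι n cn cn-eq rs splits) where
  private
    module F = FiniteField F
    module K = Field K
    module PF = Poly F.commRing
    module PK = Poly K.commRing
  open SplittingTower F K ι n cn cn-eq rs splits using (cn-hom; module Splitting)
  open Splitting splitting
  private
    module L = FiniteField L
    module PL = Poly L.commRing
    module LP = CommutativeRing (polyRing L.commRing)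
    module KP = CommutativeRing (polyRing K.commRing)
    module I = MapPolynomial into
    module J = MapPolynomial onto
  open PolynomialRing F.commRing using () renaming (_≋_ to _≋F_; at to atF)
  open PolynomialRing L.commRing using () renaming (_≋_ to _≋L_)
  open PolynomialRing K.commRing using () renaming (_≋_ to _≋K_; mk≋ to mkK; at to atK)
  open Divisibility (polyRing F.commRing)
  open SplitField L.field′ L._≟_
  open LinearFactors L.commRing
  open Involution F.commRing K.commRing ι s using (IsStarS; SelfInvolutive)

  cnL : L.Carrier
  cnL = Hom.⟦_⟧ into cn

  compose : PF.Pol → PF.Pol
  compose = eval (constHom F.commRing) (PF.xpow s)

  record RootsInL (f : PF.Pol) : Set where
    field
      bs       : List L.Carrier
      cof      : PL.Pol
      f≋       : I.mapₚ f ≋L PL.prodLin bs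
      divides-N  : (PL.prodLin bs PL.*ₚ cof) ≋L PL.xⁿ-1 n
  open RootsInL

  rootsInL : ∀ {m f} → Degree.MonicOfDegree F.commRing m f → f ∣ PF.xⁿ-1 n → RootsInL f
  rootsInL {m} {f} M (g by e) = record
    { bs = proj₁ sf ; cof = I.mapₚ g ; f≋ = proj₂ sf
    ; divides-N = LP.trans (LP.*-congʳ {I.mapₚ g} (LP.sym (proj₂ sf))) fg }
    where
    fg : (I.mapₚ f PL.*ₚ I.mapₚ g) ≋L PL.xⁿ-1 n
    fg = LP.trans (LP.sym (I.map-* f g)) (LP.trans (I.map-cong e) (I.map-xⁿ-1 n))
    sf = split-factor roots (I.mapₚ f) (I.mapₚ g) (monic-map into M) (LP.trans fg (LP.sym split))

  map-into-onto : ∀ f → J.mapₚ (I.mapₚ f) ≋K map (Hom.⟦_⟧ ι) f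
  map-into-onto []      = KP.refl
  map-into-onto (a ∷ f) = PolynomialRing.∷-cong K.commRing (factors a) (map-into-onto f)

  in-K : ∀ {f bs} → I.mapₚ f ≋L PL.prodLin bs → map (Hom.⟦_⟧ ι) f PK.≈ₚ PK.prodLin (map (Hom.⟦_⟧ onto) bs)
  in-K {f} {bs} e = atK (KP.trans (KP.sym (map-into-onto f)) (KP.trans (J.map-cong e) (J.map-prodLin bs)))

  -- At a root b of f the value of h(x^s) is h(b^s), and it is a multiple of f(b) = 0.
  root-power : ∀ {f h} (A : RootsInL f) (B : RootsInL h) → f ∣ compose h →
               ∀ {b} → b PL.∈ bs A → Roots.evalAt L.commRing (PL.pow b s) (PL.prodLin (bs B)) L.≈ L.0#
  root-power {f} {h} A B (w by e) {b} m = begin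
    evalAt (PL.pow b s) (PL.prodLin (bs B))     ≈⟨ Evaluation.eval-cong (idHom L.commRing) (PL.pow b s) (LP.sym (f≋ B)) ⟩
    evalAt (PL.pow b s) (I.mapₚ h)              ≈⟨ evalAt-map into (PL.pow b s) h ⟩
    eval into (PL.pow b s) h                    ≈⟨ L.sym (eval-compose into s b h) ⟩
    eval into b (compose h)                     ≈⟨ Evaluation.eval-cong into b {compose h} {f PF.*ₚ w} (CommutativeRing.sym (polyRing F.commRing) e) ⟩
    eval into b (f PF.*ₚ w)                     ≈⟨ Evaluation.eval-* into b f w ⟩
    eval into b f L.* eval into b w             ≈⟨ L.*-congʳ (L.sym (evalAt-map into b f)) ⟩
    evalAt b (I.mapₚ f) L.* eval into b w       ≈⟨ L.*-congʳ (L.trans (Evaluation.eval-cong (idHom L.commRing) b (f≋ A)) (member-root m)) ⟩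
    L.0# L.* eval into b w                      ≈⟨ L.zeroˡ _ ⟩
    L.0#                                        ∎
    where
    open Roots L.commRing using (evalAt)
    open import Relation.Binary.Reasoning.Setoid L.setoid

  selfInvolutive : ∀ {m f} → Degree.MonicOfDegree F.commRing m f → f ∣ PF.xⁿ-1 n → f ∣ compose f → SelfInvolutive f
  selfInvolutive {m} {f} M d c = map J (bs A) , in-K {f} {bs A} (f≋ A) , closed , onto-powers
    where
    A = rootsInL M d
    J : L.Carrier → K.Carrier
    J = Hom.⟦_⟧ onto
    powers : ∀ {b} → b PL.∈ bs A → PL.pow b s PL.∈ bs A
    powers m = root-member (bs A) (root-power A A c m)
    J-mem : ∀ {b as} → b PL.∈ as → J b PK.∈ map J as
    J-mem m = Anyₚ.map⁺ (Any.map (Hom.cong onto) m)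
    -- Membership in K is traced back to L, where the closure under s-th powers is proved.
    preimage : ∀ {a} as → a PK.∈ map J as → ∃ λ b → b PL.∈ as × a K.≈ J b
    preimage (b ∷ as) (here e)  = b , here L.refl , e
    preimage (b ∷ as) (there m) with preimage as m
    ... | b' , m' , e = b' , there m' , e
    mem-resp : ∀ {a b as} → a K.≈ b → b PK.∈ as → a PK.∈ as
    mem-resp e = Any.map (K.trans e)
    closed : ∀ a → a PK.∈ map J (bs A) → PK.pow a s PK.∈ map J (bs A)
    closed a m = let (b , m' , e) = preimage (bs A) m in mem-resp (K.trans (Powers.pow-cong K.commRing e s) (K.sym (HomProperties.pow-hom onto b s))) (J-mem (powers m'))
    onto-powers : ∀ a → a PK.∈ map J (bs A) → ∃ λ b → b PK.∈ map J (bs A) × PK.pow b s K.≈ a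
    -- For a = J b the witness is the image of b^s, because (b^s)^s = b for an n-th root of unity.
    onto-powers a m = let (b , m' , e) = preimage (bs A) m in J (PL.pow b s) , J-mem (powers m') ,
          K.trans (K.sym (HomProperties.pow-hom onto (PL.pow b s) s))
            (K.trans (Hom.cong onto (Powers.pow-involution L.commRing {b} (nth-root n cnL (cn-hom into) {bs A} {cof A} (divides-N A) m') {s} ss)) (K.sym e))

  starS : ∀ {m k f h} → Degree.MonicOfDegree F.commRing m f → Degree.MonicOfDegree F.commRing k h → PF.Monic h →
          f ∣ PF.xⁿ-1 n → h ∣ PF.xⁿ-1 n → f ∣ compose h → h ∣ compose f → IsStarS f h
  starS {m} {k} {f} {h} Mf Mh monic df dh fh hf = monic , map J (bs A) , in-K {f} {bs A} (f≋ A) ,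
      atK (KP.trans (mkK {map (Hom.⟦_⟧ ι) h} {PK.prodLin (map J (map (λ a → PL.pow a s) (bs A)))} (in-K {h} {map (λ a → PL.pow a s) (bs A)} (LP.trans (f≋ B) (powers-split n cnL (cn-hom into) s ss (bs A) (bs B) (cof A) (cof B) (divides-N A) (divides-N B)
           (root-power A B fh) (root-power B A hf))))) (prodLin-cong (bs A)))
    where
    J : L.Carrier → K.Carrier
    J = Hom.⟦_⟧ onto
    A = rootsInL Mf df
    B = rootsInL Mh dh
    prodLin-cong : ∀ as → PK.prodLin (map J (map (λ a → PL.pow a s) as)) ≋K PK.prodLin (map (λ a → PK.pow a s) (map J as))
    prodLin-cong []       = KP.refl
    prodLin-cong (a ∷ as) = KP.*-cong {PK.linear (J (PL.pow a s))} {PK.linear (PK.pow (J a) s)}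
      (PolynomialRing.∷-cong K.commRing (K.-‿cong (HomProperties.pow-hom onto a s)) KP.refl) (prodLin-cong as)

-- Orders of n-th roots of unity and the exponent d.

module UnityOrders (R : CR) where
  open CommutativeRing R
  open Poly R using (pow)
  open Powers R

  -- A Bézout identity in natural numbers has the form d + y n = x m or its mirror image, so a^d
  -- times 1 equals 1.
  pow-gcd : ∀ {a m n d} → GCD m n d → pow a m ≈ 1# → pow a n ≈ 1# → pow a d ≈ 1#
  pow-gcd {a} {m} {n} {d} G em en = go (Bézout.identity G)
    where
    cancel : ∀ x y → pow a x ≈ 1# → pow a y ≈ 1# → d ℕ.+ x ≡ y → pow a d ≈ 1#
    cancel x y ex ey eq = trans (sym (*-identityʳ _)) (trans (*-congˡ (sym ex))
      (trans (sym (pow-+ a d x)) (trans (reflexive (≡.cong (pow a) eq)) ey)))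
    go : Bézout.Identity d m n → pow a d ≈ 1#
    go (Bézout.+- x y eq) = cancel (y ℕ.* n) (x ℕ.* m) (pow-multiple {a} {n} en y) (pow-multiple {a} {m} em x) eq
    go (Bézout.-+ x y eq) = cancel (x ℕ.* m) (y ℕ.* n) (pow-multiple {a} {m} em x) (pow-multiple {a} {n} en y) eq

  -- By a^n = 1 the element a has the inverse a^(n-1), which cancels one factor in a^s = a.
  pow-pred : ∀ {a n} s .{{_ : NonZero n}} → pow a n ≈ 1# → pow a s ≈ a → pow a (s ∸ 1) ≈ 1#
  -- For s = 0 truncated subtraction leaves the exponent 0.
  pow-pred zero    en es = refl
  pow-pred {a} {suc n} (suc t) en es = trans (sym (*-identityˡ _)) (trans (*-congʳ (sym inv))
    (trans (*-assoc _ _ _) (trans (*-congˡ es) inv)))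
    where
    inv : pow a n * a ≈ 1#
    inv = trans (*-comm _ _) en

  pow-fixed : ∀ {a n d} s .{{_ : NonZero n}} → (s ℕ.* s) % n ≡ 1 % n → GCD n (s ∸ 1) d → pow a d ≈ 1# → pow a s ≈ a
  pow-fixed {a} {n} {d} s ss G e = go s ss (GCD.gcd∣m G) (GCD.gcd∣n G)
    where
    go : ∀ s → (s ℕ.* s) % n ≡ 1 % n → d ∣ℕ n → d ∣ℕ (s ∸ 1) → pow a s ≈ a
    -- For s = 0 the congruence reads 0 ≡ 1 mod n, and exponents may be reduced modulo n because a^d
    -- = 1 with d dividing n gives a^n = 1.
    go zero    ss (divides q eq) _ = trans (pow-mod-cong {a} {n}
      (trans (reflexive (≡.cong (pow a) eq)) (pow-multiple {a} {d} e q)) {0} {1} ss) (*-identityʳ a)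
    go (suc t) ss _ (divides q eq) = trans (*-congˡ (trans (reflexive (≡.cong (pow a) eq)) (pow-multiple {a} {d} e q))) (*-identityʳ a)

-- Primitive central idempotents attached to irreducible factors of xⁿ - 1.

module PrimitiveIdempotents (F : FiniteField) (n : ℕ) .{{nz : NonZero n}} (s : ℕ) (ss : (s ℕ.* s) % n ≡ 1 % n)
    (d : ℕ) (d-gcd : GCD n (s ∸ 1) d)
    (cn : FiniteField.Carrier F)
    (cn-eq : IsNegInverse (FiniteField.commRing F) n cn) where
  open FiniteField F using (field′; _≟_; search; commRing; Carrier; 0#; 1#; 1≉0)
  open Poly commRing
  open PolynomialRing commRing
  open Degree commRing
  open Derivative commRing
  open DiscreteField field′ _≟_
  open Divisibility (polyRing commRing)
  open CyclicQuotient commRing n s ss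
  private
    module P = CommutativeRing (polyRing commRing)
    module Q = CommutativeRing Rₙ
  open IntegerSolver (polyRing commRing)
  module S = Hom composeHom

  N : Pol
  N = xⁿ-1 n

  module Mod (f : Pol) = Quotient (polyRing commRing) f

  ∣xᵏ-1⇒ : ∀ {f} k → f ∣ xⁿ-1 k → Mod._≈/_ f (Poly.pow (Mod.quotient f) X k) oneₚ
  ∣xᵏ-1⇒ {f} k p = Qf.trans (Qf.sym (HomProperties.pow-hom (Mod.π f) X k))
    (Mod.mk/ (∣-respʳ (P.+-congʳ {negₚ oneₚ} (xpow≋pow k)) p))
    where module Qf = CommutativeRing (Mod.quotient f)

  ⇒∣xᵏ-1 : ∀ {f} k → Mod._≈/_ f (Poly.pow (Mod.quotient f) X k) oneₚ → f ∣ xⁿ-1 k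
  ⇒∣xᵏ-1 {f} k p = ∣-respʳ (P.+-congʳ {negₚ oneₚ} (P.sym (xpow≋pow k)))
    (Mod.un/ (Qf.trans (HomProperties.pow-hom (Mod.π f) X k) p))
    where module Qf = CommutativeRing (Mod.quotient f)

  ∣xᵏ-1-multiple : ∀ {f} k q → f ∣ xⁿ-1 k → f ∣ xⁿ-1 (q ℕ.* k)
  ∣xᵏ-1-multiple {f} k q p = ⇒∣xᵏ-1 (q ℕ.* k) (Powers.pow-multiple (Mod.quotient f) {X} {k} (∣xᵏ-1⇒ k p) q)

  xᵈ-1∣N : xⁿ-1 d ∣ N
  xᵈ-1∣N = let (divides q eq) = GCD.gcd∣m d-gcd in
    ≡.subst (λ k → xⁿ-1 d ∣ xⁿ-1 k) (≡.sym eq) (∣xᵏ-1-multiple d q (∣-refl {xⁿ-1 d}))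

  private
    compose-X : compose X ≋ Poly.pow (polyRing commRing) X s
    compose-X = P.trans E.eval-X (xpow≋pow s)

  -- In F[x]/(f) the hypotheses say X^n = 1 and X^s = X, so the order of X divides n and s - 1,
  -- hence d.
  moved⇒∣xᵈ-1 : ∀ {f} → f ∣ N → f ∣ (compose X +ₚ negₚ X) → f ∣ xⁿ-1 d
  moved⇒∣xᵈ-1 {f} fN p = ⇒∣xᵏ-1 d (UnityOrders.pow-gcd (Mod.quotient f) {X} {n} {s ∸ 1} d-gcd Xn
      (UnityOrders.pow-pred (Mod.quotient f) {X} {n} s Xn
        (Qf.trans (Qf.sym (HomProperties.pow-hom (Mod.π f) X s)) (Mod.mk/ (∣-respʳ (P.+-congʳ {negₚ X} compose-X) p)))))
    where
    module Qf = CommutativeRing (Mod.quotient f)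
    Xn = ∣xᵏ-1⇒ n fN

  -- Once X^s = X holds in F[x]/(f), the substitution and the identity agree there by the universal
  -- property.
  ∣xᵈ-1⇒fixed : ∀ {f} → f ∣ xⁿ-1 d → ∀ c → f ∣ (compose c +ₚ negₚ c)
  ∣xᵈ-1⇒fixed {f} p c = Mod.un/ (Qf.trans
      (unique (Mod.π f ∘ʰ composeHom) (λ a → Mod.≈⇒≈/ f (E.eval-const a)) Xs c)
      (Qf.sym (unique (Mod.π f) (λ _ → Qf.refl) Qf.refl c)))
    where
    module Qf = CommutativeRing (Mod.quotient f)
    unique = Evaluation.eval-unique (Mod.π f ∘ʰ constHom commRing) X
    Xs : Mod._≈/_ f (compose X) X
    Xs = Qf.trans (Mod.≈⇒≈/ f compose-X) (Qf.trans (HomProperties.pow-hom (Mod.π f) X s)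
      (UnityOrders.pow-fixed (Mod.quotient f) {X} {n} s ss d-gcd (∣xᵏ-1⇒ d p)))

  -- e is the idempotent polynomial e_f of the factor f of xⁿ - 1.
  record IsE (f e : Pol) : Set where
    field
      g    : Pol
      fg   : (f *ₚ g) ≋ N
      g∣e  : g ∣ e
      f∣e-1 : f ∣ (e +ₚ negₚ oneₚ)
  open IsE public

  efPoly-IsE : ∀ {f g} → Monic f → (f *ₚ g) ≋ N → IsE f (efPoly cn f g)
  efPoly-IsE {f} {g} m e = record { g = g ; fg = e ; g∣e = g∣ef cn f g ; f∣e-1 = f∣ef-1 n cn cn-eq m e }

  f∣N : ∀ {f e} → IsE f e → f ∣ N
  f∣N I = g I by fg I

  N∣⇒ : ∀ {f a} → f ∣ N → a ≈/ [] → f ∣ a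
  N∣⇒ fN z = ∣-trans fN (≈/0⇒∣ z)

  -- Here f g divides e a because g divides e. With the converse `e-kills⁻¹`, which rests on e ≡ 1
  -- mod f, multiplication by e becomes a test for divisibility by f and replaces the projection of
  -- R onto F[x]/(f).
  e-kills : ∀ {f e a} → IsE f e → f ∣ a → (e *ₚ a) ≈/ []
  e-kills {f} {e} {a} I fa = ∣⇒≈/0 (∣-respˡ (fg I) (∣-respʳ (P.*-comm a e) (∣*∣ fa (g∣e I))))

  e-kills⁻¹ : ∀ {f e a} → IsE f e → (e *ₚ a) ≈/ [] → f ∣ a
  e-kills⁻¹ {f} {e} {a} I z = ∣-respʳ
    (solve 2 (λ e a → e :* a :- (e :- :1) :* a := a) ≋-refl e a)
    (∣- (N∣⇒ (f∣N I) z) (∣*ʳ a (f∣e-1 I)))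

  e-absorbs : ∀ {f e a b} → IsE f e → f ∣ (a +ₚ negₚ b) → (e *ₚ a) ≈/ (e *ₚ b)
  e-absorbs {f} {e} {a} {b} I p = mk/ (∣-respʳ
    (solve 3 (λ e a b → e :* (a :- b) := e :* a :- e :* b) ≋-refl e a b) (≈/0⇒∣ (e-kills I p)))

  e-idem : ∀ {f e} → IsE f e → (e *ₚ e) ≈/ e
  e-idem {f} {e} I = Q.trans (e-absorbs I (f∣e-1 I)) (≈⇒≈/ (P.*-identityʳ e))

  -- For an idempotent a the prime f divides a (a - 1), so a is 0 or 1 on the component of f.
  e-atom : ∀ {f e} → IsE f e → Irr f → Atom e
  e-atom {f} {e} I irr = record
    { idem = e-idem I
    ; ≉0   = λ z → ∤1 irr (e-kills⁻¹ I (Q.trans (≈⇒≈/ (P.*-identityʳ e)) z))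
    ; atom = λ a ea aa → Sum.map
        (λ p → Q.trans (Q.sym ea) (e-kills I p))
        (λ p → Q.trans (Q.sym ea)
                 (Q.trans (e-absorbs I p) (≈⇒≈/ (P.*-identityʳ e))))
        (irreducible-prime irr a (a +ₚ negₚ oneₚ) (∣-respʳ
          (solve 1 (λ a → a :* a :- a := a :* (a :- :1)) ≋-refl a) (∣-trans (f∣N I) (un/ aa)))) }

  compose-∣ : ∀ {p q} → p ∣ q → compose p ∣ compose q
  compose-∣ = hom-∣ composeHom

  ∣compose-1 : ∀ {f h e} → f ∣ compose h → h ∣ (e +ₚ negₚ oneₚ) → f ∣ (compose e +ₚ negₚ oneₚ)
  ∣compose-1 {f} {h} {e} p q = ∣-respʳ
    (P.trans (HomProperties.sub-hom composeHom e oneₚ) (P.+-congˡ {compose e} (P.-‿cong S.1-hom)))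
    (∣-trans p (compose-∣ q))

  -- Since σ(e_h) ≡ 1 mod f, one has e_f σ(e_h) = e_f. By symmetry e_h σ(e_f) = e_h, and applying
  -- the involution σ turns this into σ(e_h) e_f = σ(e_h).
  σ-e : ∀ {f h ef eh} → IsE f ef → IsE h eh → f ∣ compose h → h ∣ compose f → compose eh ≈/ ef
  σ-e {f} {h} {ef} {eh} If Ih fh hf = Q.trans
      (Q.sym up) down
    where
    down : (ef *ₚ compose eh) ≈/ ef
    down = Q.trans (e-absorbs If (∣compose-1 {f} {h} {eh} fh (f∣e-1 Ih))) (≈⇒≈/ (P.*-identityʳ ef))
    down' : (eh *ₚ compose ef) ≈/ eh
    down' = Q.trans (e-absorbs Ih (∣compose-1 {h} {f} {ef} hf (f∣e-1 If))) (≈⇒≈/ (P.*-identityʳ eh))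
    up : (ef *ₚ compose eh) ≈/ compose eh
    up = Q.trans
      (Q.trans (≈⇒≈/ (P.*-comm ef (compose eh)))
        (Q.*-congˡ {compose eh} {ef} {compose (compose ef)} (Q.sym (σσ ef))))
      (Q.trans
        (≈⇒≈/ (P.sym (S.*-hom eh (compose ef)))) (Hom.cong σ {eh *ₚ compose ef} {eh} down'))

  -- The element moved is `X`: f does not divide x^s - x by `moved⇒∣xᵈ-1`, so x^s - x is invertible
  -- modulo the irreducible f.
  e-moves : ∀ {f e} → IsE f e → Irr f → ¬ (f ∣ xⁿ-1 d) → Moves e
  e-moves {f} {e} I irr nd = [ (λ p → ⊥-elim (nd (moved⇒∣xᵈ-1 (f∣N I) p))) , (λ (u , v , q) → moves X v (go u v q)) ]′
      (irreducible-dichotomy irr (compose X +ₚ negₚ X))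
    where
    go : ∀ u v → (u *ₚ f +ₚ v *ₚ (compose X +ₚ negₚ X)) ≋ oneₚ → (v *ₚ (compose X +ₚ negₚ X) *ₚ e) ≈/ e
    go u v q = Q.trans (≈⇒≈/ (P.*-comm (v *ₚ m) e))
      (Q.trans (e-absorbs I (negₚ u by P.trans
        (solve 3 (λ f u w → f :* (:- u) := w :- (u :* f :+ w)) ≋-refl f u (v *ₚ m))
        (P.+-congˡ {v *ₚ m} (P.-‿cong q)))) (≈⇒≈/ (P.*-identityʳ e)))
      where m = compose X +ₚ negₚ X

  ∣xᵈ-1⇒σ-e : ∀ {f e} → IsE f e → f ∣ xⁿ-1 d → compose e ≈/ e
  ∣xᵈ-1⇒σ-e {f} {e} I fd = σ-e I I ff ff
    where
    ff : f ∣ compose f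
    ff = ∣-respʳ (solve 2 (λ a b → a :- b :+ b := a) ≋-refl (compose f) f) (∣+ (∣xᵈ-1⇒fixed fd f) ∣-refl)

  pci-case₁ : ∀ {f e} → IsE f e → Irr f → f ∣ xⁿ-1 d → ∀ {h t} → (h +ₚ h) ≋ oneₚ → compose h ≋ h →
              (t *ₚ t) ≋ oneₚ → compose t ≋ t → PCI (h *ₚ e , t *ₚ (h *ₚ e))
  pci-case₁ {f} {e} I irr fd 2h Sh tt St = pci-split (e-atom I irr)
    (λ c → e-absorbs I (∣xᵈ-1⇒fixed fd c)) (∣xᵈ-1⇒σ-e I fd) (≈⇒≈/ 2h) (≈⇒≈/ Sh) (≈⇒≈/ tt) (≈⇒≈/ St)

  pci-case₂ : ∀ {f e} → IsE f e → Irr f → ¬ (f ∣ xⁿ-1 d) → f ∣ compose f → PCI (e , [])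
  pci-case₂ I irr nd ff = pci-fixed (e-atom I irr) (σ-e I I ff ff) (e-moves I irr nd)

  associates : ∀ {m f h} → MonicOfDegree m h → Irr f → Irr h → Monic f → f ∣ h → f ≋ h
  associates {m} {f} {h} Mh If Ih mf (w by e) = [ (λ u → ⊥-elim (∤1 If u)) , unit ]′ (no-split Ih f w e)
    where
    Mw = monic-cofactor 1≉0 (proj₂ (Monic⇒ mf)) Mh e
    unit : w ∣ oneₚ → f ≋ h
    unit (w' by q) = go (proj₁ Mw) (proj₂ (proj₂ Mw))
      where
      go : ∀ k → MonicOfDegree k w → f ≋ h
      go zero    M = P.trans (P.sym (P.*-identityʳ f)) (P.trans (P.*-congˡ {f} (P.sym (monic0 M))) e)
      go (suc k) M = ⊥-elim (absurd (monic-cofactor 1≉0 M monic-one q))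
        where
        absurd : (∃ λ k' → 0 ≡ suc k ℕ.+ k' × MonicOfDegree k' w') → ⊥
        absurd (_ , () , _)

  -- f divides xⁿ - 1, the product of h and its cofactor, and does not divide h; so it divides the
  -- cofactor and therefore e_h.
  orthogonal : ∀ {f h ef eh} → IsE f ef → IsE h eh → Irr f → Irr h → Monic f → Monic h → ¬ (f ≋ h) → (ef *ₚ eh) ≈/ []
  orthogonal {f} {h} If Ih irf irh mf mh ne = e-kills If ([ (λ p → ⊥-elim (ne (associates (proj₂ (Monic⇒ mh)) irf irh mf p))) ,
      (λ p → ∣-trans p (g∣e Ih)) ]′ (irreducible-prime irf h (g Ih) (∣-respʳ (P.sym (fg Ih)) (f∣N If))))

  pci-case₃ : ∀ {f h ef eh} → IsE f ef → IsE h eh → Irr f → Irr h → Monic f → Monic h → ¬ (f ≋ h) →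
              ¬ (f ∣ xⁿ-1 d) → f ∣ compose h → h ∣ compose f → PCI (ef +ₚ eh , [])
  pci-case₃ If Ih irf irh mf mh ne nd fh hf = pci-swapped (e-atom If irf) (σ-e Ih If hf fh) (σ-e If Ih fh hf)
    (orthogonal If Ih irf irh mf mh ne) (e-moves If irf nd)

  -- By separability f is comaximal with its cofactor in xⁿ - 1, and x^d - 1 divides that cofactor.
  quotient-factor⇒¬∣ : ∀ {f q} → Irr f → (q *ₚ xⁿ-1 d) ≋ N → f ∣ q → ¬ (f ∣ xⁿ-1 d)
  quotient-factor⇒¬∣ {f} {q} irr e (w by fw) fd = ∤1 irr (∣-respʳ (proj₂ (proj₂ B))
      (∣+ (m∣*m {f} (proj₁ B)) (∣*ˡ (proj₁ (proj₂ B)) (∣*ˡ w fd))))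
    where
    fwd : (f *ₚ (w *ₚ xⁿ-1 d)) ≋ N
    fwd = P.trans (P.sym (P.*-assoc f w (xⁿ-1 d))) (P.trans (P.*-congʳ {xⁿ-1 d} fw) e)
    B = bezout-cofactor n cn cn-eq {f} {w *ₚ xⁿ-1 d} fwd

  ¬∣⇒quotient-factor : ∀ {f} → Irr f → f ∣ N → ¬ (f ∣ xⁿ-1 d) → ∃ λ q → ((q *ₚ xⁿ-1 d) ≋ N) × (f ∣ q)
  ¬∣⇒quotient-factor {f} irr fN nd = q , eq ,
      [ (λ p → p) , (λ p → ⊥-elim (nd p)) ]′ (irreducible-prime irr q (xⁿ-1 d) (∣-respʳ (P.sym eq) fN))
    where
    q = cofactor xᵈ-1∣N
    eq : (q *ₚ xⁿ-1 d) ≋ N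
    eq = P.trans (P.*-comm q (xⁿ-1 d)) (product xᵈ-1∣N)

  record Conjugate (f : Pol) : Set where
    field
      h     : Pol
      monic : Monic h
      irr-h : Irr h
      h∣N   : h ∣ N
      f∣σh  : f ∣ compose h
      h∣σf  : h ∣ compose f

  ∣σσ : ∀ {p q} → p ∣ N → p ∣ compose (compose q) → p ∣ q
  ∣σσ {p} {q} pN z = ∣-respʳ (solve 2 (λ a b → a :- (a :- b) := b) ≋-refl (compose (compose q)) q)
    (∣- z (∣-trans pN (un/ (σσ q))))

  ∣σσ⁻¹ : ∀ {p q} → p ∣ N → p ∣ q → p ∣ compose (compose q)
  ∣σσ⁻¹ {p} {q} pN z = ∣-respʳ (solve 2 (λ a b → a :- b :+ b := a) ≋-refl (compose (compose q)) q)
    (∣+ (∣-trans pN (un/ (σσ q))) z)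

  -- f^{*_s} is the greatest common divisor of f(x^s) and xⁿ - 1.
  conjugate : ∀ {f} → Irr f → f ∣ N → Conjugate f
  conjugate {f} irr fN = build (normalise (length G) G (deg<-length G))
    where
    module B = Bezout (bezout (compose f) N)
    G = B.common
    build : G ≋ [] ⊎ Normalised G (length G) → Conjugate f
    build (inj₁ z) = ⊥-elim (monic≉0 (monic-xⁿ-1 n) (P.trans (P.sym (product B.common∣q)) (*ₚ-congʳ (cofactor B.common∣q) z)))
    build (inj₂ Nm) = record
      { h = h ; monic = proj₁ (proj₂ list) ; irr-h = mkIrr (monic≉0 Mh) h∤1 h-split
      ; h∣N = ∣-trans h∣G B.common∣q ; f∣σh = f∣σh ; h∣σf = h∣σf }
      where
      list = ⇒Monic (Normalised.isMonic Nm)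
      h : Pol
      h = proj₁ list
      Mh : MonicOfDegree (Normalised.deg Nm) h
      Mh = monic-resp (proj₂ (proj₂ list)) (Normalised.isMonic Nm)
      h∣G : h ∣ G
      h∣G = ∣-respˡ (proj₂ (proj₂ list)) (normalised-∣ Nm)
      G∣h : G ∣ h
      G∣h = ∣-respʳ (proj₂ (proj₂ list)) (∣-normalised Nm)
      h∣σf : h ∣ compose f
      h∣σf = ∣-trans h∣G B.common∣p
      hN : h ∣ N
      hN = ∣-trans h∣G B.common∣q
      σN : f ∣ compose N
      σN = ∣-trans fN (≈/0⇒∣ (Hom.cong σ {N} {[]} (∣⇒≈/0 ∣-refl)))
      f∣σG : f ∣ compose G
      -- Substituting x^s in the Bézout combination for G gives a combination of f(x^(s²)),
      -- congruent to f modulo xⁿ - 1, and of a multiple of xⁿ - 1; f divides both.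
      f∣σG = ∣-respʳ (P.trans (P.sym (P.trans (S.+-hom (B.u *ₚ compose f) (B.v *ₚ N))
            (P.+-cong (S.*-hom B.u (compose f)) (S.*-hom B.v N)))) (S.cong B.combo))
          (∣+ (∣*ˡ (compose B.u) (∣σσ⁻¹ fN ∣-refl)) (∣*ˡ (compose B.v) σN))
      f∣σh : f ∣ compose h
      f∣σh = ∣-trans f∣σG (compose-∣ G∣h)
      h∤1 : ¬ (h ∣ oneₚ)
      h∤1 p = ∤1 irr (∣-respʳ S.1-hom (∣-trans f∣σh (compose-∣ p)))
      σ-up : ∀ p → f ∣ compose p → h ∣ p
      σ-up p z = ∣σσ hN (∣-trans h∣σf (compose-∣ z))
      cancel : ∀ p q → (p *ₚ q) ≋ h → h ∣ p → q ∣ oneₚ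
      cancel p q e (k by hk) = k by P.trans (P.*-comm q k) (monic-cancelˡ Mh (P.trans (P.sym (P.*-assoc h k q))
        (P.trans (P.*-congʳ {q} hk) (P.trans e (P.sym (P.*-identityʳ h))))))
      -- Irreducibility of h comes from primality of f: f divides h(x^s) = p(x^s) q(x^s), say
      -- p(x^s); substituting again shows that h divides p, and cancelling h makes q a unit.
      h-split : ∀ p q → (p *ₚ q) ≋ h → p ∣ oneₚ ⊎ q ∣ oneₚ
      h-split p q e = [ (λ z → inj₂ (cancel p q e (σ-up p z))) ,
          (λ z → inj₁ (cancel q p (P.trans (P.*-comm q p) e) (σ-up q z))) ]′
        (irreducible-prime irr (compose p) (compose q) (∣-respʳ (P.trans (S.cong (P.sym e)) (S.*-hom p q)) f∣σh))

  -- If h divided x^d - 1, then f(x^s) ≡ f mod h, so h would divide f, be associated to it, and make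
  -- f divide f(x^s).
  conjugate-¬∣ : ∀ {f h} → Irr f → Irr h → f ∣ N → h ∣ N → f ∣ compose h → h ∣ compose f → ¬ (f ∣ compose f) → ¬ (h ∣ xⁿ-1 d)
  conjugate-¬∣ {f} {h} irf irh fN hN fh hf nff hd = finish (h∣f)
    where
    h∣f : h ∣ f
    h∣f = ∣-respʳ (solve 2 (λ a b → a :- (a :- b) := b) ≋-refl (compose f) f) (∣- hf (∣xᵈ-1⇒fixed hd f))
    finish : h ∣ f → ⊥
    finish (w by e) = [ (λ u → ∤1 irh u) , (λ (w' by q) → nff (∣-trans (w' by P.trans (P.*-congʳ {w'} (P.sym e))
      (P.trans (P.*-assoc h w w') (P.trans (P.*-congˡ {h} q) (P.*-identityʳ h)))) hf)) ]′ (no-split irf h w e)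

  -- p and q are coprime because their product divides the separable xⁿ - 1.
  coprime-product-∣ : ∀ {p q a} → (p *ₚ q) ∣ N → p ∣ a → q ∣ a → (p *ₚ q) ∣ a
  coprime-product-∣ {p} {q} {a} (w by e) pa qa =
      go (bezout-cofactor n cn cn-eq {p} {q *ₚ w} (P.trans (P.sym (P.*-assoc p q w)) e))
    where
    go : (∃ λ u → ∃ λ v → (u *ₚ p +ₚ v *ₚ (q *ₚ w)) ≋ oneₚ) → (p *ₚ q) ∣ a
    go (u , v , uv) = ∣-respʳ {p *ₚ q} {p *ₚ a *ₚ u +ₚ q *ₚ a *ₚ (w *ₚ v)} {a}
      (P.trans (solve 6 (λ u v p q w a → p :* a :* u :+ q :* a :* (w :* v) := (u :* p :+ v :* (q :* w)) :* a) ≋-refl u v p q w a)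
        (P.trans (P.*-congʳ {a} uv) (P.*-identityˡ a)))
      (∣+ {p *ₚ q} {p *ₚ a *ₚ u} {q *ₚ a *ₚ (w *ₚ v)} (∣*ʳ {p *ₚ q} {p *ₚ a} u (∣*∣ {p} {p} ∣-refl qa))
        (∣*ʳ {p *ₚ q} {q *ₚ a} (w *ₚ v) (∣-respˡ {q *ₚ p} {p *ₚ q} {q *ₚ a} (P.*-comm q p) (∣*∣ {q} {q} ∣-refl pa))))

  open SearchableField field′ _≟_ search using (irreducible-factor)

  -- Expresses that a + b y is nonzero modulo the factor p of xⁿ - 1.
  Missed : Pol → Pol → Pol → Set
  Missed a b p = (p ∣ N) × (¬ ((p ∣ a) × (p ∣ b)))

  -- The descent starts from xⁿ - 1 itself, modulo which the element is nonzero; coprimality of the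
  -- two factors at each splitting hands the property on to one of them.
  component : ∀ a b → ¬ ((a , b) ≈ᴬ 0ᴬ) → ∃ λ f → Monic f × Irr f × f ∣ N × Missed a b f
  component a b nz0 = irreducible-factor (Missed a b)
      (λ {p} {q} e (x , y) → ∣-respˡ e x , λ (u , v) → y (∣-respˡ (P.sym e) u , ∣-respˡ (P.sym e) v))
      split {ℕ.pred n} {N} (≡.subst (λ k → MonicOfDegree k N) (≡.sym (ℕₚ.suc-pred n)) (monic-xⁿ-1 n))
      (∣-refl , λ (x , y) → nz0 (mkᴬ (∣⇒≈/0 x) (∣⇒≈/0 y)))
    where
    split : ∀ p q → Missed a b (p *ₚ q) → Missed a b p ⊎ Missed a b q
    split p q (pqN , no-both) = go ((p ∣? a) ×-dec (p ∣? b)) ((q ∣? a) ×-dec (q ∣? b))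
      where
      pN : p ∣ N
      pN = ∣-trans (m∣m* {p} q) pqN
      qN : q ∣ N
      qN = ∣-trans (m∣*m {q} p) pqN
      go : Dec ((p ∣ a) × (p ∣ b)) → Dec ((q ∣ a) × (q ∣ b)) → Missed a b p ⊎ Missed a b q
      go (no np)         _               = inj₁ (pN , np)
      go (yes _)         (no nq)         = inj₂ (qN , nq)
      go (yes (pa , pb)) (yes (qa , qb)) = ⊥-elim (no-both (coprime-product-∣ pqN pa qa , coprime-product-∣ pqN pb qb))

  ≈/[]? : ∀ p → Dec (p ≈/ [])
  ≈/[]? p = map′ ∣⇒≈/0 ≈/0⇒∣ (monic-∣? (monic-xⁿ-1 n) p)

  ≈ᴬ0? : ∀ z → Dec (z ≈ᴬ 0ᴬ)
  ≈ᴬ0? (a , b) = map′ (λ (x , y) → mkᴬ x y) (λ e → fst≈ e , snd≈ e) (≈/[]? a ×-dec ≈/[]? b)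

  -- The product has the coordinates a u and b u, as u is fixed by σ. If they vanished, multiplying
  -- by e, where e u = e, would give e a = e b = 0, and f would divide both a and b.
  pure-product≉0 : ∀ {a b f e u} → IsE f e → (e *ₚ u) ≈/ e → compose u ≈/ u → ¬ ((f ∣ a) × (f ∣ b)) → ¬ ((a , b) · (u , []) ≈ᴬ 0ᴬ)
  pure-product≉0 {a} {b} {f} {e} {u} I eu Su nb (mkᴬ x y) = nb
      (e-kills⁻¹ I (kill a (Q.trans
          (≈⇒≈/ (P.sym (P.trans (P.+-congˡ {a *ₚ u} (*ₚ-zeroʳ b)) (P.+-identityʳ _)))) x))
      , e-kills⁻¹ I (kill b (Q.trans
          (Q.trans (Q.*-congˡ {b} {u} {compose u} (Q.sym Su))
            (≈⇒≈/ (P.sym (P.+-congʳ {b *ₚ compose u} (*ₚ-zeroʳ a))))) y)))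
    where
    kill : ∀ c → (c *ₚ u) ≈/ [] → (e *ₚ c) ≈/ []
    kill c z = Q.trans (Q.*-congʳ {c} {e} {e *ₚ u} (Q.sym eu))
      (Q.trans
        (≈⇒≈/ (solve 3 (λ e u c → e :* u :* c := e :* (c :* u)) ≋-refl e u c))
        (Q.trans (Q.*-congˡ {e} {c *ₚ u} {[]} z) (≈⇒≈/ (*ₚ-zeroʳ e))))

  -- The first coordinates of the two products decide: their sum is e a, and t times their
  -- difference is e b, because 2h = 1 and t² = 1. So at least one sign gives a nonzero product.
  split-product≉0 : ∀ {a b f e h t t'} → IsE f e → (h +ₚ h) ≋ oneₚ → (t +ₚ t') ≋ [] → (t *ₚ t) ≋ oneₚ →
    compose (t *ₚ (h *ₚ e)) ≈/ (t *ₚ (h *ₚ e)) → compose (t' *ₚ (h *ₚ e)) ≈/ (t' *ₚ (h *ₚ e)) →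
    ¬ ((f ∣ a) × (f ∣ b)) → (a , b) · (h *ₚ e , t *ₚ (h *ₚ e)) ≈ᴬ 0ᴬ → (a , b) · (h *ₚ e , t' *ₚ (h *ₚ e)) ≈ᴬ 0ᴬ → ⊥
  split-product≉0 {a} {b} {f} {e} {h} {t} {t'} I 2h tt' tt Sy Sy' nb (mkᴬ p _) (mkᴬ q _) = nb
      (e-kills⁻¹ I (Q.trans
         (≈⇒≈/ (P.sym sum)) (Q.+-cong {a *ₚ x +ₚ b *ₚ y} {[]} {a *ₚ x +ₚ b *ₚ y'} {[]} p' q'))
      , e-kills⁻¹ I (Q.trans
         (≈⇒≈/ (P.sym diff)) (Q.trans
           (Q.*-congˡ {t} {(a *ₚ x +ₚ b *ₚ y) +ₚ negₚ (a *ₚ x +ₚ b *ₚ y')} {[]} (Q.+-cong {a *ₚ x +ₚ b *ₚ y} {[]} {negₚ (a *ₚ x +ₚ b *ₚ y')} {[]} p' (Q.-‿cong {a *ₚ x +ₚ b *ₚ y'} {[]} q'))) (≈⇒≈/ (*ₚ-zeroʳ t)))))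
    where
    x y y' : Pol
    x  = h *ₚ e
    y  = t *ₚ x
    y' = t' *ₚ x
    p' : (a *ₚ x +ₚ b *ₚ y) ≈/ []
    p' = Q.trans (Q.+-congˡ {a *ₚ x} {b *ₚ y} {b *ₚ compose y} (Q.*-congˡ {b} {y} {compose y} (Q.sym Sy))) p
    q' : (a *ₚ x +ₚ b *ₚ y') ≈/ []
    q' = Q.trans (Q.+-congˡ {a *ₚ x} {b *ₚ y'} {b *ₚ compose y'} (Q.*-congˡ {b} {y'} {compose y'} (Q.sym Sy'))) q
    sum : ((a *ₚ x +ₚ b *ₚ y) +ₚ (a *ₚ x +ₚ b *ₚ y')) ≋ (e *ₚ a)
    sum = P.trans (solve 6 (λ a b h e t t' → a :* (h :* e) :+ b :* (t :* (h :* e)) :+ (a :* (h :* e) :+ b :* (t' :* (h :* e))) :=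
              (h :+ h) :* (e :* a) :+ (t :+ t') :* (b :* (h :* e))) ≋-refl a b h e t t')
      (P.trans (P.+-cong (P.*-congʳ {e *ₚ a} 2h) (P.*-congʳ {b *ₚ (h *ₚ e)} tt'))
        (P.trans (P.+-identityʳ _) (P.*-identityˡ (e *ₚ a))))
    diff : (t *ₚ ((a *ₚ x +ₚ b *ₚ y) +ₚ negₚ (a *ₚ x +ₚ b *ₚ y'))) ≋ (e *ₚ b)
    diff = P.trans (solve 6 (λ a b h e t t' → t :* (a :* (h :* e) :+ b :* (t :* (h :* e)) :- (a :* (h :* e) :+ b :* (t' :* (h :* e)))) :=
              t :* t :* ((h :+ h) :* (e :* b)) :- (t :+ t') :* (t :* b :* (h :* e))) ≋-refl a b h e t t')
      (P.trans (P.+-cong (P.*-cong tt (P.*-congʳ {e *ₚ b} 2h)) (P.-‿cong (P.*-congʳ {t *ₚ b *ₚ (h *ₚ e)} tt')))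
        (P.trans (P.+-identityʳ _) (P.trans (P.*-identityˡ _) (P.*-identityˡ (e *ₚ b)))))

-- The listed elements are exactly the primitive central idempotents.

module Classification (F : FiniteField) (K : Field)
    (ι : Hom (FiniteField.commRing F) (Field.commRing K))
    (n : ℕ) .{{nz : NonZero n}} (s : ℕ) (ss : (s ℕ.* s) % n ≡ 1 % n)
    (d : ℕ) (d-gcd : GCD n (s ∸ 1) d)
    (cn c2 : FiniteField.Carrier F)
    (cn-eq : IsNegInverse (FiniteField.commRing F) n cn)
    (c2-eq : FiniteField._≈_ F (FiniteField._*_ F c2 (Poly.nat (FiniteField.commRing F) 2)) (FiniteField.1# F))
    (rs : List (Field.Carrier K))
    (splits : PolynomialRing._≋_ (Field.commRing K) (Poly.xⁿ-1 (Field.commRing K) n) (Poly.prodLin (Field.commRing K) rs))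
    (splitting : SplittingTower.Splitting F K ι n cn cn-eq rs splits) where
  private
    module F = FiniteField F
    module K = Field K
    module PK = Poly K.commRing
  open FiniteField F using (commRing)
  open Poly commRing
  open PolynomialRing commRing
  open Degree commRing
  open DiscreteField F.field′ F._≟_
  open Divisibility (polyRing commRing)
  open CyclicQuotient commRing n s ss
  open GroupAlgebra commRing n s hiding (_·_)
  open GroupAlgebraModel commRing n s ss
  open MonomialAlgebra groupAlgebra using (⋆-cong)
  open PrimitiveIdempotents F n s ss d d-gcd cn cn-eq
  open StarConstruction F K ι n cn cn-eq rs splits s ss splitting using (selfInvolutive; starS)
  open Theorem commRing K.commRing ι n s d cn c2 using (IsEf; IrrFactorOfQuot; Listed)
  open Involution commRing K.commRing ι s using (IsStarS; SelfInvolutive)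
  private
    module P = CommutativeRing (polyRing commRing)
    module Q = CommutativeRing Rₙ
    module FS = IntegerSolver commRing
  open IntegerSolver (polyRing commRing)

  PrimG : RG → Set
  PrimG = PrimitiveCentralIdempotent

  infixr 5 _»_
  _»_ : ∀ {a b c : RG} → a ≈G b → b ≈G c → a ≈G c
  (e » f) g = F.trans (e g) (f g)

  symG : ∀ {a b : RG} → a ≈G b → b ≈G a
  symG e g = F.sym (e g)

  PrimG-resp : ∀ {a e} → e ≈G a → PrimG a → PrimG e
  PrimG-resp {a} {e} q (c , i , nz0 , m) =
      (λ b → cong {e} {a} {b} {b} q (reflG {b}) » c b » cong {b} {b} {a} {e} (reflG {b}) (symG {e} {a} q))
    , cong {e} {a} {e} {a} q q » i » symG {e} {a} q
    , (λ e0 → nz0 (symG {e} {a} q » e0))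
    , λ e' c' i' l → Sum.map (λ x → x) (λ x → x » symG {e} {a} q)
        (m e' c' i' (cong {a} {e} {e'} {e'} (symG {e} {a} q) (reflG {e'}) » l))
    where
    cong : ∀ {a a' b b'} → a ≈G a' → b ≈G b' → a ⋆ b ≈G a' ⋆ b'
    cong {a} {a'} {b} {b'} = ⋆-cong {a} {a'} {b} {b'}
    reflG : ∀ {a : RG} → a ≈G a
    reflG g = F.refl

  pci⇒ : ∀ {z e} → e ≈G Φ z → PCI z → PrimG e
  pci⇒ {z} {e} q p = PrimG-resp {Φ z} {e} q (Equivalence.to pci⇔ p)

  half : Pol
  half = c2 ∷ []

  half+half : (half +ₚ half) ≋ oneₚ
  half+half = ∷-cong (F.trans (FS.solve 1 (λ c → c FS.:+ c FS.:= c FS.:* (FS.:1 FS.:+ (FS.:1 FS.:+ FS.:0))) F.refl c2) c2-eq) ≋-refl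

  σ-half : compose half ≋ half
  σ-half = Evaluation.eval-const (constHom commRing) (xpow s) c2

  data PlusMinus : Set where
    plus minus : PlusMinus

  sgn : PlusMinus → Pol
  sgn plus  = oneₚ
  sgn minus = negₚ oneₚ

  sgn² : ∀ t → (sgn t *ₚ sgn t) ≋ oneₚ
  sgn² plus  = P.*-identityˡ oneₚ
  sgn² minus = solve 0 (:- :1 :* (:- :1) := :1) ≋-refl

  σ-sgn : ∀ t → compose (sgn t) ≋ sgn t
  σ-sgn plus  = Hom.1-hom composeHom
  σ-sgn minus = P.trans (HomProperties.neg-hom composeHom oneₚ) (P.-‿cong (Hom.1-hom composeHom))

  halfG : PlusMinus → RG
  halfG plus  = scaleG c2 (1G +G yG)
  halfG minus = scaleG c2 (1G +G (-G yG))

  E± : PlusMinus → Pol → A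
  E± t e = half *ₚ e , sgn t *ₚ (half *ₚ e)

  halfG≈ : ∀ t → halfG t ≈G Φ (half , sgn t *ₚ half)
  halfG≈ t = pointwise t » Φ-cong {half , signed t} {half , sgn t *ₚ half} (mkᴬ (≈⇒≈/ ≋-refl) (≈⇒≈/ (coeffs t)))
    where
    signed : PlusMinus → Pol
    signed plus  = half
    signed minus = negₚ half
    coeffs : ∀ t → signed t ≋ (sgn t *ₚ half)
    coeffs plus  = P.sym (P.*-identityˡ half)
    coeffs minus = solve 1 (λ h → :- h := :- :1 :* h) ≋-refl half
    pointwise : ∀ t → halfG t ≈G Φ (half , signed t)
    pointwise plus  g = FS.solve 3 (λ c x y → c FS.:* (x FS.:+ y) FS.:= c FS.:* x FS.:+ FS.:0 FS.:+ (c FS.:* y FS.:+ FS.:0)) F.refl c2 (1G g) (yG g)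
    pointwise minus g = FS.solve 3 (λ c x y → c FS.:* (x FS.:+ FS.:- y) FS.:= c FS.:* x FS.:+ FS.:0 FS.:+ (FS.:- c FS.:* y FS.:+ FS.:0)) F.refl c2 (1G g) (yG g)

  -- The condition σ(e) = e lets e move past y, which brings the product into the shape treated by
  -- `pci-split`.
  split-idempotent : ∀ t {e ef} → compose e ≈/ e → ef ≈G toRG e → halfG t ⋆ ef ≈G Φ (E± t e)
  split-idempotent t {e} {ef} Se q =
      ⋆-cong {halfG t} {Φ (half , y)} {ef} {Φ (e , [])} (halfG≈ t) (q » symG {Φ (e , [])} {toRG e} (Φ-pure e))
    » Φ-· (half , y) (e , [])
    » Φ-cong (mkᴬ (≈⇒≈/ (P.trans (P.+-congˡ {half *ₚ e} (*ₚ-zeroʳ y)) (P.+-identityʳ _)))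
        (Q.trans
          (Q.trans (≈⇒≈/ (P.+-congʳ {y *ₚ compose e} (*ₚ-zeroʳ half)))
            (Q.*-congˡ {y} {compose e} {e} Se)) (≈⇒≈/ (P.*-assoc (sgn t) half e))))
    where y = sgn t *ₚ half

  pci± : ∀ t {f e} → IsE f e → Irr f → f ∣ xⁿ-1 d → PCI (E± t e)
  pci± t {f} {e} I irr fd = pci-case₁ {f} {e} I irr fd {half} {sgn t} half+half σ-half (sgn² t) (σ-sgn t)

  -- Otherwise a Bézout identity for f and p, evaluated at the common root, would read 1 = 0 in K.
  common-root : ∀ {f p} → Irr f → ∀ a → eval ι a f K.≈ K.0# → eval ι a p K.≈ K.0# → f ∣ p
  common-root {f} {p} irr a fa pa = [ (λ x → x) , (λ (u , v , e) → ⊥-elim (absurd u v e)) ]′ (irreducible-dichotomy irr p)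
    where
    module Ev = Evaluation ι a
    absurd : ∀ u v → (u *ₚ f +ₚ v *ₚ p) ≋ oneₚ → ⊥
    absurd u v e = K.1≉0 (K.trans (K.sym (Hom.1-hom (evalHom ι a))) (K.trans (Ev.eval-cong {oneₚ} {u *ₚ f +ₚ v *ₚ p} (P.sym e))
      (K.trans (Ev.eval-+ (u *ₚ f) (v *ₚ p)) (K.trans (K.+-cong
        (K.trans (Ev.eval-* u f) (K.trans (K.*-congˡ fa) (K.zeroʳ _)))
        (K.trans (Ev.eval-* v p) (K.trans (K.*-congˡ pa) (K.zeroʳ _)))) (K.+-identityˡ K.0#)))))

  member-vanishes : ∀ {f as a} → map (Hom.⟦_⟧ ι) f PK.≈ₚ PK.prodLin as → a PK.∈ as → eval ι a f K.≈ K.0#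
  member-vanishes {f} {as} {a} e m = K.trans (K.sym (evalAt-map ι a f)) (K.trans
    (Evaluation.eval-cong (idHom K.commRing) a {map (Hom.⟦_⟧ ι) f} {PK.prodLin as} (PolynomialRing.mk≋ e)) (LinearFactors.member-root K.commRing {a} {as} m))

  -- With an empty list f would map to 1; its degree would then be 0, and a monic f of degree 0 is
  -- the unit 1.
  some-root : ∀ {f as} → Irr f → Monic f → map (Hom.⟦_⟧ ι) f PK.≈ₚ PK.prodLin as → ∃ λ a → a PK.∈ as
  some-root {f} {a ∷ as} irr mf e = a , here K.refl
  some-root {f} {[]}     irr mf e = ⊥-elim (∤1 irr (∣-reflexive (trivial (Monic⇒ mf))))
    where
    trivial : (∃ λ m → MonicOfDegree m f) → f ≋ oneₚ
    trivial (m , M) = monic0 (≡.subst (λ k → MonicOfDegree k f)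
      (Degree.monic-degree-unique K.commRing K.1≉0 (monic-map ι M)
        (Degree.monic-resp K.commRing (CommutativeRing.sym (polyRing K.commRing) {map (Hom.⟦_⟧ ι) f} {PK.oneₚ} (PolynomialRing.mk≋ e)) (Degree.monic-one K.commRing))) M)

  self-involutive⇒ : ∀ {f} → Irr f → Monic f → SelfInvolutive f → f ∣ compose f
  self-involutive⇒ {f} irr mf (as , e , closed , _) = go (some-root {f} {as} irr mf e)
    where
    go : (∃ λ a → a PK.∈ as) → f ∣ compose f
    go (a , m) = common-root irr a (member-vanishes {f} {as} e m)
      (K.trans (eval-compose ι s a f) (member-vanishes {f} {as} e (closed a m)))

  -- A single root a of f suffices: a^s is a root of h, which makes f divide h(x^s); then (a^s)^s =
  -- a is a root of f, which makes h divide f(x^s).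
  star⇒ : ∀ {f h} → Irr f → Irr h → Monic f → f ∣ N → IsStarS f h → (f ∣ compose h) × (h ∣ compose f)
  star⇒ {f} {h} irf irh mf fN (_ , as , e , e') = go (some-root {f} {as} irf mf e)
    where
    pow-member : ∀ {a} as → a PK.∈ as → PK.pow a s PK.∈ map (λ a → PK.pow a s) as
    pow-member (b ∷ as) (here q)  = here (Powers.pow-cong K.commRing q s)
    pow-member (b ∷ as) (there m) = there (pow-member as m)
    go : (∃ λ a → a PK.∈ as) → (f ∣ compose h) × (h ∣ compose f)
    go (a , m) = common-root irf a fa (K.trans (eval-compose ι s a h) ha)
      , common-root irh (PK.pow a s) ha (K.trans (eval-compose ι s (PK.pow a s) f)
          (K.trans (power-eval f) fa))
      where
      fa : eval ι a f K.≈ K.0#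
      fa = member-vanishes {f} {as} e m
      ha : eval ι (PK.pow a s) h K.≈ K.0#
      ha = member-vanishes {h} {map (λ a → PK.pow a s) as} e' (pow-member as m)
      aⁿ : PK.pow a n K.≈ K.1#
      aⁿ = K.trans (KS.solve 1 (λ x → x KS.:= x KS.:- KS.:1 KS.:+ KS.:1) K.refl (PK.pow a n))
        (K.trans (K.+-congʳ (K.trans (K.sym (Evaluation.eval-xⁿ-1 ι a n)) (K.trans
          (Evaluation.eval-cong ι a {N} {f *ₚ cofactor fN} (P.sym (product fN)))
          (K.trans (Evaluation.eval-* ι a f (cofactor fN)) (K.trans (K.*-congʳ fa) (K.zeroˡ _)))))) (K.+-identityˡ K.1#))
        where module KS = IntegerSolver K.commRing
      power-eval : ∀ p → eval ι (PK.pow (PK.pow a s) s) p K.≈ eval ι a p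
      power-eval []      = K.refl
      power-eval (c ∷ p) = K.+-congˡ (K.*-cong (Powers.pow-involution K.commRing {a} aⁿ {s} ss) (power-eval p))

  quot-factor⇒ : ∀ {f} → IrrFactorOfQuot f → Monic f × Irr f × f ∣ N × (¬ (f ∣ xⁿ-1 d))
  quot-factor⇒ {f} (mf , irr , q , e , (w , fw)) = mf , I , ∣-trans {f} {q} {N} (w by mk≋ fw) (xⁿ-1 d by mk≋ e) ,
      quotient-factor⇒¬∣ {f} {q} I (mk≋ e) (w by mk≋ fw)
    where I = Irreducible⇒Irr irr

  ⇒quot-factor : ∀ {f} → Monic f → Irr f → f ∣ N → ¬ (f ∣ xⁿ-1 d) → IrrFactorOfQuot f
  ⇒quot-factor {f} mf irr fN nd = let (q , e , (w by fw)) = ¬∣⇒quotient-factor irr fN nd in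
    mf , Irr⇒Irreducible irr , q , at e , (w , at fw)

  isEf⇒ : ∀ {f e} → Monic f → IsEf f e → ∃ λ p → IsE f p × (e ≈G toRG p)
  isEf⇒ {f} mf (g , fg , e) = efPoly cn f g , efPoly-IsE mf (mk≋ fg) , e

  listed⇒pci : ∀ e → Listed e → PrimG e
  listed⇒pci e (inj₁ (f , ef , mf , irr , (w , fd) , If , eq)) = go (isEf⇒ {f} {ef} mf If)
    where
    fd' : f ∣ xⁿ-1 d
    fd' = w by mk≋ fd
    go : (∃ λ p → IsE f p × (ef ≈G toRG p)) → PrimG e
    go (p , I , q) = [ (λ x → pci⇒ {E± plus p} {e} (x » split-idempotent plus {p} {ef} Sp q) (pci± plus I irr' fd'))
                     , (λ x → pci⇒ {E± minus p} {e} (x » split-idempotent minus {p} {ef} Sp q) (pci± minus I irr' fd')) ]′ eq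
      where
      irr' = Irreducible⇒Irr irr
      Sp = ∣xᵈ-1⇒σ-e I fd'
  listed⇒pci e (inj₂ (inj₁ (f , Qf , self , If))) =
    let (mf , irr , fN , nd) = quot-factor⇒ Qf
        (p , I , q) = isEf⇒ {f} {e} mf If
    in pci⇒ {p , []} {e} (q » symG {Φ (p , [])} {toRG p} (Φ-pure p)) (pci-case₂ I irr nd (self-involutive⇒ {f} irr mf self))
  listed⇒pci e (inj₂ (inj₂ (f , h , ef , eh , Qf , Qh , star , ne , If , Ih , eq))) =
    let (mf , irf , fN , nd) = quot-factor⇒ Qf
        (mh , irh , _ , _)   = quot-factor⇒ Qh
        (p , I , q)    = isEf⇒ {f} {ef} mf If
        (p' , I' , q') = isEf⇒ {h} {eh} mh Ih
        (fh , hf)      = star⇒ {f} {h} irf irh mf fN star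
    in pci⇒ {p +ₚ p' , []} {e} (eq » sum-pure p p' {ef} {eh} q q')
         (pci-case₃ I I' irf irh mf mh (λ z → ne (at z)) nd fh hf)
    where
    sum-pure : ∀ p p' {ef eh} → ef ≈G toRG p → eh ≈G toRG p' → (ef +G eh) ≈G Φ (p +ₚ p' , [])
    sum-pure p p' q q' g = F.trans (F.+-cong (F.trans (q g) (F.sym (Φ-pure p g))) (F.trans (q' g) (F.sym (Φ-pure p' g)))) (F.sym (Φ-pure-+ p p' g))

  private
    opposite : PlusMinus → PlusMinus
    opposite plus  = minus
    opposite minus = plus

    sgn-opposite : ∀ t → (sgn t +ₚ sgn (opposite t)) ≋ []
    sgn-opposite plus  = P.-‿inverseʳ oneₚ
    sgn-opposite minus = P.-‿inverseˡ oneₚ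

    σ-E± : ∀ t {e} → compose e ≈/ e → compose (sgn t *ₚ (half *ₚ e)) ≈/ (sgn t *ₚ (half *ₚ e))
    σ-E± t {e} Se = Q.trans
      (≈⇒≈/ (P.trans (Hom.*-hom composeHom (sgn t) (half *ₚ e)) (P.*-congˡ {compose (sgn t)} (Hom.*-hom composeHom half e))))
      (Q.*-cong {compose (sgn t)} {sgn t} {compose half *ₚ compose e} {half *ₚ e} (≈⇒≈/ (σ-sgn t))
        (Q.*-cong {compose half} {half} {compose e} {e} (≈⇒≈/ σ-half) Se))

  listed₁ : ∀ t {e f g z} → Monic f → Irr f → (fg : (f *ₚ g) ≋ N) → f ∣ xⁿ-1 d → Φ z ≈G e →
            z ≈ᴬ E± t (efPoly cn f g) → Listed e
  listed₁ t {e} {f} {g} {z} mf irr fg fd q zE = inj₁ (f , toRG (efPoly cn f g) , mf , Irr⇒Irreducible irr ,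
      (cofactor fd , at (product fd)) , (g , at fg , λ _ → F.refl) , choose t equation)
    where
    equation : e ≈G halfG t ⋆ toRG (efPoly cn f g)
    equation = symG {Φ z} {e} q » Φ-cong {z} {E± t (efPoly cn f g)} zE » symG {halfG t ⋆ toRG (efPoly cn f g)} {Φ (E± t (efPoly cn f g))}
      (split-idempotent t {efPoly cn f g} {toRG (efPoly cn f g)} (∣xᵈ-1⇒σ-e (efPoly-IsE mf fg) fd) (λ _ → F.refl))
    choose : ∀ t → e ≈G halfG t ⋆ toRG (efPoly cn f g) →
      e ≈G halfG plus ⋆ toRG (efPoly cn f g) ⊎ e ≈G halfG minus ⋆ toRG (efPoly cn f g)
    choose plus  = inj₁
    choose minus = inj₂

  -- A factor f modulo which the element is nonzero selects the candidate: whether f divides x^d -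
  -- 1, and if not, whether it divides f(x^s), decides the type. The candidate has a nonzero product
  -- with the given idempotent, so `pci-unique` identifies the two.
  pci⇒listed : ∀ e → PrimG e → Listed e
  pci⇒listed e pe = start (Φ-surjective e)
    where
    start : (∃ λ z → Φ z ≈G e) → Listed e
    start ((a , b) , q) = found (component a b (nonzero pz))
      where
      z : A
      z = a , b
      pz : PCI z
      pz = Equivalence.from pci⇔ (PrimG-resp {e} {Φ z} q pe)
      found : (∃ λ f → Monic f × Irr f × f ∣ N × Missed a b f) → Listed e
      found (f , mf , irr , (g by fg) , (fN , missed)) = by-d (f ∣? xⁿ-1 d)
        where
        ef : Pol
        ef = efPoly cn f g
        I : IsE f ef
        I = efPoly-IsE mf fg
        by-d : Dec (f ∣ xⁿ-1 d) → Listed e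
        by-d (yes fd) = by-sign (≈ᴬ0? (z · E± plus ef)) (≈ᴬ0? (z · E± minus ef))
          where
          Se = ∣xᵈ-1⇒σ-e I fd
          by-sign : Dec (z · E± plus ef ≈ᴬ 0ᴬ) → Dec (z · E± minus ef ≈ᴬ 0ᴬ) → Listed e
          by-sign (no nz₊)  _        = listed₁ plus {e} {f} {g} {z} mf irr fg fd q (pci-unique pz (pci± plus I irr fd) nz₊)
          by-sign (yes _)  (no nz₋)  = listed₁ minus {e} {f} {g} {z} mf irr fg fd q (pci-unique pz (pci± minus I irr fd) nz₋)
          by-sign (yes x)  (yes y)   = ⊥-elim (split-product≉0 {a} {b} {f} {ef} {half} {sgn plus} {sgn minus} I half+half (sgn-opposite plus) (sgn² plus)
            (σ-E± plus Se) (σ-E± minus Se) missed x y)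
        by-d (no nd) = by-self (f ∣? compose f)
          where
          Qf = ⇒quot-factor mf irr fN nd
          by-self : Dec (f ∣ compose f) → Listed e
          by-self (yes ff) = inj₂ (inj₁ (f , Qf , selfInvolutive (proj₂ (Monic⇒ mf)) fN ff ,
              (g , at fg , symG {Φ z} {e} q » Φ-cong {z} {ef , []} (pci-unique pz (pci-case₂ I irr nd ff)
                 (pure-product≉0 {a} {b} {f} {ef} {ef} I (e-idem I) (σ-e I I ff ff) missed)) » Φ-pure ef)))
          by-self (no nff) = conj (conjugate irr fN)
            where
            conj : Conjugate f → Listed e
            conj C = inj₂ (inj₂ (f , h , toRG ef , toRG eh , Qf ,
                ⇒quot-factor monic irr-h h∣N (conjugate-¬∣ irr irr-h fN h∣N f∣σh h∣σf nff) ,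
                starS (proj₂ (Monic⇒ mf)) (proj₂ (Monic⇒ monic)) monic fN h∣N f∣σh h∣σf ,
                (λ x → f≉h (mk≋ x)) , (g , at fg , λ _ → F.refl) , (cofactor h∣N , at (product h∣N) , λ _ → F.refl) ,
                (symG {Φ z} {e} q » Φ-cong {z} {ef +ₚ eh , []} z≈ » Φ-pure-+ ef eh » sum)))
              where
              open Conjugate C
              eh : Pol
              eh = efPoly cn h (cofactor h∣N)
              Ih : IsE h eh
              Ih = efPoly-IsE monic (product h∣N)
              f≉h : ¬ (f ≋ h)
              f≉h x = nff (∣-trans (∣-reflexive x) h∣σf)
              orth : (ef *ₚ eh) ≈/ []
              orth = orthogonal I Ih irr irr-h mf monic f≉h
              z≈ : z ≈ᴬ (ef +ₚ eh , [])
              z≈ = pci-unique pz (pci-case₃ I Ih irr irr-h mf monic f≉h nd f∣σh h∣σf)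
                (pure-product≉0 {a} {b} {f} {ef} {ef +ₚ eh} I
                  (Q.trans (≈⇒≈/ (P.distribˡ ef ef eh))
                    (Q.trans (Q.+-cong {ef *ₚ ef} {ef} {ef *ₚ eh} {[]} (e-idem I) orth) (≈⇒≈/ (P.+-identityʳ ef))))
                  (Q.trans (≈⇒≈/ (Hom.+-hom composeHom ef eh))
                    (Q.trans
                      (Q.+-cong {compose ef} {eh} {compose eh} {ef} (σ-e Ih I h∣σf f∣σh) (σ-e I Ih f∣σh h∣σf)) (≈⇒≈/ (P.+-comm eh ef))))
                  missed)
              sum : (Φ (ef , []) +G Φ (eh , [])) ≈G (toRG ef +G toRG eh)
              sum x = F.+-cong (Φ-pure ef x) (Φ-pure eh x)

  classification : ∀ e → PrimG e ⇔ Listed e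
  classification e = mk⇔ (pci⇒listed e) (listed⇒pci e)

-- Comparison and search are carried out on the indices in `Fin q`.
finiteField : ∀ {q} (F : Field) → Bijection (CommutativeRing.setoid (Field.commRing F)) (≡.setoid (Fin q)) → FiniteField
finiteField F bij = record
  { field′ = F
  ; _≟_    = λ x y → map′ injective cong (to x Finₚ.≟ to y)
  ; search = λ P resp dec → map′ (λ (i , p) → from i , p)
      (λ (x , p) → to x , resp (sym (injective (proj₂ (strictlySurjective (to x))))) p)
      (Finₚ.any? (λ i → dec (from i))) }
  where
  open Field F using (Carrier; sym)
  open Bijection bij using (to; cong; injective; strictlySurjective)
  from : Fin _ → Carrier
  from i = proj₁ (strictlySurjective i)

open import Data.Nat using (_*_)
open ≡ using (setoid)

theorem5p3 : (q : ℕ) → IsPrimePower q →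
    (F : Field) → Bijection (CommutativeRing.setoid (Field.commRing F)) (setoid (Fin q)) →
    (n : ℕ) → .{{_ : NonZero n}} → (s : ℕ) →
    (s * s) % n ≡ 1 % n →
    gcd (2 * n) q ≡ 1 →
    (K : Field) → (ι : Hom (Field.commRing F) (Field.commRing K)) →
    Σ (List (Field.Carrier K))
    (λ rs → Poly._≈ₚ_ (Field.commRing K) (map (Hom.⟦_⟧ ι) (Poly.xⁿ-1 (Field.commRing F) n))
    (Poly.prodLin (Field.commRing K) rs)) →
    (cn c2 : Field.Carrier F) →
    Field._≈_ F (Field._*_ F cn (Poly.nat (Field.commRing F) n)) (Field.-_ F (Field.1# F)) →
    Field._≈_ F (Field._*_ F c2 (Poly.nat (Field.commRing F) 2)) (Field.1# F) →
    (e : GroupAlgebra.RG (Field.commRing F) n s) →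
    GroupAlgebra.PrimitiveCentralIdempotent (Field.commRing F) n s e
    ⇔ Theorem.Listed (Field.commRing F) (Field.commRing K) ι n s (gcd n (s ∸ 1)) cn c2 e
theorem5p3 q _ F bij n s ss _ K ι (rs , rs-eq) cn c2 cn-eq c2-eq =
  Classification.classification F′ K ι n s ss (gcd n (s ∸ 1)) (gcd-GCD n (s ∸ 1)) cn c2 cn-eq c2-eq rs splits
    (SplittingTower.splitting F′ K ι n cn cn-eq rs splits)
  where
  F′ : FiniteField
  F′ = finiteField F bij
  module KP = CommutativeRing (polyRing (Field.commRing K))
  splits : PolynomialRing._≋_ (Field.commRing K) (Poly.xⁿ-1 (Field.commRing K) n) (Poly.prodLin (Field.commRing K) rs)
  -- As `ι` maps xⁿ - 1 to xⁿ - 1, the given factorisation is one of xⁿ - 1 over K itself.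
  splits = KP.trans (KP.sym (MapPolynomial.map-xⁿ-1 ι n)) (PolynomialRing.mk≋ rs-eq)
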